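{- Let $$S_6=\{(1,0,-1,-3),(1,1,-1,-3),(1,2,-1,-3),(1,3,-1,-3),(1,4,-1,-4),(2,0,0,-2),(2,1,0,-2),(2,2,0,-2),(2,3,0,-3),(2,4,0,-3),(1,1,0,-3),(1,2,0,-3),(1,3,0,-3),(1,4,0,-3)\}.$$ If $(t_1,t_2,t_3,t_4)\in S_6$, then for all integers $n\geq 0$, $$a_{1^{t_1}2^{t_2}3^{t_3}4^{t_4}}(4n)>0,\qquad a_{1^{t_1}2^{t_2}3^{t_3}4^{t_4}}(4n+1)<0,$$ $$a_{1^{t_1}2^{t_2}3^{t_3}4^{t_4}}(4n+2)<0,\qquad a_{1^{t_1}2^{t_2}3^{t_3}4^{t_4}}(4n+3)>0.$$
   Context: For $|q|<1$ (or as formal power series in $q$) let $f_j:=(q^j;q^j)_\infty=\prod_{k\ge 1}(1-q^{jk})$ for each positive integer $j$. For a positive integer $m$ and integers $t_1,\dots,t_m$ (possibly zero or negative), the integers $a_{1^{t_1}2^{t_2}\cdots m^{t_m}}(n)$, $n\ge 0$, are defined by $\sum_{n=0}^\infty a_{1^{t_1}2^{t_2}\cdots m^{t_m}}(n)q^n=f_1^{t_1}f_2^{t_2}\cdots f_m^{t_m}$. -}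

module Defs where

open import Algebra.Bundles.Raw using (RawMonoid)
import Algebra.Definitions.RawMonoid as RawMonoidDefinitions
import Algebra.Properties.CommutativeMonoid.Sum as Sum
open import Data.Fin.Base using (Fin; zero; suc; toℕ)
open import Data.Integer.Base using (ℤ; +_; -[1+_]; -_; _+_; _-_; _*_; 0ℤ; 1ℤ)
import Data.Integer.Properties as ℤ
open import Data.List.Base using (List; []; _∷_)
open import Data.Nat.Base as ℕ using (ℕ; zero; suc; NonZero; _≤_; _<_; s≤s; _∸_; _≤′_; ≤′-refl; ≤′-step)
import Data.Nat.Properties as ℕ
open import Data.Product.Base using (_×_; _,_)
open import Data.Vec.Base as Vec using (Vec; lookup)
open import Data.Vec.Functional using (Vector)
open import Level using (0ℓ)
open import Relation.Binary.PropositionalEquality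
open import Relation.Nullary.Decidable using (does; dec-false)
open import Data.Bool.Base using (if_then_else_)

open Sum ℤ.+-0-commutativeMonoid using (sum; sum⁺-syntax; sum-cong-≗; sum-replicate-zero)

-- A formal power series in q over ℤ, as its coefficient function.
Series : Set
Series = ℕ → ℤ

infix 9 q^_

q^_ : ℕ → Series
(q^ m) n = if does (m ℕ.≟ n) then 1ℤ else 0ℤ

𝟙 : Series
𝟙 = q^ 0

infixl 6 _⊖_

_⊖_ : Series → Series → Series
(g ⊖ h) n = g n - h n

infixl 7 _⊛_

_⊛_ : Series → Series → Series
(g ⊛ h) n = ∑[ i ≤ n ] (g (toℕ i) * h (n ∸ toℕ i))

⊛-rawMonoid : RawMonoid 0ℓ 0ℓ
⊛-rawMonoid = record { Carrier = Series ; _≈_ = _≗_ ; _∙_ = _⊛_ ; ε = 𝟙 }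

open RawMonoidDefinitions ⊛-rawMonoid using () renaming (sum to ∏; _×_ to power)

-- The coefficients of 1/g up to degree n, highest degree first, obtained by
-- solving g ⊛ h = 1 for one coefficient of h at a time.  This assumes that g
-- has constant term 1; see ⊛-inverse.
inversePrefix : Series → (n : ℕ) → Vec ℤ (suc n)
inversePrefix g zero    = 1ℤ Vec.∷ Vec.[]
inversePrefix g (suc n) = - (∑[ i ≤ n ] (g (suc (toℕ i)) * lookup h i)) Vec.∷ h
  where h = inversePrefix g n

infix 9 _⁻¹

_⁻¹ : Series → Series
(g ⁻¹) n = Vec.head (inversePrefix g n)

infixr 8 _^_

_^_ : Series → ℤ → Series
g ^ (+ n)    = power n g
g ^ -[1+ n ] = power (suc n) (g ⁻¹)

-- ∏_{k=1}^{N} (1 - q^{jk})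
partialProduct : ℕ → ℕ → Series
partialProduct j zero    = 𝟙
partialProduct j (suc N) = (𝟙 ⊖ q^ (j ℕ.* suc N)) ⊛ partialProduct j N

-- f j = (q^j; q^j)_∞ for j ≥ 1.  The factors with k > n do not affect the
-- coefficient of q^n, so that coefficient of the infinite product is read off
-- from the n-th partial product; see partialProduct-stable.
f : ℕ → Series
f j n = partialProduct j n n

-- a t n is the coefficient of q^n in f_1^{t_1} ⋯ f_m^{t_m}.  The index i : Fin m
-- starts at 0, so t i is the exponent of f (suc (toℕ i)).
a : ∀ {m} → Vector ℤ m → ℕ → ℤ
a t = ∏ λ i → f (suc (toℕ i)) ^ t i

S₆ : List (ℤ × ℤ × ℤ × ℤ)
S₆ = (+ 1 , + 0 , - + 1 , - + 3)
   ∷ (+ 1 , + 1 , - + 1 , - + 3)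
   ∷ (+ 1 , + 2 , - + 1 , - + 3)
   ∷ (+ 1 , + 3 , - + 1 , - + 3)
   ∷ (+ 1 , + 4 , - + 1 , - + 4)
   ∷ (+ 2 , + 0 , + 0 , - + 2)
   ∷ (+ 2 , + 1 , + 0 , - + 2)
   ∷ (+ 2 , + 2 , + 0 , - + 2)
   ∷ (+ 2 , + 3 , + 0 , - + 3)
   ∷ (+ 2 , + 4 , + 0 , - + 3)
   ∷ (+ 1 , + 1 , + 0 , - + 3)
   ∷ (+ 1 , + 2 , + 0 , - + 3)
   ∷ (+ 1 , + 3 , + 0 , - + 3)
   ∷ (+ 1 , + 4 , + 0 , - + 3)
   ∷ []

lookup-inversePrefix : ∀ g n (i : Fin (suc n)) →
                       lookup (inversePrefix g n) i ≡ (g ⁻¹) (n ∸ toℕ i)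
lookup-inversePrefix g zero    zero    = refl
lookup-inversePrefix g (suc n) zero    = refl
lookup-inversePrefix g (suc n) (suc i) = lookup-inversePrefix g n i

⊛-inverse : ∀ g → g 0 ≡ 1ℤ → g ⊛ g ⁻¹ ≗ 𝟙
⊛-inverse g g₀≡1 zero    rewrite g₀≡1 = refl
⊛-inverse g g₀≡1 (suc n) = begin
  g 0 * (- s) + s′   ≡⟨ cong₂ _+_ (cong (_* (- s)) g₀≡1) s′≡s ⟩
  1ℤ * (- s) + s     ≡⟨ cong (_+ s) (ℤ.*-identityˡ (- s)) ⟩
  - s + s            ≡⟨ ℤ.+-inverseˡ s ⟩
  0ℤ                 ∎
  where
  open ≡-Reasoning
  s s′ : ℤ
  s  = ∑[ i ≤ n ] (g (suc (toℕ i)) * lookup (inversePrefix g n) i)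
  s′ = ∑[ i ≤ n ] (g (suc (toℕ i)) * (g ⁻¹) (n ∸ toℕ i))
  s′≡s : s′ ≡ s
  s′≡s = sum-cong-≗ {suc n} λ i →
    cong (g (suc (toℕ i)) *_) (sym (lookup-inversePrefix g n i))

q^-vanishes : ∀ {m n} → n < m → (q^ m) n ≡ 0ℤ
q^-vanishes {m} {n} n<m rewrite dec-false (m ℕ.≟ n) (ℕ.>⇒≢ n<m) = refl

1-q^m-⊛ : ∀ m g n → n < m → ((𝟙 ⊖ q^ m) ⊛ g) n ≡ g n
1-q^m-⊛ m g n n<m = begin
  h 0 * g n + sum (λ (i : Fin n) → h (suc (toℕ i)) * g (n ∸ suc (toℕ i)))
    ≡⟨ cong₂ _+_ (cong (_* g n) h₀) (sum-cong-≗ {n} tail-vanishes) ⟩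
  1ℤ * g n + sum (λ (i : Fin n) → 0ℤ)
    ≡⟨ cong₂ _+_ (ℤ.*-identityˡ (g n)) (sum-replicate-zero n) ⟩
  g n + 0ℤ
    ≡⟨ ℤ.+-identityʳ (g n) ⟩
  g n ∎
  where
  open ≡-Reasoning
  open import Data.Fin.Properties using (toℕ<n)
  h : Series
  h = 𝟙 ⊖ q^ m
  h₀ : h 0 ≡ 1ℤ
  h₀ = cong (λ c → 1ℤ - c) (q^-vanishes (ℕ.≤-<-trans ℕ.z≤n n<m))
  tail-vanishes : ∀ (i : Fin n) → h (suc (toℕ i)) * g (n ∸ suc (toℕ i)) ≡ 0ℤ
  tail-vanishes i = cong (λ c → (0ℤ - c) * g (n ∸ suc (toℕ i)))
                         (q^-vanishes (ℕ.≤-<-trans (toℕ<n i) n<m))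

partialProduct-stable : ∀ j .{{_ : NonZero j}} {n N} → n ≤ N →
                        partialProduct j N n ≡ f j n
partialProduct-stable j n≤N = go (ℕ.≤⇒≤′ n≤N)
  where
  go : ∀ {n N} → n ≤′ N → partialProduct j N n ≡ f j n
  go ≤′-refl = refl
  go {n} (≤′-step {N} n≤′N) = trans
    (1-q^m-⊛ (j ℕ.* suc N) (partialProduct j N) n
      (ℕ.<-≤-trans (s≤s (ℕ.≤′⇒≤ n≤′N)) (ℕ.m≤n*m (suc N) j)))
    (go n≤′N)

f-constantTerm : ∀ j → f j 0 ≡ 1ℤ
f-constantTerm j = refl

{-# OPTIONS --safe #-}

-- By Jacobi's triple product identity f₁² = f₂ θ, f₁ = (f₂/f₄) θ and f₁/f₃ = (f₂/f₆²) θ for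
-- theta series θ = ∑ (-1)ⁿ q^{e(n)} in which e(n) has the parity of n.  Hence each of the
-- fourteen products is K(q²) θ(q), its even part is K times a theta series with positive
-- signs, and so is its odd part, up to sign.  The claim says that these parts (the odd one
-- negated) have positive coefficients after q ↦ -q.  This turns f₁ into (-q; q²)_∞ f₂, and a
-- second use of the triple product identity leaves only factors 1 + q^a and 1 / (1 - q^a) and
-- theta series with positive signs.  The triple product identity itself is the q-adic limit of
-- its finite form with Gaussian binomial coefficients.

module Submission where

open import Algebra.Bundles using (CommutativeMonoid; CommutativeSemiring)
open import Data.Integer.Base as ℤ using (ℤ; +_; -_; 0ℤ; 1ℤ; -1ℤ)
import Data.Integer.Properties as ℤ
import Data.Integer.Solver as ℤ
open import Data.List.Relation.Unary.Any using (here; there)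
open import Data.Nat.Base as ℕ using (ℕ; zero; suc; z≤n; s≤s; NonZero)
open import Data.Nat.DivMod using (m≡m%n+[m/n]*n; m%n<n)
import Data.Nat.Properties as ℕ
import Data.Nat.Solver as ℕ
open import Data.Product.Base using (∃; _,_)
open import Data.Sum.Base using (_⊎_; inj₁; inj₂)
open import Function.Base using (_∘_)
open import Level using (0ℓ)
open import Relation.Binary.PropositionalEquality
  using (_≡_; _≗_; refl; sym; trans; cong; cong₂; subst; _→-setoid_; module ≡-Reasoning)
open import Relation.Nullary.Decidable using (yes; no)

-- Positivity must be strict, and a product of nonnegative factors may have gaps. So each case keeps
-- a pair of factors that reaches every degree: `o = (-q; q²)_∞`, positive at all odd degrees, with
-- a series positive at 0 and 1; or some 1/(q^c; ...)_∞, positive at all multiples of c, with a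
-- series positive at 0, ..., c - 1. Every other factor is nonnegative with positive constant term.
-- Signs resist in three places. For t₁ = 1, t₃ = 0 the dissected theta series have odd parameters
-- (3, 5) and (7, 1), so q ↦ -q makes them signed; one `o` is spent on cancelling this. For t₃ = -1
-- the factor 1/f₃² of K leaves 1/(-q³; q⁶)_∞ twice; each is absorbed by an `o`, and for (1, 0, -1,
-- -3), where there is only one `o`, by the theta series ∑ q^{n(3n+1)/2}. A surplus f₂ is absorbed
-- by two `o` into ∑ q^{n²}. Identities between infinite objects are proved up to degree d for every
-- d, so no notion of limit is required.

module Convolution {c ℓ} (R : CommutativeSemiring c ℓ) where
  open CommutativeSemiring R renaming (refl to ≈-refl; sym to ≈-sym; trans to ≈-trans)
  open import Algebra.Properties.CommutativeSemigroup +-commutativeSemigroup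
    using (interchange; x∙yz≈y∙xz)

  open import Relation.Binary.Reasoning.Setoid setoid

  Sequence : Set c
  Sequence = ℕ → Carrier

  private variable
    g g′ h h′ : Sequence

  infix 4 _≋_
  _≋_ : Sequence → Sequence → Set ℓ
  g ≋ h = ∀ n → g n ≈ h n

  -- The Cauchy product, as a recursion on the degree that peels off the constant coefficient of
  -- `g`. The ring laws then become inductions in which `g` is replaced by its tail.
  conv : Sequence → Sequence → Sequence
  conv g h zero    = g 0 * h 0
  conv g h (suc n) = g 0 * h (suc n) + conv (g ∘ suc) h n

  conv-cong-≤ : ∀ n {g g′ h h′} → (∀ m → m ℕ.≤ n → g m ≈ g′ m) → (∀ m → m ℕ.≤ n → h m ≈ h′ m) →
                conv g h n ≈ conv g′ h′ n
  conv-cong-≤ zero    p r = *-cong (p 0 z≤n) (r 0 z≤n)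
  conv-cong-≤ (suc n) p r = +-cong (*-cong (p 0 z≤n) (r (suc n) ℕ.≤-refl))
    (conv-cong-≤ n (λ m m≤n → p (suc m) (s≤s m≤n)) (λ m m≤n → r m (ℕ.m≤n⇒m≤1+n m≤n)))

  conv-cong : g ≋ g′ → h ≋ h′ → conv g h ≋ conv g′ h′
  conv-cong p r n = conv-cong-≤ n (λ m _ → p m) (λ m _ → r m)

  conv-zeroˡ : ∀ h → conv (λ _ → 0#) h ≋ λ _ → 0#
  conv-zeroˡ h zero    = zeroˡ (h 0)
  conv-zeroˡ h (suc n) = ≈-trans (+-cong (zeroˡ (h (suc n))) (conv-zeroˡ h n)) (+-identityˡ 0#)

  conv-distribʳ : ∀ k g h → conv (λ n → g n + h n) k ≋ λ n → conv g k n + conv h k n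
  conv-distribʳ k g h zero    = distribʳ (k 0) (g 0) (h 0)
  conv-distribʳ k g h (suc n) =
    ≈-trans (+-cong (distribʳ (k (suc n)) (g 0) (h 0)) (conv-distribʳ k (g ∘ suc) (h ∘ suc) n))
          (interchange _ _ _ _)

  conv-scaleˡ : ∀ x g h → conv (λ n → x * g n) h ≋ λ n → x * conv g h n
  conv-scaleˡ x g h zero    = *-assoc x (g 0) (h 0)
  conv-scaleˡ x g h (suc n) =
    ≈-trans (+-cong (*-assoc x (g 0) (h (suc n))) (conv-scaleˡ x (g ∘ suc) h n)) (≈-sym (distribˡ x _ _))

  conv-sucʳ : ∀ g h n → conv g h (suc n) ≈ h 0 * g (suc n) + conv g (h ∘ suc) n
  conv-sucʳ g h zero    = ≈-trans (+-congˡ (*-comm (g 1) (h 0))) (+-comm _ _)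
  conv-sucʳ g h (suc n) = ≈-trans (+-congˡ (conv-sucʳ (g ∘ suc) h n)) (x∙yz≈y∙xz _ _ _)

  conv-comm : ∀ g h → conv g h ≋ conv h g
  conv-comm g h zero    = *-comm (g 0) (h 0)
  conv-comm g h (suc n) = ≈-trans (+-congˡ (conv-comm (g ∘ suc) h n)) (≈-sym (conv-sucʳ h g n))

  conv-assoc : ∀ g h k → conv (conv g h) k ≋ conv g (conv h k)
  conv-assoc g h k zero    = *-assoc (g 0) (h 0) (k 0)
  conv-assoc g h k (suc n) = begin
    (g 0 * h 0) * k (suc n) + conv (λ m → g 0 * h (suc m) + conv (g ∘ suc) h m) k n
      ≈⟨ +-cong (*-assoc _ _ _) (≈-trans (conv-distribʳ k (λ m → g 0 * h (suc m)) (conv (g ∘ suc) h) n)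
           (+-cong (conv-scaleˡ (g 0) (h ∘ suc) k n) (conv-assoc (g ∘ suc) h k n))) ⟩
    g 0 * (h 0 * k (suc n)) + (g 0 * conv (h ∘ suc) k n + conv (g ∘ suc) (conv h k) n)
      ≈⟨ +-assoc _ _ _ ⟨
    (g 0 * (h 0 * k (suc n)) + g 0 * conv (h ∘ suc) k n) + conv (g ∘ suc) (conv h k) n
      ≈⟨ +-congʳ (distribˡ (g 0) _ _) ⟨
    conv g (conv h k) (suc n) ∎

  one : Sequence
  one zero    = 1#
  one (suc _) = 0#

  conv-identityˡ : ∀ g → conv one g ≋ g
  conv-identityˡ g zero    = *-identityˡ (g 0)
  conv-identityˡ g (suc n) =
    ≈-trans (+-cong (*-identityˡ (g (suc n))) (conv-zeroˡ g n)) (+-identityʳ (g (suc n)))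

-- Finite sums and products in a commutative monoid

module Big {c ℓ} (M : CommutativeMonoid c ℓ) where
  open CommutativeMonoid M renaming (refl to ≈-refl; sym to ≈-sym; trans to ≈-trans)
  open import Algebra.Properties.CommutativeSemigroup commutativeSemigroup using (interchange; x∙yz≈y∙xz)

  big : (ℕ → Carrier) → ℕ → Carrier
  big u zero    = ε
  big u (suc n) = u n ∙ big u n

  big-cong-< : ∀ {u v} N → (∀ k → k ℕ.< N → u k ≈ v k) → big u N ≈ big v N
  big-cong-< zero    p = ≈-refl
  big-cong-< (suc N) p = ∙-cong (p N ℕ.≤-refl) (big-cong-< N λ k k<N → p k (ℕ.m<n⇒m<1+n k<N))

  big-cong : ∀ {u v} N → (∀ k → u k ≈ v k) → big u N ≈ big v N
  big-cong N p = big-cong-< N λ k _ → p k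

  big-ε : ∀ N → big (λ _ → ε) N ≈ ε
  big-ε zero    = ≈-refl
  big-ε (suc N) = ≈-trans (identityˡ _) (big-ε N)

  big-∙ : ∀ u v N → big (λ k → u k ∙ v k) N ≈ big u N ∙ big v N
  big-∙ u v zero    = ≈-sym (identityˡ ε)
  big-∙ u v (suc N) = ≈-trans (∙-congˡ (big-∙ u v N)) (interchange _ _ _ _)

  big-head : ∀ u N → big u (suc N) ≈ u 0 ∙ big (u ∘ suc) N
  big-head u zero    = ≈-refl
  big-head u (suc N) = ≈-trans (∙-congˡ (big-head u N)) (x∙yz≈y∙xz _ _ _)

  big-+ : ∀ u m n → big u (m ℕ.+ n) ≈ big (λ i → u (i ℕ.+ n)) m ∙ big u n
  big-+ u zero    n = ≈-sym (identityˡ _)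
  big-+ u (suc m) n = ≈-trans (∙-congˡ (big-+ u m n)) (≈-sym (assoc _ _ _))

  big-blocks : ∀ u m N → big u (N ℕ.* m) ≈ big (λ k → big (λ i → u (i ℕ.+ k ℕ.* m)) m) N
  big-blocks u m zero    = ≈-refl
  big-blocks u m (suc N) = ≈-trans (big-+ u m (N ℕ.* m)) (∙-congˡ (big-blocks u m N))

  big-swap : ∀ (u : ℕ → ℕ → Carrier) m n →
             big (λ i → big (λ j → u i j) n) m ≈ big (λ j → big (λ i → u i j) m) n
  big-swap u zero    n = ≈-sym (big-ε n)
  big-swap u (suc m) n = ≈-trans (∙-congˡ (big-swap u m n)) (≈-sym (big-∙ (u m) _ n))

-- Gaussian binomial coefficients and the finite triple product

module FiniteTripleProduct {c ℓ} (R : CommutativeSemiring c ℓ)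
  (x y q : CommutativeSemiring.Carrier R)
  (xy≈q : CommutativeSemiring._≈_ R (CommutativeSemiring._*_ R x y) q) where
  open CommutativeSemiring R renaming (refl to ≈-refl; sym to ≈-sym; trans to ≈-trans; reflexive to ≡⇒≈)
  open import Algebra.Properties.Semiring.Exp semiring using (_^_; ^-homo-*)
  open import Algebra.Properties.CommutativeSemigroup *-commutativeSemigroup using (x∙yz≈y∙xz)
  open import Algebra.Solver.Ring.NaturalCoefficients.Default R
  open import Relation.Binary.Reasoning.Setoid setoid
  open Big +-commutativeMonoid using () renaming
      (big to ∑; big-head to ∑-head; big-cong-< to ∑-cong-<; big-cong to ∑-cong; big-∙ to ∑-+)
  open Big *-commutativeMonoid using () renaming (big to ∏)

  ∑-*ʳ : ∀ v z N → ∑ v N * z ≈ ∑ (λ k → v k * z) N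
  ∑-*ʳ v z zero    = zeroˡ z
  ∑-*ʳ v z (suc N) = ≈-trans (distribʳ z (v N) (∑ v N)) (+-congˡ (∑-*ʳ v z N))

  q^[m∸n]*q^n : ∀ {m n} → n ℕ.≤ m → q ^ (m ℕ.∸ n) * q ^ n ≈ q ^ m
  q^[m∸n]*q^n {m} {n} n≤m = ≈-trans (≈-sym (^-homo-* q (m ℕ.∸ n) n)) (≡⇒≈ (cong (q ^_) (ℕ.m∸n+n≡m n≤m)))

  -- The Gaussian binomial coefficient, built by a q-Pascal rule so that a semiring suffices. The
  -- truncation in `n ∸ s` is harmless: for `s > n` the power multiplies a zero.
  gauss : ℕ → ℕ → Carrier
  gauss zero    zero    = 1#
  gauss zero    (suc s) = 0#
  gauss (suc n) zero    = 1#
  gauss (suc n) (suc s) = gauss n (suc s) + q ^ (n ℕ.∸ s) * gauss n s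

  gauss-zero : ∀ n → gauss n 0 ≈ 1#
  gauss-zero zero    = ≈-refl
  gauss-zero (suc n) = ≈-refl

  gauss-over : ∀ {n s} → n ℕ.< s → gauss n s ≈ 0#
  gauss-over {zero}  {suc s} _         = ≈-refl
  gauss-over {suc n} {suc s} (s≤s n<s) =
    ≈-trans (+-cong (gauss-over (ℕ.m<n⇒m<1+n n<s))
          (≈-trans (*-congˡ (gauss-over n<s)) (zeroʳ _))) (+-identityˡ 0#)

  gauss-diag : ∀ n → gauss n n ≈ 1#
  gauss-diag zero    = ≈-refl
  gauss-diag (suc n) = begin
    gauss n (suc n) + q ^ (n ℕ.∸ n) * gauss n n
      ≈⟨ +-cong (gauss-over {n} ℕ.≤-refl) (*-cong (≡⇒≈ (cong (q ^_) (ℕ.n∸n≡0 n))) (gauss-diag n)) ⟩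
    0# + 1# * 1#    ≈⟨ +-identityˡ _ ⟩
    1# * 1#         ≈⟨ *-identityˡ 1# ⟩
    1#              ∎

  -- The dual q-Pascal rule: `gaussSum-x` rests on the defining rule, `gaussSum-y` on this one.
  -- Expanding by the two rules in either order, the results differ only in how the power of `q` at
  -- `gauss n (suc s)` is written.
  gauss-pascal : ∀ n s → gauss (suc n) (suc s) ≈ gauss n s + q ^ suc s * gauss n (suc s)
  gauss-pascal zero    zero    = solve 1 (λ q → con 0 :+ con 1 :* con 1
        := con 1 :+ (q :* con 1) :* con 0) ≈-refl q
  gauss-pascal zero    (suc s) = solve 1 (λ z → con 0 :+ con 1 :* con 0
        := con 0 :+ z :* con 0) ≈-refl (q ^ suc (suc s))
  gauss-pascal (suc n) zero    = begin
    gauss (suc n) 1 + q ^ suc n * 1#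
      ≈⟨ +-congʳ (gauss-pascal n 0) ⟩
    (gauss n 0 + q * 1# * gauss n 1) + q ^ suc n * 1#
      ≈⟨ +-congʳ (+-congʳ (gauss-zero n)) ⟩
    (1# + q * 1# * gauss n 1) + q * q ^ n * 1#
      ≈⟨ solve 3 (λ q p g → (con 1 :+ q :* con 1 :* g) :+ q :* p :* con 1
            := con 1 :+ q :* con 1 :* (g :+ p :* con 1)) ≈-refl q (q ^ n) (gauss n 1) ⟩
    1# + q * 1# * (gauss n 1 + q ^ n * 1#)
      ≈⟨ +-congˡ (*-congˡ (+-congˡ (*-congˡ (gauss-zero n)))) ⟨
    1# + q ^ 1 * gauss (suc n) 1 ∎
  gauss-pascal (suc n) (suc s) = begin
    gauss (suc n) (suc (suc s)) + q ^ (n ℕ.∸ s) * gauss (suc n) (suc s)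
      ≈⟨ +-cong (gauss-pascal n (suc s)) (*-congˡ (gauss-pascal n s)) ⟩
    (B₁ + q * p * B₂) + r * (B₀ + p * B₁)
      ≈⟨ solve 6 (λ q p r B₀ B₁ B₂ → (B₁ :+ q :* p :* B₂) :+ r :* (B₀ :+ p :* B₁)
            := (B₁ :+ r :* B₀ :+ q :* p :* B₂) :+ r :* p :* B₁) ≈-refl q p r B₀ B₁ B₂ ⟩
    (B₁ + r * B₀ + q * p * B₂) + r * p * B₁
      ≈⟨ +-congˡ exponents ⟩
    (B₁ + r * B₀ + q * p * B₂) + q * p * (q ^ (n ℕ.∸ suc s) * B₁)
      ≈⟨ solve 5 (λ b z t B₂ u → (b :+ z :+ t :* B₂) :+ t :* u
            := (b :+ z) :+ t :* (B₂ :+ u)) ≈-refl B₁ (r * B₀) (q * p) B₂ (q ^ (n ℕ.∸ suc s) * B₁) ⟩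
    gauss (suc n) (suc s) + q ^ suc (suc s) * gauss (suc n) (suc (suc s)) ∎
    where
    B₀ = gauss n s
    B₁ = gauss n (suc s)
    B₂ = gauss n (suc (suc s))
    p = q ^ suc s
    r = q ^ (n ℕ.∸ s)
    exponents : r * p * B₁ ≈ q * p * (q ^ (n ℕ.∸ suc s) * B₁)
    -- Both sides are q^{n+1} `B₁` if `s < n`. Otherwise the truncated exponents disagree, but `B₁`
    -- is zero.
    exponents with s ℕ.<? n
    ... | yes s<n = begin
      r * (q * q ^ s) * B₁                  ≈⟨ *-congʳ (x∙yz≈y∙xz r q _) ⟩
      q * (r * q ^ s) * B₁                  ≈⟨ *-congʳ (*-congˡ (q^[m∸n]*q^n (ℕ.<⇒≤ s<n))) ⟩
      q * q ^ n * B₁                        ≈⟨ *-congʳ (*-congˡ (q^[m∸n]*q^n s<n)) ⟨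
      q * (q ^ (n ℕ.∸ suc s) * p) * B₁      ≈⟨ solve 4 (λ q u p B → q :* (u :* p) :* B
            := q :* p :* (u :* B)) ≈-refl q (q ^ (n ℕ.∸ suc s)) p B₁ ⟩
      q * p * (q ^ (n ℕ.∸ suc s) * B₁)      ∎
    ... | no s≮n = begin
      r * p * B₁                            ≈⟨ *-congˡ B₁≈0 ⟩
      r * p * 0#                            ≈⟨ solve 4 (λ a b c d → a :* b :* con 0
            := c :* b :* (d :* con 0)) ≈-refl r p q (q ^ (n ℕ.∸ suc s)) ⟩
      q * p * (q ^ (n ℕ.∸ suc s) * 0#)      ≈⟨ *-congˡ (*-congˡ B₁≈0) ⟨
      q * p * (q ^ (n ℕ.∸ suc s) * B₁)      ∎
      where
      B₁≈0 : B₁ ≈ 0#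
      B₁≈0 = gauss-over (s≤s (ℕ.≮⇒≥ s≮n))

  -- z^k q^{k(k-1)/2}
  term : Carrier → ℕ → Carrier
  term z zero    = 1#
  term z (suc k) = term z k * (z * q ^ k)

  -- x^{s-N} q^{(s-N)(s-N-1)/2}, where x^{-1} stands for y / q.
  shiftedTerm : ℕ → ℕ → Carrier
  shiftedTerm zero    s       = term x s
  shiftedTerm (suc N) zero    = term y (suc N)
  shiftedTerm (suc N) (suc s) = shiftedTerm N s

  shiftedTerm-zero : ∀ N → shiftedTerm N 0 ≡ term y N
  shiftedTerm-zero zero    = refl
  shiftedTerm-zero (suc N) = refl

  shiftedTerm-+ : ∀ N i → shiftedTerm N (i ℕ.+ N) ≡ term x i
  shiftedTerm-+ zero    i = cong (term x) (ℕ.+-identityʳ i)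
  shiftedTerm-+ (suc N) i rewrite ℕ.+-suc i N = shiftedTerm-+ N i

  -- Consecutive shifted terms have ratio x q^{s-N}. Since M = (M + N - s) + (s - N), what is left
  -- over is the very weight in the recursion for `gauss (suc (M + N)) (suc s)`.
  shiftedTerm-x : ∀ M N {s} → s ℕ.≤ M ℕ.+ N →
    shiftedTerm N s * (x * q ^ M) ≈ q ^ (M ℕ.+ N ℕ.∸ s) * shiftedTerm N (suc s)
  shiftedTerm-x M zero {s} s≤M rewrite ℕ.+-identityʳ M = begin
    term x s * (x * q ^ M)                         ≈⟨ *-congˡ (*-congˡ (q^[m∸n]*q^n s≤M)) ⟨
    term x s * (x * (q ^ (M ℕ.∸ s) * q ^ s))       ≈⟨ solve 4 (λ t x u v → t :* (x :* (u :* v))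
          := u :* (t :* (x :* v))) ≈-refl (term x s) x (q ^ (M ℕ.∸ s)) (q ^ s) ⟩
    q ^ (M ℕ.∸ s) * (term x s * (x * q ^ s))       ∎
  shiftedTerm-x M (suc N) {zero} _ = begin
    term y N * (y * q ^ N) * (x * q ^ M)           ≈⟨ solve 5 (λ t y x u v → t :* (y :* u) :* (x :* v)
          := (v :* ((x :* y) :* u)) :* t) ≈-refl (term y N) y x (q ^ N) (q ^ M) ⟩
    (q ^ M * ((x * y) * q ^ N)) * term y N         ≈⟨ *-congʳ (*-congˡ (*-congʳ xy≈q)) ⟩
    (q ^ M * q ^ suc N) * term y N
        ≈⟨ *-cong (≈-sym (^-homo-* q M (suc N))) (≡⇒≈ (sym (shiftedTerm-zero N))) ⟩
    q ^ (M ℕ.+ suc N) * shiftedTerm N 0            ∎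
  shiftedTerm-x M (suc N) {suc s} s≤M+N rewrite ℕ.+-suc M N = shiftedTerm-x M N (ℕ.≤-pred s≤M+N)

  -- The ratio x q^{s-N} times y q^N is q^{s+1}, the weight that `gauss-pascal` asks for.
  shiftedTerm-y : ∀ N s → shiftedTerm N (suc s) * (y * q ^ N) ≈ q ^ suc s * shiftedTerm N s
  shiftedTerm-y zero s = begin
    term x s * (x * q ^ s) * (y * 1#)    ≈⟨ solve 4 (λ t x y u → t :* (x :* u) :* (y :* con 1)
          := (x :* y) :* u :* t) ≈-refl (term x s) x y (q ^ s) ⟩
    (x * y) * q ^ s * term x s           ≈⟨ *-congʳ (*-congʳ xy≈q) ⟩
    q ^ suc s * term x s                 ∎
  shiftedTerm-y (suc N) zero = begin
    shiftedTerm N 0 * (y * (q * q ^ N))  ≈⟨ *-congʳ (≡⇒≈ (shiftedTerm-zero N)) ⟩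
    term y N * (y * (q * q ^ N))         ≈⟨ solve 4 (λ t y q u → t :* (y :* (q :* u))
          := q :* con 1 :* (t :* (y :* u))) ≈-refl (term y N) y q (q ^ N) ⟩
    q * 1# * (term y N * (y * q ^ N))    ∎
  shiftedTerm-y (suc N) (suc s) = begin
    shiftedTerm N (suc s) * (y * (q * q ^ N))    ≈⟨ solve 4 (λ t y q u → t :* (y :* (q :* u))
          := q :* (t :* (y :* u))) ≈-refl (shiftedTerm N (suc s)) y q (q ^ N) ⟩
    q * (shiftedTerm N (suc s) * (y * q ^ N))    ≈⟨ *-congˡ (shiftedTerm-y N s) ⟩
    q * (q ^ suc s * shiftedTerm N s)            ≈⟨ *-assoc q _ _ ⟨
    q ^ suc (suc s) * shiftedTerm N s            ∎

  gaussSum : ℕ → ℕ → Carrier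
  gaussSum M N = ∑ (λ s → gauss (M ℕ.+ N) s * shiftedTerm N s) (suc (M ℕ.+ N))

  ∑-extend : ∀ n (t : ℕ → Carrier) → ∑ (λ s → gauss n s * t s) (suc (suc n)) ≈ ∑ (λ s → gauss n s * t s)
      (suc n)
  ∑-extend n t = ≈-trans (+-congʳ (≈-trans (*-congʳ (gauss-over {n} ℕ.≤-refl)) (zeroˡ _))) (+-identityˡ _)

  gaussSum-x : ∀ M N → (1# + x * q ^ M) * gaussSum M N ≈ gaussSum (suc M) N
  gaussSum-x M N = begin
    (1# + x * q ^ M) * gaussSum M N
      ≈⟨ solve 2 (λ a g → (con 1 :+ a) :* g := g :+ g :* a) ≈-refl (x * q ^ M) (gaussSum M N) ⟩
    gaussSum M N + gaussSum M N * (x * q ^ M)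
      ≈⟨ +-cong (≈-sym (∑-extend n τ)) (∑-*ʳ _ (x * q ^ M) (suc n)) ⟩
    ∑ (λ s → gauss n s * τ s) (suc (suc n)) + ∑ (λ s → gauss n s * τ s * (x * q ^ M)) (suc n)
      ≈⟨ +-cong (∑-head _ (suc n)) (∑-cong-< (suc n) λ s s<1+n →
           ≈-trans (*-assoc _ _ _) (≈-trans (*-congˡ (shiftedTerm-x M N (ℕ.≤-pred s<1+n)))
             (solve 3 (λ g u t → g :* (u :* t)
                   := u :* g :* t) ≈-refl (gauss n s) (q ^ (n ℕ.∸ s)) (τ (suc s))))) ⟩
    (gauss n 0 * τ 0 + ∑ (λ s → gauss n (suc s) * τ (suc s)) (suc n)) + ∑
        (λ s → q ^ (n ℕ.∸ s) * gauss n s * τ (suc s)) (suc n)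
      ≈⟨ +-assoc _ _ _ ⟩
    gauss n 0 * τ 0 + (∑ (λ s → gauss n (suc s) * τ (suc s)) (suc n) + ∑
        (λ s → q ^ (n ℕ.∸ s) * gauss n s * τ (suc s)) (suc n))
      ≈⟨ +-cong (*-congʳ (gauss-zero n)) (≈-sym (∑-+ _ _ (suc n))) ⟩
    1# * τ 0 + ∑ (λ s → gauss n (suc s) * τ (suc s) + q ^ (n ℕ.∸ s) * gauss n s * τ (suc s)) (suc n)
      ≈⟨ +-congˡ (∑-cong (suc n) λ s → ≈-sym (distribʳ (τ (suc s)) _ _)) ⟩
    1# * τ 0 + ∑ (λ s → gauss (suc n) (suc s) * τ (suc s)) (suc n)
      ≈⟨ ∑-head (λ s → gauss (suc n) s * τ s) (suc n) ⟨
    gaussSum (suc M) N ∎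
    where
    n = M ℕ.+ N
    τ = shiftedTerm N

  gaussSum-y : ∀ N → (1# + y * q ^ N) * gaussSum 0 N ≈ gaussSum 0 (suc N)
  gaussSum-y N = begin
    (1# + y * q ^ N) * gaussSum 0 N
      ≈⟨ solve 2 (λ a g → (con 1 :+ a) :* g := g :+ g :* a) ≈-refl (y * q ^ N) (gaussSum 0 N) ⟩
    gaussSum 0 N + gaussSum 0 N * (y * q ^ N)
      ≈⟨ +-congˡ (≈-trans (*-congʳ (≈-sym (∑-extend N τ))) (∑-*ʳ _ (y * q ^ N) (suc (suc N)))) ⟩
    gaussSum 0 N + ∑ (λ s → gauss N s * τ s * (y * q ^ N)) (suc (suc N))
      ≈⟨ +-congˡ (≈-trans (∑-head _ (suc N)) (+-cong
            (≈-trans (*-assoc _ _ _) (*-cong (gauss-zero N) (*-congʳ (≡⇒≈ (shiftedTerm-zero N)))))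
           (∑-cong (suc N) λ s → ≈-trans (*-assoc _ _ _) (≈-trans (*-congˡ (shiftedTerm-y N s))
             (solve 3 (λ g u t → g :* (u :* t)
                   := u :* g :* t) ≈-refl (gauss N (suc s)) (q ^ suc s) (τ s)))))) ⟩
    gaussSum 0 N + (1# * term y (suc N) + ∑ (λ s → q ^ suc s * gauss N (suc s) * τ s) (suc N))
      ≈⟨ solve 3 (λ a b c → a :+ (b :+ c) := b :+ (a :+ c)) ≈-refl (gaussSum 0 N) (1# * term y (suc N)) _ ⟩
    1# * term y (suc N) + (gaussSum 0 N + ∑ (λ s → q ^ suc s * gauss N (suc s) * τ s) (suc N))
      ≈⟨ +-congˡ (≈-sym (∑-+ _ _ (suc N))) ⟩
    1# * term y (suc N) + ∑ (λ s → gauss N s * τ s + q ^ suc s * gauss N (suc s) * τ s) (suc N)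
      ≈⟨ +-congˡ (∑-cong (suc N) λ s → ≈-trans (≈-sym (distribʳ (τ s) _ _))
          (*-congʳ (≈-sym (gauss-pascal N s)))) ⟩
    1# * term y (suc N) + ∑ (λ s → gauss (suc N) (suc s) * τ s) (suc N)
      ≈⟨ ∑-head (λ s → gauss (suc N) s * shiftedTerm (suc N) s) (suc N) ⟨
    gaussSum 0 (suc N) ∎
    where
    τ = shiftedTerm N

  -- The q-binomial theorem with its index recentred. Each new factor acts on the sum as a q-Pascal
  -- rule; the factors in `y` are adjoined first, at `M = 0`, then those in `x`.
  finiteTripleProduct : ∀ M N → ∏ (λ k → 1# + x * q ^ k) M * ∏ (λ k → 1# + y * q ^ k) N ≈ gaussSum M N
  finiteTripleProduct zero    zero    = solve 0 (con 1 :* con 1 := con 1 :* con 1 :+ con 0) ≈-refl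
  finiteTripleProduct zero    (suc N) = begin
    1# * ((1# + y * q ^ N) * ∏ (λ k → 1# + y * q ^ k) N)   ≈⟨ x∙yz≈y∙xz _ _ _ ⟩
    (1# + y * q ^ N) * (1# * ∏ (λ k → 1# + y * q ^ k) N)   ≈⟨ *-congˡ (finiteTripleProduct 0 N) ⟩
    (1# + y * q ^ N) * gaussSum 0 N                        ≈⟨ gaussSum-y N ⟩
    gaussSum 0 (suc N)                                     ∎
  finiteTripleProduct (suc M) N       = begin
    (1# + x * q ^ M) * ∏ (λ k → 1# + x * q ^ k) M * ∏ (λ k → 1# + y * q ^ k) N    ≈⟨ *-assoc _ _ _ ⟩
    (1# + x * q ^ M) * (∏ (λ k → 1# + x * q ^ k) M * ∏ (λ k → 1# + y * q ^ k) N)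
        ≈⟨ *-congˡ (finiteTripleProduct M N) ⟩
    (1# + x * q ^ M) * gaussSum M N                                               ≈⟨ gaussSum-x M N ⟩
    gaussSum (suc M) N                                                            ∎

  -- Indices k and -k-1 around the centre N are paired, as in `thetaTerm`. The 2N + 1 terms leave
  -- `term x N` unpaired; it disappears in the q-adic limit.
  ∑-shiftedTerm : ∀ N → ∑ (shiftedTerm N) (suc (N ℕ.+ N)) ≈ term x N + ∑ (λ k → term x k + term y (suc k)) N
  ∑-shiftedTerm zero    = ≈-refl
  ∑-shiftedTerm (suc N) = begin
    ∑ (shiftedTerm (suc N)) (suc (suc (N ℕ.+ suc N)))
      ≈⟨ ∑-head (shiftedTerm (suc N)) (suc (N ℕ.+ suc N)) ⟩
    term y (suc N) + ∑ (shiftedTerm N) (suc (N ℕ.+ suc N))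
      ≈⟨ +-congˡ (≡⇒≈ (cong (∑ (shiftedTerm N) ∘ suc) (ℕ.+-suc N N))) ⟩
    term y (suc N) + (shiftedTerm N (suc N ℕ.+ N) + ∑ (shiftedTerm N) (suc (N ℕ.+ N)))
      ≈⟨ +-congˡ (+-cong (≡⇒≈ (shiftedTerm-+ N (suc N))) (∑-shiftedTerm N)) ⟩
    term y (suc N) + (term x (suc N) + (term x N + ∑ (λ k → term x k + term y (suc k)) N))
      ≈⟨ solve 4 (λ a b c d → a :+ (b :+ (c :+ d))
            := b :+ ((c :+ a) :+ d)) ≈-refl (term y (suc N)) (term x (suc N)) (term x N) _ ⟩
    term x (suc N) + ∑ (λ k → term x k + term y (suc k)) (suc N) ∎

-- The ring of formal power series over ℤ

open import Defs
open import Data.Integer.Base using (_<_; _>_)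
open import Data.List.Membership.Propositional using (_∈_)
open import Data.Product.Base using (_×_)
open import Data.Vec.Functional using (_∷_; [])

open module ConvolutionOverℤ = Convolution ℤ.+-*-commutativeSemiring
  using () renaming (conv to convℤ)

infixl 6 _⊕_
infixl 7 _·_ _•_

tail : Series → Series
tail g = g ∘ suc

𝟘 : Series
𝟘 _ = 0ℤ

_⊕_ : Series → Series → Series
(g ⊕ h) n = g n ℤ.+ h n

_•_ : ℤ → Series → Series
(x • g) n = x ℤ.* g n

-- The product ⊛ of Defs, opaque because unfolding it makes conversion checking intractable.
opaque
  _·_ : Series → Series → Series
  _·_ = convℤ

  ·≗⊛ : ∀ g h → g · h ≗ g ⊛ h
  ·≗⊛ g h zero    = sym (ℤ.+-identityʳ (g 0 ℤ.* h 0))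
  ·≗⊛ g h (suc n) = cong (λ x → g 0 ℤ.* h (suc n) ℤ.+ x) (·≗⊛ (tail g) h n)

  ·-zero : ∀ g h → (g · h) 0 ≡ g 0 ℤ.* h 0
  ·-zero g h = refl

  ·-suc : ∀ g h n → (g · h) (suc n) ≡ g 0 ℤ.* h (suc n) ℤ.+ (tail g · h) n
  ·-suc g h n = refl

  ·-cong-≤ : ∀ n {g g′ h h′} → (∀ m → m ℕ.≤ n → g m ≡ g′ m) → (∀ m → m ℕ.≤ n → h m ≡ h′ m) →
             (g · h) n ≡ (g′ · h′) n
  ·-cong-≤ = ConvolutionOverℤ.conv-cong-≤

  ·-cong : ∀ {g g′ h h′} → g ≗ g′ → h ≗ h′ → g · h ≗ g′ · h′
  ·-cong {g} {g′} {h} {h′} = ConvolutionOverℤ.conv-cong {g} {g′} {h} {h′}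

  ·-assoc : ∀ g h k → (g · h) · k ≗ g · (h · k)
  ·-assoc = ConvolutionOverℤ.conv-assoc

  ·-comm : ∀ g h → g · h ≗ h · g
  ·-comm = ConvolutionOverℤ.conv-comm

  ·-identityˡ : ∀ g → 𝟙 · g ≗ g
  ·-identityˡ g n = trans
    (ConvolutionOverℤ.conv-cong {h = g} (λ { zero → refl ; (suc _) → refl }) (λ _ → refl) n)
    (ConvolutionOverℤ.conv-identityˡ g n)

  ·-zeroˡ : ∀ g → 𝟘 · g ≗ 𝟘
  ·-zeroˡ = ConvolutionOverℤ.conv-zeroˡ

  ·-distribʳ : ∀ k g h → (g ⊕ h) · k ≗ g · k ⊕ h · k
  ·-distribʳ = ConvolutionOverℤ.conv-distribʳ

  •-· : ∀ x g h → (x • g) · h ≗ x • (g · h)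
  •-· = ConvolutionOverℤ.conv-scaleˡ

-- A semiring is enough: minus signs live in the coefficients of monomials, so the modules above and
-- the solver for natural coefficients apply.
seriesSemiring : CommutativeSemiring 0ℓ 0ℓ
seriesSemiring = record
  { Carrier = Series ; _≈_ = _≗_ ; _+_ = _⊕_ ; _*_ = _·_ ; 0# = 𝟘 ; 1# = 𝟙
  ; isCommutativeSemiring = record
    { isSemiring = record
      { isSemiringWithoutAnnihilatingZero = record
        { +-isCommutativeMonoid = record
          { isMonoid = record
            { isSemigroup = record
              { isMagma = record
                { isEquivalence = isEquivalence
                ; ∙-cong = ⊕-cong }
              ; assoc = λ g h k n → ℤ.+-assoc (g n) (h n) (k n) }
            ; identity = (λ g n → ℤ.+-identityˡ (g n)) , (λ g n → ℤ.+-identityʳ (g n)) }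
          ; comm = λ g h n → ℤ.+-comm (g n) (h n) }
        ; *-cong = ·-cong
        ; *-assoc = ·-assoc
        ; *-identity = comm∧idˡ⇒id ·-comm ·-identityˡ
        ; distrib = comm∧distrʳ⇒distr ⊕-cong ·-comm ·-distribʳ }
      ; zero = comm∧zeˡ⇒ze ·-comm ·-zeroˡ }
    ; *-comm = ·-comm } }
  where
  open import Relation.Binary.Bundles using (Setoid)
  open Setoid (ℕ →-setoid ℤ) using (isEquivalence)
  open import Algebra.Consequences.Setoid (ℕ →-setoid ℤ)
  ⊕-cong : ∀ {g g′ h h′ : Series} → g ≗ g′ → h ≗ h′ → g ⊕ h ≗ g′ ⊕ h′
  ⊕-cong p r n = cong₂ ℤ._+_ (p n) (r n)

open module S = CommutativeSemiring seriesSemiring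
  using () renaming (refl to ≗-refl; sym to ≗-sym; trans to ≗-trans)

open import Algebra.Properties.Semiring.Exp S.semiring using () renaming (_^_ to _^ˢ_)
open import Algebra.Solver.Ring.NaturalCoefficients.Default seriesSemiring using ()
  renaming (solve to solve-series; _:=_ to _⊜_; _:*_ to _⊗_; _:+_ to _⊞_; con to numeral)

module ≗-Reasoning where
  open import Relation.Binary.Reasoning.Setoid S.setoid public

open module ∏ = Big S.*-commutativeMonoid using () renaming (big to ∏)
open module ∑ = Big S.+-commutativeMonoid using () renaming (big to ∑)

private variable
  g h k : Series

·-congˡ : ∀ {g h h′} → h ≗ h′ → g · h ≗ g · h′
·-congˡ {g} = ·-cong {g} {g} λ _ → refl

·-congʳ : ∀ {g g′ h} → g ≗ g′ → g · h ≗ g′ · h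
·-congʳ {h = h} p = ·-cong {h = h} p λ _ → refl

⊕-cong : ∀ {g g′ h h′} → g ≗ g′ → h ≗ h′ → g ⊕ h ≗ g′ ⊕ h′
⊕-cong = S.+-cong

-- Recursion on both exponent and degree lets shifts compute, in contrast to `q^_`, which compares
-- the two by a decision procedure.
mono : ℤ → ℕ → Series
mono x zero    zero    = x
mono x zero    (suc n) = 0ℤ
mono x (suc a) zero    = 0ℤ
mono x (suc a) (suc n) = mono x a n

mono-0-· : ∀ x g → mono x 0 · g ≗ x • g
mono-0-· x g = begin
  mono x 0 · g  ≈⟨ ·-congʳ (λ { zero → sym (ℤ.*-identityʳ x) ; (suc n) → sym (ℤ.*-zeroʳ x) }) ⟩
  (x • 𝟙) · g   ≈⟨ •-· x 𝟙 g ⟩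
  x • (𝟙 · g)   ≈⟨ (λ n → cong (x ℤ.*_) (·-identityˡ g n)) ⟩
  x • g         ∎
  where open ≗-Reasoning

mono-suc-·-zero : ∀ x a g → (mono x (suc a) · g) 0 ≡ 0ℤ
mono-suc-·-zero x a g = ·-zero (mono x (suc a)) g

mono-suc-·-suc : ∀ x a g n → (mono x (suc a) · g) (suc n) ≡ (mono x a · g) n
mono-suc-·-suc x a g n = trans (·-suc (mono x (suc a)) g n) (ℤ.+-identityˡ _)

mono-·-mono : ∀ x a y b → mono x a · mono y b ≗ mono (x ℤ.* y) (a ℕ.+ b)
mono-·-mono x zero    y b n       = trans (mono-0-· x (mono y b) n) (go b n)
  where
  go : ∀ b n → x ℤ.* mono y b n ≡ mono (x ℤ.* y) b n
  go zero    zero    = refl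
  go zero    (suc n) = ℤ.*-zeroʳ x
  go (suc b) zero    = ℤ.*-zeroʳ x
  go (suc b) (suc n) = go b n
mono-·-mono x (suc a) y b zero    = mono-suc-·-zero x a (mono y b)
mono-·-mono x (suc a) y b (suc n) = trans (mono-suc-·-suc x a (mono y b) n) (mono-·-mono x a y b n)

mono-vanishes : ∀ x {a n} → n ℕ.< a → mono x a n ≡ 0ℤ
mono-vanishes x {suc a} {zero}  _         = refl
mono-vanishes x {suc a} {suc n} (s≤s n<a) = mono-vanishes x n<a

mono-diag : ∀ x a → mono x a a ≡ x
mono-diag x zero    = refl
mono-diag x (suc a) = mono-diag x a

mono-⊕-mono : ∀ x y a → mono x a ⊕ mono y a ≗ mono (x ℤ.+ y) a
mono-⊕-mono x y zero    zero    = refl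
mono-⊕-mono x y zero    (suc n) = refl
mono-⊕-mono x y (suc a) zero    = refl
mono-⊕-mono x y (suc a) (suc n) = mono-⊕-mono x y a n

mono-0ℤ : ∀ a → mono 0ℤ a ≗ 𝟘
mono-0ℤ zero    zero    = refl
mono-0ℤ zero    (suc n) = refl
mono-0ℤ (suc a) zero    = refl
mono-0ℤ (suc a) (suc n) = mono-0ℤ a n

mono-𝟙 : mono 1ℤ 0 ≗ 𝟙
mono-𝟙 zero    = refl
mono-𝟙 (suc n) = refl

-- Agreement up to degree d, infinite products and infinite sums

infix 4 _≈[_]_
_≈[_]_ : Series → ℕ → Series → Set
g ≈[ d ] h = ∀ n → n ℕ.≤ d → g n ≡ h n

≗⇒≈ : ∀ {d g h} → g ≗ h → g ≈[ d ] h
≗⇒≈ p n _ = p n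

≈⇒≗ : ∀ {g h} → (∀ d → g ≈[ d ] h) → g ≗ h
≈⇒≗ p n = p n n ℕ.≤-refl

≈-mono : ∀ {d e g h} → d ℕ.≤ e → g ≈[ e ] h → g ≈[ d ] h
≈-mono d≤e p n n≤d = p n (ℕ.≤-trans n≤d d≤e)

≈-sym : ∀ {d g h} → g ≈[ d ] h → h ≈[ d ] g
≈-sym p n n≤d = sym (p n n≤d)

≈-trans : ∀ {d g h k} → g ≈[ d ] h → h ≈[ d ] k → g ≈[ d ] k
≈-trans p r n n≤d = trans (p n n≤d) (r n n≤d)

≈-· : ∀ {d g g′ h h′} → g ≈[ d ] g′ → h ≈[ d ] h′ → g · h ≈[ d ] g′ · h′
≈-· p r n n≤d = ·-cong-≤ n (λ m m≤n → p m (ℕ.≤-trans m≤n n≤d)) (λ m m≤n → r m (ℕ.≤-trans m≤n n≤d))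

≈-⊕ : ∀ {d g g′ h h′} → g ≈[ d ] g′ → h ≈[ d ] h′ → g ⊕ h ≈[ d ] g′ ⊕ h′
≈-⊕ p r n n≤d = cong₂ ℤ._+_ (p n n≤d) (r n n≤d)

∏-≈ : ∀ {d u v} N → (∀ k → u k ≈[ d ] v k) → ∏ u N ≈[ d ] ∏ v N
∏-≈ zero    p = λ _ _ → refl
∏-≈ (suc N) p = ≈-· (p N) (∏-≈ N p)

-- The factor `u k` is 1 + O(q^{k+1}), so the first n factors determine the coefficient of q^n.
Multipliable : (ℕ → Series) → Set
Multipliable u = ∀ k → u k ≈[ k ] 𝟙

∏∞ : (ℕ → Series) → Series
∏∞ u n = ∏ u n n

∏∞-≈ : ∀ {u} → Multipliable u → ∀ {d N} → d ℕ.≤ N → ∏∞ u ≈[ d ] ∏ u N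
∏∞-≈ {u} adm d≤N n n≤d = sym (go (ℕ.≤⇒≤′ (ℕ.≤-trans n≤d d≤N)))
  where
  go : ∀ {N} → n ℕ.≤′ N → ∏ u N n ≡ ∏ u n n
  go ℕ.≤′-refl = refl
  go (ℕ.≤′-step {N} n≤′N) = trans
    (≈-· {g = u N} {h = ∏ u N} (≈-mono (ℕ.≤′⇒≤ n≤′N) (adm N)) (λ _ _ → refl) n ℕ.≤-refl)
    (trans (·-identityˡ (∏ u N) n) (go n≤′N))

∏∞-cong : ∀ {u v} → (∀ k → u k ≗ v k) → ∏∞ u ≗ ∏∞ v
∏∞-cong p n = ∏.big-cong n p n

∏∞-· : ∀ {u v} → Multipliable u → Multipliable v → ∏∞ (λ k → u k · v k) ≗ ∏∞ u · ∏∞ v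
∏∞-· {u} {v} p r n = trans (∏.big-∙ u v n n)
  (sym (≈-· (∏∞-≈ p ℕ.≤-refl) (∏∞-≈ r ℕ.≤-refl) n ℕ.≤-refl))

-- The term `v k` is only O(q^k), one order less than for products: term n still counts at q^n,
-- hence the `suc n` in `∑∞`.
Summable : (ℕ → Series) → Set
Summable v = ∀ k n → n ℕ.< k → v k n ≡ 0ℤ

∑∞ : (ℕ → Series) → Series
∑∞ v n = ∑ v (suc n) n

∑∞-≈ : ∀ {v} → Summable v → ∀ {d N} → d ℕ.< N → ∑∞ v ≈[ d ] ∑ v N
∑∞-≈ {v} adm d<N n n≤d = sym (go (ℕ.≤⇒≤′ (ℕ.≤-<-trans n≤d d<N)))
  where
  go : ∀ {N} → suc n ℕ.≤′ N → ∑ v N n ≡ ∑ v (suc n) n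
  go ℕ.≤′-refl = refl
  go (ℕ.≤′-step {N} n<′N) = trans
    (cong (ℤ._+ ∑ v N n) (adm N n (ℕ.≤′⇒≤ n<′N)))
    (trans (ℤ.+-identityˡ _) (go n<′N))

-- Infinite products and their transformation under q ↦ q² and q ↦ -q

progression : ℤ → ℕ → ℕ → ℕ → Series
progression x a c k = 𝟙 ⊕ mono x (a ℕ.+ k ℕ.* c)

-- (−x q^a; q^c)_∞
poch : ℤ → ℕ → ℕ → Series
poch x a c = ∏∞ (progression x a c)

progression-multipliable : ∀ x {a c} → 0 ℕ.< a → 0 ℕ.< c → Multipliable (progression x a c)
progression-multipliable x {a} {c} 0<a 0<c k n n≤k =
  trans (cong (λ y → 𝟙 n ℤ.+ y) (mono-vanishes x (ℕ.≤-<-trans n≤k k<))) (ℤ.+-identityʳ (𝟙 n))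
  where
  k< : k ℕ.< a ℕ.+ k ℕ.* c
  k< = ℕ.+-mono-≤ 0<a (ℕ.m≤m*n k c {{ℕ.>-nonZero 0<c}})

mono-cong : ∀ x {a b} → a ≡ b → mono x a ≗ mono x b
mono-cong x refl n = refl

1+mono-cong : ∀ x {a b} → a ≡ b → 𝟙 ⊕ mono x a ≗ 𝟙 ⊕ mono x b
1+mono-cong x refl n = refl

-- The factors are sorted by their index modulo `m`: cutting `d * m` of them into blocks of length
-- `m` and swapping the two products leaves `d` factors in each class.
poch-split : ∀ x a c m .{{_ : NonZero a}} .{{_ : NonZero c}} .{{_ : NonZero m}} →
             poch x a c ≗ ∏ (λ i → poch x (a ℕ.+ i ℕ.* c) (m ℕ.* c)) m
poch-split x a c m = ≈⇒≗ λ d → ≈-trans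
  (∏∞-≈ (progression-multipliable x 0<a 0<c) (ℕ.m≤m*n d m))
  (≈-trans (≗⇒≈ (≗-trans (∏.big-blocks (progression x a c) m d)
    (≗-trans (∏.big-swap (λ k i → progression x a c (i ℕ.+ k ℕ.* m)) d m)
      (∏.big-cong m λ i → ∏.big-cong d λ k → 1+mono-cong x (reindex i k)))))
    (≈-sym (∏-≈ m λ i → ∏∞-≈ (progression-multipliable x (ℕ.<-≤-trans 0<a (ℕ.m≤m+n a (i ℕ.* c)))
      (ℕ.*-mono-< (ℕ.>-nonZero⁻¹ m) 0<c)) ℕ.≤-refl)))
  where
  0<a = ℕ.>-nonZero⁻¹ a
  0<c = ℕ.>-nonZero⁻¹ c
  reindex : ∀ i k → a ℕ.+ (i ℕ.+ k ℕ.* m) ℕ.* c ≡ a ℕ.+ i ℕ.* c ℕ.+ k ℕ.* (m ℕ.* c)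
  reindex i k = solve 5 (λ a i k m c → a :+ (i :+ k :* m) :* c := a :+ i :* c :+ k :* (m :* c)) refl a i k m c
    where open ℕ.+-*-Solver

poch-head : ∀ x a c .{{_ : NonZero a}} .{{_ : NonZero c}} →
            poch x a c ≗ (𝟙 ⊕ mono x a) · poch x (a ℕ.+ c) c
poch-head x a c = ≈⇒≗ λ d → ≈-trans
  (∏∞-≈ (progression-multipliable x 0<a 0<c) (ℕ.n≤1+n d))
  (≈-trans (≗⇒≈ (≗-trans (∏.big-head (progression x a c) d)
    (·-cong (1+mono-cong x (ℕ.+-identityʳ a))
      (∏.big-cong d λ k → 1+mono-cong x (sym (ℕ.+-assoc a c (k ℕ.* c)))))))
    (≈-· {g = 𝟙 ⊕ mono x a} (λ _ _ → refl)
      (≈-sym (∏∞-≈ (progression-multipliable x (ℕ.<-≤-trans 0<a (ℕ.m≤m+n a c)) 0<c) ℕ.≤-refl))))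
  where
  0<a = ℕ.>-nonZero⁻¹ a
  0<c = ℕ.>-nonZero⁻¹ c

double-progression : ∀ a c k → (a ℕ.+ k ℕ.* c) ℕ.+ (a ℕ.+ k ℕ.* c) ≡ a ℕ.+ a ℕ.+ k ℕ.* (c ℕ.+ c)
double-progression a c k = solve 3 (λ a c k → a :+ k :* c :+ (a :+ k :* c)
      := a :+ a :+ k :* (c :+ c)) refl a c k
  where open ℕ.+-*-Solver

[1+x][1-x] : ∀ a → (𝟙 ⊕ mono 1ℤ a) · (𝟙 ⊕ mono -1ℤ a) ≗ 𝟙 ⊕ mono -1ℤ (a ℕ.+ a)
[1+x][1-x] a = begin
  (𝟙 ⊕ mono 1ℤ a) · (𝟙 ⊕ mono -1ℤ a)
    ≈⟨ solve-series 3 (λ e p q → (e ⊞ p) ⊗ (e ⊞ q)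
          ⊜ e ⊗ e ⊞ e ⊗ (p ⊞ q) ⊞ p ⊗ q) (λ _ → refl) 𝟙 (mono 1ℤ a) (mono -1ℤ a) ⟩
  𝟙 · 𝟙 ⊕ 𝟙 · (mono 1ℤ a ⊕ mono -1ℤ a) ⊕ mono 1ℤ a · mono -1ℤ a
    ≈⟨ ⊕-cong (⊕-cong (·-identityˡ 𝟙) (≗-trans (·-identityˡ _)
          (≗-trans (mono-⊕-mono 1ℤ -1ℤ a) (mono-0ℤ a)))) (mono-·-mono 1ℤ a -1ℤ a) ⟩
  𝟙 ⊕ 𝟘 ⊕ mono -1ℤ (a ℕ.+ a)
    ≈⟨ ⊕-cong {𝟙 ⊕ 𝟘} {𝟙} {mono -1ℤ (a ℕ.+ a)} (λ n → ℤ.+-identityʳ (𝟙 n)) ≗-refl ⟩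
  𝟙 ⊕ mono -1ℤ (a ℕ.+ a) ∎
  where open ≗-Reasoning

poch-conjugate : ∀ a c .{{_ : NonZero a}} .{{_ : NonZero c}} →
                 poch 1ℤ a c · poch -1ℤ a c ≗ poch -1ℤ (a ℕ.+ a) (c ℕ.+ c)
poch-conjugate a c = ≗-trans
  (≗-sym (∏∞-· (progression-multipliable 1ℤ 0<a 0<c) (progression-multipliable -1ℤ 0<a 0<c)))
  (∏∞-cong λ k → ≗-trans ([1+x][1-x] (a ℕ.+ k ℕ.* c))
    (1+mono-cong -1ℤ (double-progression a c k)))
  where
  0<a = ℕ.>-nonZero⁻¹ a
  0<c = ℕ.>-nonZero⁻¹ c

-- The substitution q ↦ q².
dilate : Series → Series
dilate g zero          = g 0
dilate g (suc zero)    = 0ℤ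
dilate g (suc (suc n)) = dilate (tail g) n

dilate-≈ : ∀ {d} → g ≈[ d ] h → dilate g ≈[ d ] dilate h
dilate-≈ {g} {h} {d} p n n≤d = go n λ m m≤n → p m (ℕ.≤-trans m≤n n≤d)
  where
  go : ∀ {g h} n → g ≈[ n ] h → dilate g n ≡ dilate h n
  go zero          p = p 0 z≤n
  go (suc zero)    p = refl
  go (suc (suc n)) p = go n λ m m≤n → p (suc m) (s≤s (ℕ.m≤n⇒m≤1+n m≤n))

dilate-cong : g ≗ h → dilate g ≗ dilate h
dilate-cong {g} {h} p = ≈⇒≗ λ d → dilate-≈ {g} {h} {d} (≗⇒≈ p)

dilate-⊕ : ∀ g h → dilate (g ⊕ h) ≗ dilate g ⊕ dilate h
dilate-⊕ g h zero          = refl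
dilate-⊕ g h (suc zero)    = refl
dilate-⊕ g h (suc (suc n)) = dilate-⊕ (tail g) (tail h) n

dilate-• : ∀ x g → dilate (x • g) ≗ x • dilate g
dilate-• x g zero          = refl
dilate-• x g (suc zero)    = sym (ℤ.*-zeroʳ x)
dilate-• x g (suc (suc n)) = dilate-• x (tail g) n

dilate-𝟘 : dilate 𝟘 ≗ 𝟘
dilate-𝟘 zero          = refl
dilate-𝟘 (suc zero)    = refl
dilate-𝟘 (suc (suc n)) = dilate-𝟘 n

dilate-mono : ∀ x a → dilate (mono x a) ≗ mono x (a ℕ.+ a)
dilate-mono x zero    zero          = refl
dilate-mono x zero    (suc zero)    = refl
dilate-mono x zero    (suc (suc n)) = dilate-𝟘 n
dilate-mono x (suc a) n rewrite ℕ.+-suc a a with n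
... | zero        = refl
... | suc zero    = refl
... | suc (suc n) = dilate-mono x a n

dilate-𝟙 : dilate 𝟙 ≗ 𝟙
dilate-𝟙 = ≗-trans (dilate-cong (≗-sym mono-𝟙)) (≗-trans (dilate-mono 1ℤ 0) mono-𝟙)

-- The recursion step behind both `dilate-·` and `even-dilate-·`: the coefficient of q in `dilate g`
-- is zero, so descending two degrees leaves only these two summands.
tail²-dilate-· : ∀ g h → tail (tail (dilate g · h)) ≗ g 0 • tail (tail h) ⊕ dilate (tail g) · h
tail²-dilate-· g h n = begin
  (dilate g · h) (suc (suc n))
    ≡⟨ ·-suc (dilate g) h (suc n) ⟩
  g 0 ℤ.* h (suc (suc n)) ℤ.+ (tail (dilate g) · h) (suc n)
    ≡⟨ cong (λ y → g 0 ℤ.* h (suc (suc n)) ℤ.+ y) (·-suc (tail (dilate g)) h n) ⟩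
  g 0 ℤ.* h (suc (suc n)) ℤ.+ (0ℤ ℤ.+ (dilate (tail g) · h) n)
    ≡⟨ cong (λ y → g 0 ℤ.* h (suc (suc n)) ℤ.+ y) (ℤ.+-identityˡ _) ⟩
  g 0 ℤ.* h (suc (suc n)) ℤ.+ (dilate (tail g) · h) n ∎
  where open ≡-Reasoning

dilate-· : ∀ g h → dilate (g · h) ≗ dilate g · dilate h
dilate-· g h zero       = trans (·-zero g h) (sym (·-zero (dilate g) (dilate h)))
dilate-· g h (suc zero) = sym (trans (·-suc (dilate g) (dilate h) 0)
  (cong₂ ℤ._+_ (ℤ.*-zeroʳ (g 0)) (·-zero (tail (dilate g)) (dilate h))))
dilate-· g h (suc (suc n)) = begin
  dilate (tail (g · h)) n
    ≡⟨ dilate-cong {h = g 0 • tail h ⊕ tail g · h} (·-suc g h) n ⟩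
  dilate (g 0 • tail h ⊕ tail g · h) n
    ≡⟨ dilate-⊕ (g 0 • tail h) (tail g · h) n ⟩
  dilate (g 0 • tail h) n ℤ.+ dilate (tail g · h) n
    ≡⟨ cong₂ ℤ._+_ (dilate-• (g 0) (tail h) n) (dilate-· (tail g) h n) ⟩
  g 0 ℤ.* dilate (tail h) n ℤ.+ (dilate (tail g) · dilate h) n
    ≡⟨ tail²-dilate-· g (dilate h) n ⟨
  (dilate g · dilate h) (suc (suc n)) ∎
  where open ≡-Reasoning

-- The 2-dissection g(q) = (even g)(q²) + q (odd g)(q²).
even odd : Series → Series
even g zero    = g 0
even g (suc n) = even (tail (tail g)) n
odd g = even (tail g)

even-cong : g ≗ h → even g ≗ even h
even-cong p zero    = p 0
even-cong p (suc n) = even-cong (p ∘ suc ∘ suc) n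

even-⊕ : ∀ g h → even (g ⊕ h) ≗ even g ⊕ even h
even-⊕ g h zero    = refl
even-⊕ g h (suc n) = even-⊕ (tail (tail g)) (tail (tail h)) n

even-• : ∀ x g → even (x • g) ≗ x • even g
even-• x g zero    = refl
even-• x g (suc n) = even-• x (tail (tail g)) n

even-double : ∀ g n → even g n ≡ g (n ℕ.+ n)
even-double g zero    = refl
even-double g (suc n) = trans (even-double (tail (tail g)) n) (cong g (cong suc (sym (ℕ.+-suc n n))))

-- Factors in q² pass through the dissection, so for K(q²) θ(q) it is enough to dissect θ.
even-dilate-· : ∀ g h → even (dilate g · h) ≗ g · even h
even-dilate-· g h zero    = trans (·-zero (dilate g) h) (sym (·-zero g (even h)))
even-dilate-· g h (suc n) = begin
  even (tail (tail (dilate g · h))) n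
    ≡⟨ even-cong (tail²-dilate-· g h) n ⟩
  even (g 0 • tail (tail h) ⊕ dilate (tail g) · h) n
    ≡⟨ even-⊕ (g 0 • tail (tail h)) (dilate (tail g) · h) n ⟩
  even (g 0 • tail (tail h)) n ℤ.+ even (dilate (tail g) · h) n
    ≡⟨ cong₂ ℤ._+_ (even-• (g 0) (tail (tail h)) n) (even-dilate-· (tail g) h n) ⟩
  g 0 ℤ.* even h (suc n) ℤ.+ (tail g · even h) n
    ≡⟨ ·-suc g (even h) n ⟨
  (g · even h) (suc n) ∎
  where open ≡-Reasoning

·-sucʳ : ∀ g h n → (g · h) (suc n) ≡ h 0 ℤ.* g (suc n) ℤ.+ (g · tail h) n
·-sucʳ g h n = trans (·-comm g h (suc n)) (trans (·-suc h g n)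
  (cong (λ y → h 0 ℤ.* g (suc n) ℤ.+ y) (·-comm (tail h) g n)))

odd-dilate : ∀ g → odd (dilate g) ≗ 𝟘
odd-dilate g zero    = refl
odd-dilate g (suc n) = odd-dilate (tail g) n

odd-dilate-· : ∀ g h → odd (dilate g · h) ≗ g · odd h
odd-dilate-· g h n = begin
  even (tail (dilate g · h)) n
    ≡⟨ even-cong (·-sucʳ (dilate g) h) n ⟩
  even (h 0 • tail (dilate g) ⊕ dilate g · tail h) n
    ≡⟨ even-⊕ (h 0 • tail (dilate g)) (dilate g · tail h) n ⟩
  even (h 0 • tail (dilate g)) n ℤ.+ even (dilate g · tail h) n
    ≡⟨ cong₂ ℤ._+_ (trans (even-• (h 0) (tail (dilate g)) n) (cong (h 0 ℤ.*_) (odd-dilate g n)))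
         (even-dilate-· g (tail h) n) ⟩
  h 0 ℤ.* 0ℤ ℤ.+ (g · odd h) n
    ≡⟨ cong (ℤ._+ (g · odd h) n) (ℤ.*-zeroʳ (h 0)) ⟩
  0ℤ ℤ.+ (g · odd h) n
    ≡⟨ ℤ.+-identityˡ _ ⟩
  (g · odd h) n ∎
  where open ≡-Reasoning

sgn : ℕ → ℤ
sgn zero    = 1ℤ
sgn (suc n) = - sgn n

twist : Series → Series
twist g n = sgn n ℤ.* g n

twist-≈ : ∀ {d} → g ≈[ d ] h → twist g ≈[ d ] twist h
twist-≈ p n n≤d = cong (sgn n ℤ.*_) (p n n≤d)

twist-cong : g ≗ h → twist g ≗ twist h
twist-cong p n = cong (sgn n ℤ.*_) (p n)

twist-⊕ : ∀ g h → twist (g ⊕ h) ≗ twist g ⊕ twist h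
twist-⊕ g h n = ℤ.*-distribˡ-+ (sgn n) (g n) (h n)

neg-* : ∀ s y → - s ℤ.* y ≡ -1ℤ ℤ.* (s ℤ.* y)
neg-* s y = trans (sym (ℤ.neg-distribˡ-* s y)) (sym (ℤ.-1*i≡-i (s ℤ.* y)))

tail-twist : ∀ g → tail (twist g) ≗ -1ℤ • twist (tail g)
tail-twist g n = neg-* (sgn n) (g (suc n))

twist-· : ∀ g h → twist (g · h) ≗ twist g · twist h
twist-· g h zero    = begin
  1ℤ ℤ.* (g · h) 0                   ≡⟨ cong (1ℤ ℤ.*_) (·-zero g h) ⟩
  1ℤ ℤ.* (g 0 ℤ.* h 0)               ≡⟨ ℤ.*-identityˡ _ ⟩
  g 0 ℤ.* h 0                        ≡⟨ cong₂ ℤ._*_ (ℤ.*-identityˡ (g 0)) (ℤ.*-identityˡ (h 0)) ⟨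
  (1ℤ ℤ.* g 0) ℤ.* (1ℤ ℤ.* h 0)      ≡⟨ ·-zero (twist g) (twist h) ⟨
  (twist g · twist h) 0              ∎
  where open ≡-Reasoning
twist-· g h (suc n) = begin
  - sgn n ℤ.* (g · h) (suc n)
    ≡⟨ cong (- sgn n ℤ.*_) (·-suc g h n) ⟩
  - sgn n ℤ.* (g 0 ℤ.* h (suc n) ℤ.+ (tail g · h) n)
    ≡⟨ ℤ.*-distribˡ-+ (- sgn n) (g 0 ℤ.* h (suc n)) _ ⟩
  - sgn n ℤ.* (g 0 ℤ.* h (suc n)) ℤ.+ - sgn n ℤ.* (tail g · h) n
    ≡⟨ cong₂ ℤ._+_ (swap (- sgn n) (g 0) (h (suc n)))
         (trans (neg-* (sgn n) ((tail g · h) n)) (cong (-1ℤ ℤ.*_) (twist-· (tail g) h n))) ⟩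
  g 0 ℤ.* twist h (suc n) ℤ.+ -1ℤ ℤ.* (twist (tail g) · twist h) n
    ≡⟨ cong₂ ℤ._+_ (cong (ℤ._* twist h (suc n)) (sym (ℤ.*-identityˡ (g 0))))
         (trans (sym (•-· -1ℤ (twist (tail g)) (twist h) n)) (·-congʳ (≗-sym (tail-twist g)) n)) ⟩
  twist g 0 ℤ.* twist h (suc n) ℤ.+ (tail (twist g) · twist h) n
    ≡⟨ ·-suc (twist g) (twist h) n ⟨
  (twist g · twist h) (suc n) ∎
  where
  open ≡-Reasoning
  open import Algebra.Properties.CommutativeSemigroup ℤ.*-commutativeSemigroup using () renaming
      (x∙yz≈y∙xz to swap)

twist-mono : ∀ x a → twist (mono x a) ≗ mono (sgn a ℤ.* x) a
twist-mono x zero    zero    = refl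
twist-mono x zero    (suc n) = ℤ.*-zeroʳ (- sgn n)
twist-mono x (suc a) zero    = refl
twist-mono x (suc a) (suc n) = begin
  - sgn n ℤ.* mono x a n             ≡⟨ ℤ.neg-distribˡ-* (sgn n) _ ⟨
  - (sgn n ℤ.* mono x a n)           ≡⟨ cong -_ (twist-mono x a n) ⟩
  - (mono (sgn a ℤ.* x) a n)         ≡⟨ neg-mono (sgn a ℤ.* x) a n ⟩
  mono (- (sgn a ℤ.* x)) a n         ≡⟨ cong (λ y → mono y a n) (ℤ.neg-distribˡ-* (sgn a) x) ⟩
  mono (- sgn a ℤ.* x) a n           ∎
  where
  open ≡-Reasoning
  neg-mono : ∀ x a n → - mono x a n ≡ mono (- x) a n
  neg-mono x zero    zero    = refl
  neg-mono x zero    (suc n) = refl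
  neg-mono x (suc a) zero    = refl
  neg-mono x (suc a) (suc n) = neg-mono x a n

twist-𝟙 : twist 𝟙 ≗ 𝟙
twist-𝟙 = ≗-trans (twist-cong (≗-sym mono-𝟙)) (≗-trans (twist-mono 1ℤ 0) mono-𝟙)

sgn-+ : ∀ m n → sgn (m ℕ.+ n) ≡ sgn m ℤ.* sgn n
sgn-+ zero    n = sym (ℤ.*-identityˡ (sgn n))
sgn-+ (suc m) n = trans (cong -_ (sgn-+ m n)) (ℤ.neg-distribˡ-* (sgn m) (sgn n))

sgn² : ∀ n → sgn n ℤ.* sgn n ≡ 1ℤ
sgn² zero    = refl
sgn² (suc n) = trans (sym (ℤ.neg-distribˡ-* (sgn n) (- sgn n)))
  (trans (cong -_ (sym (ℤ.neg-distribʳ-* (sgn n) (sgn n)))) (trans (ℤ.neg-involutive _) (sgn² n)))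

sgn-double : ∀ n → sgn (n ℕ.+ n) ≡ 1ℤ
sgn-double n = trans (sgn-+ n n) (sgn² n)

-- `F-≈` is q-adic continuity without loss of precision; it carries the multiplicative map `F`
-- through infinite products. The instances are q ↦ q² and q ↦ -q.
module Endomorphism (F : Series → Series)
  (F-≈ : ∀ {d g h} → g ≈[ d ] h → F g ≈[ d ] F h)
  (F-𝟙 : F 𝟙 ≗ 𝟙)
  (F-· : ∀ g h → F (g · h) ≗ F g · F h) where

  F-cong : g ≗ h → F g ≗ F h
  F-cong {g} {h} p = ≈⇒≗ λ d → F-≈ {d} {g} {h} (≗⇒≈ p)

  F-∏ : ∀ u N → F (∏ u N) ≗ ∏ (F ∘ u) N
  F-∏ u zero    = F-𝟙
  F-∏ u (suc N) = ≗-trans (F-· (u N) (∏ u N)) (·-congˡ (F-∏ u N))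

  F-∏∞ : ∀ {u} → Multipliable u → F (∏∞ u) ≗ ∏∞ (F ∘ u)
  F-∏∞ {u} p n = trans (F-≈ (∏∞-≈ p ℕ.≤-refl) n ℕ.≤-refl) (F-∏ u n n)

  F-inverse : ∀ {g h} → g · h ≗ 𝟙 → F g · F h ≗ 𝟙
  F-inverse {g} {h} p = ≗-trans (≗-sym (F-· g h)) (≗-trans (F-cong p) F-𝟙)

  F-^ : F g ≗ h → ∀ n → F (g ^ˢ n) ≗ h ^ˢ n
  F-^ p zero    = F-𝟙
  F-^ {g} p (suc n) = ≗-trans (F-· g (g ^ˢ n)) (·-cong p (F-^ p n))

module Dilate = Endomorphism dilate (λ {d} {g} {h} → dilate-≈ {g} {h} {d}) dilate-𝟙 dilate-·

module Twist = Endomorphism twist (λ {d} {g} {h} → twist-≈ {g} {h} {d}) twist-𝟙 twist-·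

dilate-poch : ∀ x a c .{{_ : NonZero a}} .{{_ : NonZero c}} →
              dilate (poch x a c) ≗ poch x (a ℕ.+ a) (c ℕ.+ c)
dilate-poch x a c = ≗-trans
  (Dilate.F-∏∞ (progression-multipliable x (ℕ.>-nonZero⁻¹ a) (ℕ.>-nonZero⁻¹ c)))
  (∏∞-cong λ k → ≗-trans (dilate-⊕ 𝟙 (mono x (a ℕ.+ k ℕ.* c)))
    (⊕-cong dilate-𝟙 (≗-trans (dilate-mono x (a ℕ.+ k ℕ.* c)) (mono-cong x (double-progression a c k)))))

-- The step `c + c` is even, so all exponents have the parity of `a` and one sign serves every
-- factor.
twist-poch : ∀ x a c .{{_ : NonZero a}} .{{_ : NonZero c}} →
             twist (poch x a (c ℕ.+ c)) ≗ poch (sgn a ℤ.* x) a (c ℕ.+ c)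
twist-poch x a c = ≗-trans
  (Twist.F-∏∞ (progression-multipliable x (ℕ.>-nonZero⁻¹ a) (ℕ.<-≤-trans (ℕ.>-nonZero⁻¹ c) (ℕ.m≤m+n c c))))
  (∏∞-cong λ k → ≗-trans (twist-⊕ 𝟙 (mono x (a ℕ.+ k ℕ.* (c ℕ.+ c))))
    (⊕-cong twist-𝟙 (≗-trans (twist-mono x (a ℕ.+ k ℕ.* (c ℕ.+ c)))
      λ n → cong (λ s → mono (s ℤ.* x) (a ℕ.+ k ℕ.* (c ℕ.+ c)) n) (sgn-progression k))))
  where
  sgn-progression : ∀ k → sgn (a ℕ.+ k ℕ.* (c ℕ.+ c)) ≡ sgn a
  sgn-progression k = trans (sgn-+ a _) (trans (cong (λ m → sgn a ℤ.* sgn m) (ℕ.*-distribˡ-+ k c c))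
    (trans (cong (sgn a ℤ.*_) (sgn-double (k ℕ.* c))) (ℤ.*-identityʳ (sgn a))))

·-inverse : ∀ g → g 0 ≡ 1ℤ → g · g ⁻¹ ≗ 𝟙
·-inverse g p = ≗-trans (·≗⊛ g (g ⁻¹)) (⊛-inverse g p)

inverse-unique : g · h ≗ 𝟙 → g · k ≗ 𝟙 → h ≗ k
inverse-unique {g} {h} {k} p r = begin
  h             ≈⟨ ·-identityˡ h ⟨
  𝟙 · h         ≈⟨ ·-congʳ r ⟨
  (g · k) · h   ≈⟨ solve-series 3 (λ g k h → (g ⊗ k) ⊗ h ⊜ (g ⊗ h) ⊗ k) (λ _ → refl) g k h ⟩
  (g · h) · k   ≈⟨ ·-congʳ p ⟩
  𝟙 · k         ≈⟨ ·-identityˡ k ⟩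
  k             ∎
  where open ≗-Reasoning

q^≗mono : ∀ a → q^ a ≗ mono 1ℤ a
q^≗mono zero    zero    = refl
q^≗mono zero    (suc n) = refl
q^≗mono (suc a) zero    = refl
q^≗mono (suc a) (suc n) = q^≗mono a n

f≗poch : ∀ j → f j ≗ poch -1ℤ j j
f≗poch j n = partialProduct≗∏ n n
  where
  factor : ∀ N → 𝟙 ⊖ q^ (j ℕ.* suc N) ≗ progression -1ℤ j j N
  factor N n = cong (λ y → 𝟙 n ℤ.+ y) (begin
    - (q^ (j ℕ.* suc N)) n          ≡⟨ cong -_ (q^≗mono (j ℕ.* suc N) n) ⟩
    - mono 1ℤ (j ℕ.* suc N) n       ≡⟨ ℤ.-1*i≡-i _ ⟨
    -1ℤ ℤ.* mono 1ℤ (j ℕ.* suc N) n ≡⟨ mono-0-· -1ℤ (mono 1ℤ (j ℕ.* suc N)) n ⟨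
    (mono -1ℤ 0 · mono 1ℤ (j ℕ.* suc N)) n ≡⟨ mono-·-mono -1ℤ 0 1ℤ (j ℕ.* suc N) n ⟩
    mono -1ℤ (j ℕ.* suc N) n        ≡⟨ cong (λ m → mono -1ℤ m n)
        (trans (ℕ.*-suc j N) (cong (j ℕ.+_) (ℕ.*-comm j N))) ⟩
    mono -1ℤ (j ℕ.+ N ℕ.* j) n      ∎)
    where open ≡-Reasoning
  partialProduct≗∏ : ∀ N → partialProduct j N ≗ ∏ (progression -1ℤ j j) N
  partialProduct≗∏ zero    = ≗-refl
  partialProduct≗∏ (suc N) = ≗-trans (≗-sym (·≗⊛ _ _)) (·-cong (factor N) (partialProduct≗∏ N))
-- Theta series and the triple product

-- This is ka + c k(k-1)/2, the exponent of q in `term` when its argument is q^a and the base is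
-- q^c.
exponent : ℕ → ℕ → ℕ → ℕ
exponent a c zero    = 0
exponent a c (suc k) = exponent a c k ℕ.+ (a ℕ.+ k ℕ.* c)

exponent-≥ : ∀ {a} c k → 0 ℕ.< a → k ℕ.≤ exponent a c k
exponent-≥ c zero    0<a = z≤n
exponent-≥ {a} c (suc k) 0<a = ℕ.≤-trans (ℕ.≤-reflexive (ℕ.+-comm 1 k))
  (ℕ.+-mono-≤ (exponent-≥ c k 0<a) (ℕ.<-≤-trans 0<a (ℕ.m≤m+n a (k ℕ.* c))))

thetaTerm : ℤ → ℕ → ℕ → ℕ → Series
thetaTerm x a b k = mono (x ℤ.^ k) (exponent a (a ℕ.+ b) k) ⊕ mono (x ℤ.^ suc k)
    (exponent b (a ℕ.+ b) (suc k))

-- ∑_{n ∈ ℤ} x^n q^{a n(n+1)/2 + b n(n-1)/2} for x = ±1, with k and −k−1 taken together.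
theta : ℤ → ℕ → ℕ → Series
theta x a b = ∑∞ (thetaTerm x a b)

-- The case `b = 0` must be covered, since it occurs in the odd part of `theta -1ℤ 1 1`; the growth
-- then comes from the summand `a` of the step.
exponent-suc-≥ : ∀ {a} b k → 0 ℕ.< a → k ℕ.≤ exponent b (a ℕ.+ b) (suc k)
exponent-suc-≥ {a} b zero    0<a = z≤n
exponent-suc-≥ {a} b (suc k) 0<a = ℕ.≤-trans (ℕ.≤-reflexive (ℕ.+-comm 1 k))
  (ℕ.+-mono-≤ (exponent-suc-≥ b k 0<a)
    (ℕ.<-≤-trans 0<a (ℕ.≤-trans (ℕ.m≤m+n a (b ℕ.+ k ℕ.* (a ℕ.+ b)))
      (ℕ.≤-trans (ℕ.≤-reflexive (sym (ℕ.+-assoc a b _))) (ℕ.m≤n+m _ b)))))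

theta-summable : ∀ x {a} b → 0 ℕ.< a → Summable (thetaTerm x a b)
theta-summable x {a} b 0<a k n n<k = cong₂ ℤ._+_
  (mono-vanishes (x ℤ.^ k) (ℕ.<-≤-trans n<k (exponent-≥ (a ℕ.+ b) k 0<a)))
  (mono-vanishes (x ℤ.^ suc k) (ℕ.<-≤-trans n<k (exponent-suc-≥ b k 0<a)))

-- Because `x` is its own inverse, x q^a and x q^b multiply to the base q^{a+b}, as the finite
-- identity demands.
module TripleProduct (x : ℤ) (x²≡1 : x ℤ.* x ≡ 1ℤ) (a b : ℕ) (0<a : 0 ℕ.< a) (0<b : 0 ℕ.< b) where
  private
    c : ℕ
    c = a ℕ.+ b

    0<c : 0 ℕ.< c
    0<c = ℕ.<-≤-trans 0<a (ℕ.m≤m+n a b)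

    xq^a·xq^b : mono x a · mono x b ≗ mono 1ℤ c
    xq^a·xq^b = ≗-trans (mono-·-mono x a x b) λ n → cong (λ y → mono y c n) x²≡1

  open FiniteTripleProduct seriesSemiring (mono x a) (mono x b) (mono 1ℤ c) xq^a·xq^b

  mono-^ : ∀ k → mono 1ℤ c ^ˢ k ≗ mono 1ℤ (k ℕ.* c)
  mono-^ zero    = ≗-sym mono-𝟙
  mono-^ (suc k) = ≗-trans (·-congˡ (mono-^ k)) (mono-·-mono 1ℤ c 1ℤ (k ℕ.* c))

  mono-·-mono-^ : ∀ y z k → mono y z · mono 1ℤ c ^ˢ k ≗ mono y (z ℕ.+ k ℕ.* c)
  mono-·-mono-^ y z k = ≗-trans (·-congˡ (mono-^ k)) (≗-trans (mono-·-mono y z 1ℤ (k ℕ.* c))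
    λ n → cong (λ s → mono s (z ℕ.+ k ℕ.* c) n) (ℤ.*-identityʳ y))

  term≗mono : ∀ z k → term (mono x z) k ≗ mono (x ℤ.^ k) (exponent z c k)
  term≗mono z zero    = ≗-sym mono-𝟙
  term≗mono z (suc k) = ≗-trans (·-cong (term≗mono z k) (mono-·-mono-^ x z k))
    (≗-trans (mono-·-mono (x ℤ.^ k) (exponent z c k) x (z ℕ.+ k ℕ.* c))
      λ n → cong (λ s → mono s (exponent z c (suc k)) n) (ℤ.*-comm (x ℤ.^ k) x))

  term-vanishes : ∀ {z k d} → 0 ℕ.< z → d ℕ.< k → term (mono x z) k ≈[ d ] 𝟘
  term-vanishes {z} {k} 0<z d<k n n≤d = trans (term≗mono z k n)
    (mono-vanishes (x ℤ.^ k) (ℕ.≤-<-trans n≤d (ℕ.<-≤-trans d<k (exponent-≥ c k 0<z))))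

  -- (1 − q^{c(m+1)}) + q^{c(m+1)} (1 − q^{c(n+1)}) = 1 − q^{c(m+n+2)}
  factor-telescope : ∀ m n →
    progression -1ℤ c c m ⊕ (mono 1ℤ c ^ˢ suc m) · progression -1ℤ c c n ≗ progression -1ℤ
        (c ℕ.+ suc n ℕ.* c) c m
  factor-telescope m n = begin
    (𝟙 ⊕ mono -1ℤ M) ⊕ (mono 1ℤ c ^ˢ suc m) · (𝟙 ⊕ mono -1ℤ N)
      ≈⟨ S.+-congˡ {𝟙 ⊕ mono -1ℤ M} (·-congʳ {h = 𝟙 ⊕ mono -1ℤ N} (mono-^ (suc m))) ⟩
    (𝟙 ⊕ mono -1ℤ M) ⊕ mono 1ℤ M · (𝟙 ⊕ mono -1ℤ N)
      ≈⟨ solve-series 4 (λ e p q r → (e ⊞ p) ⊞ q ⊗ (e ⊞ r)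
            ⊜ e ⊞ (p ⊞ e ⊗ q) ⊞ q ⊗ r) (λ _ → refl) 𝟙 (mono -1ℤ M) (mono 1ℤ M) (mono -1ℤ N) ⟩
    𝟙 ⊕ (mono -1ℤ M ⊕ 𝟙 · mono 1ℤ M) ⊕ mono 1ℤ M · mono -1ℤ N
      ≈⟨ S.+-cong (S.+-congˡ {𝟙} (≗-trans (S.+-congˡ {mono -1ℤ M} (·-identityˡ _))
           (≗-trans (mono-⊕-mono -1ℤ 1ℤ M) (mono-0ℤ M)))) (mono-·-mono 1ℤ M -1ℤ N) ⟩
    𝟙 ⊕ 𝟘 ⊕ mono -1ℤ (M ℕ.+ N)
      ≈⟨ S.+-congʳ {mono -1ℤ (M ℕ.+ N)} (S.+-identityʳ 𝟙) ⟩
    𝟙 ⊕ mono -1ℤ (M ℕ.+ N)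
      ≈⟨ 1+mono-cong -1ℤ (ℕ.+-comm M N) ⟩
    𝟙 ⊕ mono -1ℤ (N ℕ.+ M)
      ≈⟨ 1+mono-cong -1ℤ (solve 3 (λ c m n → c :+ n :* c :+ (c :+ m :* c)
            := c :+ (c :+ n :* c) :+ m :* c) refl c m n) ⟩
    progression -1ℤ (c ℕ.+ suc n ℕ.* c) c m ∎
    where
    open ≗-Reasoning
    open ℕ.+-*-Solver
    M = c ℕ.+ m ℕ.* c
    N = c ℕ.+ n ℕ.* c

  -- After `gauss-pascal` the induction hypotheses give both summands the factor `P′`, and
  -- `factor-telescope` adds up the rest. This is the quotient formula for Gaussian binomials with
  -- its denominator cleared.
  gauss-·-∏ : ∀ m n → gauss (m ℕ.+ n) m · ∏ (progression -1ℤ c c) m ≗ ∏ (progression -1ℤ (c ℕ.+ n ℕ.* c) c) m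
  gauss-·-∏ zero    n       = ≗-trans (·-congʳ (gauss-zero n)) (·-identityˡ 𝟙)
  gauss-·-∏ (suc m) zero    = ≗-trans
    (·-cong (≗-trans (λ k → cong (λ j → gauss j (suc m) k) (ℕ.+-identityʳ (suc m))) (gauss-diag (suc m)))
      (∏.big-cong (suc m) λ k → 1+mono-cong -1ℤ (cong (ℕ._+ k ℕ.* c) (sym (ℕ.+-identityʳ c)))))
    (·-identityˡ _)
  gauss-·-∏ (suc m) (suc n) = begin
    gauss (suc m ℕ.+ suc n) (suc m) · (F · P)
      ≈⟨ ·-congʳ (gauss-pascal (m ℕ.+ suc n) m) ⟩
    (gauss (m ℕ.+ suc n) m ⊕ Q · gauss (m ℕ.+ suc n) (suc m)) · (F · P)
      ≈⟨ solve-series 5 (λ g Q h F P → (g ⊞ Q ⊗ h) ⊗ (F ⊗ P) ⊜ F ⊗ (g ⊗ P) ⊞ Q ⊗ (h ⊗ (F ⊗ P))) (λ _ → refl)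
           (gauss (m ℕ.+ suc n) m) Q (gauss (m ℕ.+ suc n) (suc m)) F P ⟩
    F · (gauss (m ℕ.+ suc n) m · P) ⊕ Q · (gauss (m ℕ.+ suc n) (suc m) · (F · P))
      ≈⟨ S.+-cong (·-congˡ (gauss-·-∏ m (suc n))) (·-congˡ (≗-trans
           (·-congʳ (λ k → cong (λ j → gauss j (suc m) k) (ℕ.+-suc m n))) (gauss-·-∏ (suc m) n))) ⟩
    F · P′ ⊕ Q · ∏ (progression -1ℤ (c ℕ.+ n ℕ.* c) c) (suc m)
      ≈⟨ S.+-congˡ {F · P′} (·-congˡ (≗-trans (∏.big-head (progression -1ℤ (c ℕ.+ n ℕ.* c) c) m)
           (·-cong (1+mono-cong -1ℤ (ℕ.+-identityʳ (c ℕ.+ n ℕ.* c)))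
               (∏.big-cong m λ k → 1+mono-cong -1ℤ (shift k))))) ⟩
    F · P′ ⊕ Q · (progression -1ℤ c c n · P′)
      ≈⟨ solve-series 4 (λ F P Q G → F ⊗ P ⊞ Q ⊗ (G ⊗ P)
            ⊜ (F ⊞ Q ⊗ G) ⊗ P) (λ _ → refl) F P′ Q (progression -1ℤ c c n) ⟩
    (F ⊕ Q · progression -1ℤ c c n) · P′
      ≈⟨ ·-congʳ (factor-telescope m n) ⟩
    ∏ (progression -1ℤ (c ℕ.+ suc n ℕ.* c) c) (suc m) ∎
    where
    open ≗-Reasoning
    F = progression -1ℤ c c m
    P = ∏ (progression -1ℤ c c) m
    P′ = ∏ (progression -1ℤ (c ℕ.+ suc n ℕ.* c) c) m
    Q = mono 1ℤ c ^ˢ suc m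
    shift : ∀ k → c ℕ.+ n ℕ.* c ℕ.+ suc k ℕ.* c ≡ c ℕ.+ suc n ℕ.* c ℕ.+ k ℕ.* c
    shift k = solve 3 (λ c n k → c :+ n :* c :+ (c :+ k :* c) := c :+ (c :+ n :* c) :+ k :* c) refl c n k
      where open ℕ.+-*-Solver

  -- `m ≥ d` lets `m` factors stand for the infinite product; `gauss-·-∏` then leaves the factors 1
  -- - q^{c(n+1+k)}, all 1 up to degree `d` since `n ≥ d`.
  gauss-limit : ∀ {d m n} → d ℕ.≤ m → d ℕ.≤ n → gauss (m ℕ.+ n) m · poch -1ℤ c c ≈[ d ] 𝟙
  gauss-limit {d} {m} {n} d≤m d≤n = ≈-trans
    (≈-· {g = gauss (m ℕ.+ n) m} (λ _ _ → refl) (∏∞-≈ (progression-multipliable -1ℤ 0<c 0<c) d≤m))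
    (≈-trans (≗⇒≈ (gauss-·-∏ m n)) (≈-trans (∏-≈ m factor≈𝟙) (≗⇒≈ (∏.big-ε m))))
    where
    factor≈𝟙 : ∀ k → progression -1ℤ (c ℕ.+ n ℕ.* c) c k ≈[ d ] 𝟙
    factor≈𝟙 k i i≤d = trans (cong (λ y → 𝟙 i ℤ.+ y) (mono-vanishes -1ℤ
      (ℕ.<-≤-trans (ℕ.+-mono-≤ 0<c (ℕ.≤-trans (ℕ.≤-trans i≤d d≤n) (ℕ.m≤m*n n c {{ℕ.>-nonZero 0<c}})))
        (ℕ.m≤m+n _ (k ℕ.* c))))) (ℤ.+-identityʳ (𝟙 i))

  shiftedTerm-+ˡ : ∀ s j → shiftedTerm (s ℕ.+ j) s ≡ term (mono x b) j
  shiftedTerm-+ˡ zero    j = shiftedTerm-zero j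
  shiftedTerm-+ˡ (suc s) j = shiftedTerm-+ˡ s j

  shiftedTerm-vanishesˡ : ∀ {d N s} → s ℕ.≤ N → d ℕ.< N ℕ.∸ s → shiftedTerm N s ≈[ d ] 𝟘
  shiftedTerm-vanishesˡ {d} {N} {s} s≤N d< = subst (λ M → shiftedTerm M s ≈[ d ] 𝟘) (ℕ.m+[n∸m]≡n s≤N)
    (subst (_≈[ d ] 𝟘) (sym (shiftedTerm-+ˡ s (N ℕ.∸ s))) (term-vanishes 0<b d<))

  shiftedTerm-vanishesʳ : ∀ {d N s} → N ℕ.≤ s → d ℕ.< s ℕ.∸ N → shiftedTerm N s ≈[ d ] 𝟘
  shiftedTerm-vanishesʳ {d} {N} {s} N≤s d< = subst (λ t → shiftedTerm N t ≈[ d ] 𝟘) (ℕ.m∸n+n≡m N≤s)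
    (subst (_≈[ d ] 𝟘) (sym (shiftedTerm-+ N (s ℕ.∸ N))) (term-vanishes 0<a d<))

  weight-vanishes : ∀ {d} g t p → t ≈[ d ] 𝟘 → g · t · p ≈[ d ] t
  weight-vanishes g t p t≈𝟘 = ≈-trans
    (≈-· (≈-trans (≈-· {g = g} (λ _ _ → refl) t≈𝟘) (≗⇒≈ (S.zeroʳ g))) (λ _ _ → refl))
    (≈-trans (≗⇒≈ (·-zeroˡ p)) (≈-sym t≈𝟘))

  -- For N > 2d the weight of the s-th term is 1 up to degree d, unless the term vanishes up to that degree.
  weight-limit : ∀ d s → let N = suc (d ℕ.+ d) in s ℕ.≤ N ℕ.+ N →
    gauss (N ℕ.+ N) s · shiftedTerm N s · poch -1ℤ c c ≈[ d ] shiftedTerm N s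
  weight-limit d s s≤2N with d ℕ.≤? s | d ℕ.≤? suc (d ℕ.+ d) ℕ.+ suc (d ℕ.+ d) ℕ.∸ s
  ... | yes d≤s | yes d≤2N∸s = ≈-trans
    (≗⇒≈ (solve-series 3 (λ g t p → g ⊗ t ⊗ p
          ⊜ (g ⊗ p) ⊗ t) (λ _ → refl) (gauss (N ℕ.+ N) s) (shiftedTerm N s) (poch -1ℤ c c)))
    (≈-trans (≈-·
          (subst (λ n → gauss n s · poch -1ℤ c c ≈[ d ] 𝟙) (ℕ.m+[n∸m]≡n s≤2N) (gauss-limit d≤s d≤2N∸s))
               (λ _ _ → refl))
      (≗⇒≈ (·-identityˡ (shiftedTerm N s))))
    where N = suc (d ℕ.+ d)
  ... | no d≰s  | _ = weight-vanishes (gauss (N ℕ.+ N) s) _ _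
    (shiftedTerm-vanishesˡ (ℕ.≤-trans (ℕ.<⇒≤ (ℕ.≰⇒> d≰s)) (ℕ.m≤n⇒m≤1+n (ℕ.m≤m+n d d))) d<N∸s)
    where
    N = suc (d ℕ.+ d)
    d<N∸s : d ℕ.< N ℕ.∸ s
    d<N∸s = ℕ.≤-trans (ℕ.≤-reflexive (sym (ℕ.m+n∸n≡m (suc d) d))) (ℕ.∸-monoʳ-≤ N (ℕ.<⇒≤ (ℕ.≰⇒> d≰s)))
  ... | yes _   | no d≰2N∸s = weight-vanishes (gauss (N ℕ.+ N) s) _ _
    (shiftedTerm-vanishesʳ (ℕ.m+n≤o⇒n≤o (suc d) d+N<s) (ℕ.m+n≤o⇒m≤o∸n (suc d) d+N<s))
    where
    N = suc (d ℕ.+ d)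
    d+N<s : suc d ℕ.+ N ℕ.≤ s
    d+N<s = ℕ.+-cancelˡ-≤ d _ _ (begin
      d ℕ.+ (suc d ℕ.+ N)          ≡⟨ ℕ.+-assoc d (suc d) N ⟨
      d ℕ.+ suc d ℕ.+ N            ≡⟨ cong (ℕ._+ N) (ℕ.+-suc d d) ⟩
      N ℕ.+ N                      ≤⟨ ℕ.m≤n+m∸n (N ℕ.+ N) s ⟩
      s ℕ.+ (N ℕ.+ N ℕ.∸ s)        ≤⟨ ℕ.+-monoʳ-≤ s (ℕ.<⇒≤ (ℕ.≰⇒> d≰2N∸s)) ⟩
      s ℕ.+ d                      ≡⟨ ℕ.+-comm s d ⟩
      d ℕ.+ s                      ∎)
      where open ℕ.≤-Reasoning

  ∑-≈-< : ∀ {d u v} N → (∀ k → k ℕ.< N → u k ≈[ d ] v k) → ∑ u N ≈[ d ] ∑ v N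
  ∑-≈-< zero    p = λ _ _ → refl
  ∑-≈-< (suc N) p = ≈-⊕ (p N ℕ.≤-refl) (∑-≈-< N λ k k<N → p k (ℕ.m<n⇒m<1+n k<N))

  private
    progression≗ : ∀ z k → progression x z c k ≗ 𝟙 ⊕ mono x z · mono 1ℤ c ^ˢ k
    progression≗ z k = S.+-congˡ {𝟙} (≗-sym (mono-·-mono-^ x z k))

  -- The infinite product turns the Gaussian weights into 1. With N = 2d + 1, an index too close to
  -- either end for this is more than `d` away from the centre N, where the term itself vanishes up
  -- to degree `d`.
  finite≈theta : ∀ d → let N = suc (d ℕ.+ d) in gaussSum N N · poch -1ℤ c c ≈[ d ] theta x a b
  finite≈theta d = ≈-trans (≗⇒≈ (∑-*ʳ _ (poch -1ℤ c c) (suc (N ℕ.+ N))))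
    (≈-trans (∑-≈-< (suc (N ℕ.+ N)) λ s s≤2N → weight-limit d s (ℕ.≤-pred s≤2N))
    (≈-trans (≗⇒≈ (∑-shiftedTerm N))
    (≈-trans (≈-⊕ (term-vanishes 0<a d<N) (λ _ _ → refl))
    (≈-trans (≗⇒≈ (S.+-identityˡ _))
    (≈-trans (≗⇒≈ (∑.big-cong N λ k → S.+-cong (term≗mono a k) (term≗mono b (suc k))))
      (≈-sym (∑∞-≈ (theta-summable x b 0<a) d<N)))))))
    where
    N = suc (d ℕ.+ d)
    d<N : d ℕ.< N
    d<N = s≤s (ℕ.m≤m+n d d)

  tripleProduct : poch x a c · poch x b c · poch -1ℤ c c ≗ theta x a b
  tripleProduct = ≈⇒≗ λ d → let N = suc (d ℕ.+ d); d≤N = ℕ.m≤n⇒m≤1+n (ℕ.m≤m+n d d) in ≈-trans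
    (≈-· (≈-trans (≈-· (∏∞-≈ (progression-multipliable x 0<a 0<c) d≤N)
        (∏∞-≈ (progression-multipliable x 0<b 0<c) d≤N))
            (≗⇒≈ (≗-trans
                  (·-cong (∏.big-cong N (progression≗ a)) (∏.big-cong N (progression≗ b)))
                      (finiteTripleProduct N N))))
       (λ _ _ → refl))
    (finite≈theta d)
-- Even and odd parts of theta series

even-≈ : ∀ {d g h} → g ≈[ d ℕ.+ d ] h → even g ≈[ d ] even h
even-≈ {g = g} {h} p n n≤d = trans (even-double g n)
  (trans (p (n ℕ.+ n) (ℕ.+-mono-≤ n≤d n≤d)) (sym (even-double h n)))

even-𝟘 : even 𝟘 ≗ 𝟘
even-𝟘 zero    = refl
even-𝟘 (suc n) = even-𝟘 n

even-∑ : ∀ v N → even (∑ v N) ≗ ∑ (even ∘ v) N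
even-∑ v zero    = even-𝟘
even-∑ v (suc N) = ≗-trans (even-⊕ (v N) (∑ v N)) (S.+-congˡ {even (v N)} (even-∑ v N))

tail-∑ : ∀ v N → tail (∑ v N) ≗ ∑ (tail ∘ v) N
tail-∑ v zero    n = refl
tail-∑ v (suc N) n = cong (λ y → v N (suc n) ℤ.+ y) (tail-∑ v N n)

odd-∑ : ∀ v N → odd (∑ v N) ≗ ∑ (odd ∘ v) N
odd-∑ v N = ≗-trans (even-cong (tail-∑ v N)) (even-∑ (tail ∘ v) N)

even-mono-even : ∀ x a → even (mono x (a ℕ.+ a)) ≗ mono x a
even-mono-even x zero    zero    = refl
even-mono-even x zero    (suc n) = even-𝟘 n
even-mono-even x (suc a) n rewrite ℕ.+-suc a a with n
... | zero  = refl
... | suc m = even-mono-even x a m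

odd-mono-even : ∀ x a → odd (mono x (a ℕ.+ a)) ≗ 𝟘
odd-mono-even x zero    n = even-𝟘 n
odd-mono-even x (suc a) n rewrite ℕ.+-suc a a with n
... | zero  = refl
... | suc m = odd-mono-even x a m

odd-mono-odd : ∀ x a → odd (mono x (suc (a ℕ.+ a))) ≗ mono x a
odd-mono-odd = even-mono-even

even-mono-odd : ∀ x a → even (mono x (suc (a ℕ.+ a))) ≗ 𝟘
even-mono-odd x a zero    = refl
even-mono-odd x a (suc n) = odd-mono-even x a n

-1^even : ∀ k → -1ℤ ℤ.^ (k ℕ.* 2) ≡ 1ℤ
-1^even zero    = refl
-1^even (suc k) = trans (sym (ℤ.*-assoc -1ℤ -1ℤ (-1ℤ ℤ.^ (k ℕ.* 2)))) (trans (ℤ.*-identityˡ _) (-1^even k))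

exponent-shift : ∀ a b c k → exponent (a ℕ.+ b) c k ≡ exponent a c k ℕ.+ k ℕ.* b
exponent-shift a b c zero    = refl
exponent-shift a b c (suc k) = trans (cong (ℕ._+ (a ℕ.+ b ℕ.+ k ℕ.* c)) (exponent-shift a b c k))
  (solve 5 (λ e a b c k → e :+ k :* b :+ (a :+ b :+ k :* c)
        := e :+ (a :+ k :* c) :+ (b :+ k :* b)) refl (exponent a c k) a b c k)
  where open ℕ.+-*-Solver

-- At index 2k the exponent is 2ka + 2e k(2k-1), twice k(a + e) + 4e k(k-1)/2.
exponent-double : ∀ a e k → exponent a (e ℕ.+ e) (k ℕ.* 2) ≡
                  exponent (a ℕ.+ e) (4 ℕ.* e) k ℕ.+ exponent (a ℕ.+ e) (4 ℕ.* e) k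
exponent-double a e zero    = refl
exponent-double a e (suc k) = trans
  (cong (λ m → m ℕ.+ (a ℕ.+ k ℕ.* 2 ℕ.* (e ℕ.+ e)) ℕ.+ (a ℕ.+ suc (k ℕ.* 2) ℕ.* (e ℕ.+ e)))
      (exponent-double a e k))
  (solve 4 (λ X a e k → X :+ X :+ (a :+ k :* con 2 :* (e :+ e)) :+ (a :+ (con 1 :+ k :* con 2) :* (e :+ e))
     := (X :+ (a :+ e :+ k :* (con 4 :* e))) :+ (X :+ (a :+ e :+ k :* (con 4 :* e)))) refl
         (exponent (a ℕ.+ e) (4 ℕ.* e) k) a e k)
  where open ℕ.+-*-Solver

-- Uniform in `r`, so that r = 0, 1, 2 treats `theta -1ℤ 1 1`, `theta -1ℤ 1 3` and `theta -1ℤ 1 5`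
-- at once. The n-th exponent is n + (r+1) n(n-1), which has the parity of n.
module Dissection (r : ℕ) where
  private
    e C b : ℕ
    e = suc r
    C = 4 ℕ.* e
    b = suc (r ℕ.+ r)
    open ℕ.+-*-Solver

    c≡ : 1 ℕ.+ b ≡ e ℕ.+ e
    c≡ = cong suc (sym (ℕ.+-suc r r))

    Ceven≡ : (2 ℕ.+ r) ℕ.+ (2 ℕ.+ 3 ℕ.* r) ≡ C
    Ceven≡ = solve 1 (λ r → con 2 :+ r :+ (con 2 :+ con 3 :* r) := con 4 :* (con 1 :+ r)) refl r

    Codd≡ : (4 ℕ.+ 3 ℕ.* r) ℕ.+ r ≡ C
    Codd≡ = solve 1 (λ r → con 4 :+ con 3 :* r :+ r := con 4 :* (con 1 :+ r)) refl r

    exponent-1-even : ∀ k → exponent 1 (1 ℕ.+ b) (k ℕ.* 2) ≡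
      exponent (2 ℕ.+ r) C k ℕ.+ exponent (2 ℕ.+ r) C k
    exponent-1-even k = trans (cong (λ c → exponent 1 c (k ℕ.* 2)) c≡) (exponent-double 1 e k)

    exponent-b-even : ∀ k → exponent b (1 ℕ.+ b) (k ℕ.* 2) ≡
      exponent (2 ℕ.+ 3 ℕ.* r) C k ℕ.+ exponent (2 ℕ.+ 3 ℕ.* r) C k
    exponent-b-even k = trans (cong (λ c → exponent b c (k ℕ.* 2)) c≡)
      (trans (exponent-double b e k) (cong (λ a → exponent a C k ℕ.+ exponent a C k)
        (solve 1 (λ r → con 1 :+ (r :+ r) :+ (con 1 :+ r) := con 2 :+ con 3 :* r) refl r)))

    exponent-1-odd : ∀ k → exponent 1 (1 ℕ.+ b) (suc (k ℕ.* 2)) ≡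
      suc (exponent (4 ℕ.+ 3 ℕ.* r) C k ℕ.+ exponent (4 ℕ.+ 3 ℕ.* r) C k)
    exponent-1-odd k = trans (cong₂ (λ m c → m ℕ.+ (1 ℕ.+ k ℕ.* 2 ℕ.* c)) (exponent-1-even k) c≡)
      (trans (solve 3 (λ X r k → X :+ X :+ (con 1 :+ k :* con 2 :* ((con 1 :+ r) :+ (con 1 :+ r)))
          := con 1 :+ (X :+ k :* (con 2 :* (con 1 :+ r)) :+ (X :+ k :* (con 2 :* (con 1 :+ r))))) refl
              (exponent (2 ℕ.+ r) C k) r k)
        (cong (λ m → suc (m ℕ.+ m))
            (trans (sym (exponent-shift (2 ℕ.+ r) (2 ℕ.* e) C k)) (cong (λ a → exponent a C k)
          (solve 1 (λ r → con 2 :+ r :+ con 2 :* (con 1 :+ r) := con 4 :+ con 3 :* r) refl r)))))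

    exponent-b-odd : ∀ k → exponent b (1 ℕ.+ b) (suc (k ℕ.* 2)) ≡
      suc (exponent r C (suc k) ℕ.+ exponent r C (suc k))
    exponent-b-odd k = trans (cong₂ (λ m c → m ℕ.+ (b ℕ.+ k ℕ.* 2 ℕ.* c))
        (trans (exponent-b-even k) (cong (λ m → m ℕ.+ m)
        (trans (cong (λ a → exponent a C k) (solve 1 (λ r → con 2 :+ con 3 :* r
              := r :+ con 2 :* (con 1 :+ r)) refl r))
          (exponent-shift r (2 ℕ.* e) C k)))) c≡)
      (solve 3 (λ X r k → (X :+ k :* (con 2 :* (con 1 :+ r))) :+ (X :+ k :* (con 2 :* (con 1 :+ r)))
            :+ ((con 1 :+ (r :+ r)) :+ k :* con 2 :* ((con 1 :+ r) :+ (con 1 :+ r)))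
          := con 1 :+ (X :+ (r :+ k :* (con 4 :* (con 1 :+ r))) :+
              (X :+ (r :+ k :* (con 4 :* (con 1 :+ r)))))) refl (exponent r C k) r k)

    mono-≡ : ∀ {x y a b} → x ≡ y → a ≡ b → mono x a ≗ mono y b
    mono-≡ refl refl n = refl

    1^ : ∀ k → 1ℤ ≡ 1ℤ ℤ.^ k
    1^ k = sym (ℤ.^-zeroˡ k)

    v : ℕ → Series
    v = thetaTerm -1ℤ 1 b

    -1^odd : ∀ k → -1ℤ ℤ.^ suc (k ℕ.* 2) ≡ -1ℤ
    -1^odd k = cong (-1ℤ ℤ.*_) (-1^even k)

    -- Two consecutive terms hold the indices 2k, -2k-1, 2k+1 and -2k-2. The even ones, 2k and
    -- 2(-k-1), form term k of the even part; the odd ones, 2k+1 and 2(-k-1)+1, form term k of the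
    -- odd part.
    block : ℕ → Series
    block k = v (1 ℕ.+ k ℕ.* 2) ⊕ (v (k ℕ.* 2) ⊕ 𝟘)

    module _ (k : ℕ) where
      open ≗-Reasoning
      P Q R T : ℕ
      P = exponent (4 ℕ.+ 3 ℕ.* r) C k
      Q = exponent (2 ℕ.+ 3 ℕ.* r) C (suc k)
      R = exponent (2 ℕ.+ r) C k
      T = exponent r C (suc k)

      evens odds : Series
      evens = mono 1ℤ (R ℕ.+ R) ⊕ mono 1ℤ (Q ℕ.+ Q)
      odds  = mono -1ℤ (suc (P ℕ.+ P)) ⊕ mono -1ℤ (suc (T ℕ.+ T))

      block≗ : block k ≗ odds ⊕ evens
      block≗ = ≗-trans
        (S.+-cong (S.+-cong (mono-≡ (-1^odd k) (exponent-1-odd k))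
            (mono-≡ (-1^even (suc k)) (exponent-b-even (suc k))))
          (≗-trans (S.+-identityʳ (v (k ℕ.* 2)))
              (S.+-cong (mono-≡ (-1^even k) (exponent-1-even k)) (mono-≡ (-1^odd k) (exponent-b-odd k)))))
        (solve-series 4 (λ p q r t → (p ⊞ q) ⊞ (r ⊞ t) ⊜ (p ⊞ t) ⊞ (r ⊞ q)) (λ _ → refl)
          (mono -1ℤ (suc (P ℕ.+ P))) (mono 1ℤ (Q ℕ.+ Q)) (mono 1ℤ (R ℕ.+ R)) (mono -1ℤ (suc (T ℕ.+ T))))

      even-block : even (block k) ≗ thetaTerm 1ℤ (2 ℕ.+ r) (2 ℕ.+ 3 ℕ.* r) k
      even-block = begin
        even (block k)
          ≈⟨ ≗-trans (even-cong block≗) (even-⊕ odds evens) ⟩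
        even odds ⊕ even evens
          ≈⟨ S.+-cong (even-⊕ (mono -1ℤ (suc (P ℕ.+ P))) _) (even-⊕ (mono 1ℤ (R ℕ.+ R)) _) ⟩
        (even (mono -1ℤ (suc (P ℕ.+ P))) ⊕ even (mono -1ℤ (suc (T ℕ.+ T)))) ⊕
            (even (mono 1ℤ (R ℕ.+ R)) ⊕ even (mono 1ℤ (Q ℕ.+ Q)))
          ≈⟨ S.+-cong (S.+-cong (even-mono-odd -1ℤ P) (even-mono-odd -1ℤ T))
              (S.+-cong (even-mono-even 1ℤ R) (even-mono-even 1ℤ Q)) ⟩
        (𝟘 ⊕ 𝟘) ⊕ (mono 1ℤ R ⊕ mono 1ℤ Q)
          ≈⟨ S.+-identityˡ (mono 1ℤ R ⊕ mono 1ℤ Q) ⟩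
        mono 1ℤ R ⊕ mono 1ℤ Q
          ≈⟨ S.+-cong (mono-≡ (1^ k) (cong (λ c → exponent (2 ℕ.+ r) c k) (sym Ceven≡)))
               (mono-≡ (1^ (suc k)) (cong (λ c → exponent (2 ℕ.+ 3 ℕ.* r) c (suc k)) (sym Ceven≡))) ⟩
        thetaTerm 1ℤ (2 ℕ.+ r) (2 ℕ.+ 3 ℕ.* r) k ∎

      odd-block : odd (block k) ≗ -1ℤ • thetaTerm 1ℤ (4 ℕ.+ 3 ℕ.* r) r k
      odd-block = begin
        odd (block k)
          ≈⟨ ≗-trans (even-cong (block≗ ∘ suc)) (even-⊕ (tail odds) (tail evens)) ⟩
        odd odds ⊕ odd evens
          ≈⟨ S.+-cong (even-⊕ (tail (mono -1ℤ (suc (P ℕ.+ P)))) (tail (mono -1ℤ (suc (T ℕ.+ T)))))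
               (even-⊕ (tail (mono 1ℤ (R ℕ.+ R))) (tail (mono 1ℤ (Q ℕ.+ Q)))) ⟩
        (odd (mono -1ℤ (suc (P ℕ.+ P))) ⊕ odd (mono -1ℤ (suc (T ℕ.+ T)))) ⊕
            (odd (mono 1ℤ (R ℕ.+ R)) ⊕ odd (mono 1ℤ (Q ℕ.+ Q)))
          ≈⟨ S.+-cong (S.+-cong (odd-mono-odd -1ℤ P) (odd-mono-odd -1ℤ T))
              (S.+-cong (odd-mono-even 1ℤ R) (odd-mono-even 1ℤ Q)) ⟩
        (mono -1ℤ P ⊕ mono -1ℤ T) ⊕ (𝟘 ⊕ 𝟘)
          ≈⟨ S.+-identityʳ (mono -1ℤ P ⊕ mono -1ℤ T) ⟩
        mono -1ℤ P ⊕ mono -1ℤ T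
          ≈⟨ S.+-cong (negate P) (negate T) ⟩
        (-1ℤ • mono 1ℤ P) ⊕ (-1ℤ • mono 1ℤ T)
          ≈⟨ (λ n → sym (ℤ.*-distribˡ-+ -1ℤ (mono 1ℤ P n) (mono 1ℤ T n))) ⟩
        -1ℤ • (mono 1ℤ P ⊕ mono 1ℤ T)
          ≈⟨ (λ n → cong (-1ℤ ℤ.*_) (S.+-cong
              (mono-≡ (1^ k) (cong (λ c → exponent (4 ℕ.+ 3 ℕ.* r) c k) (sym Codd≡)))
               (mono-≡ (1^ (suc k)) (cong (λ c → exponent r c (suc k)) (sym Codd≡))) n)) ⟩
        -1ℤ • thetaTerm 1ℤ (4 ℕ.+ 3 ℕ.* r) r k ∎
        where
        negate : ∀ a → mono -1ℤ a ≗ -1ℤ • mono 1ℤ a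
        negate a = ≗-trans (≗-sym (mono-·-mono -1ℤ 0 1ℤ a)) (mono-0-· -1ℤ (mono 1ℤ a))

    -- Degree 2d + 1 rather than 2d, because the odd part up to degree `d` reads that coefficient.
    theta≈ : ∀ d → theta -1ℤ 1 b ≈[ suc (d ℕ.+ d) ] ∑ block (suc d)
    theta≈ d = ≈-trans (∑∞-≈ (theta-summable -1ℤ b (s≤s z≤n)) (ℕ.≤-reflexive
        (solve 1 (λ d → con 2 :+ (d :+ d) := (con 1 :+ d) :* con 2) refl d)))
      (≗⇒≈ (∑.big-blocks v 2 (suc d)))

  even-theta : even (theta -1ℤ 1 (suc (r ℕ.+ r))) ≗ theta 1ℤ (2 ℕ.+ r) (2 ℕ.+ 3 ℕ.* r)
  even-theta = ≈⇒≗ λ d → ≈-trans (even-≈ {d} (≈-mono (ℕ.n≤1+n (d ℕ.+ d)) (theta≈ d)))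
    (≈-trans (≗⇒≈ (≗-trans (even-∑ block (suc d)) (∑.big-cong (suc d) even-block)))
      (≈-sym (∑∞-≈ (theta-summable 1ℤ (2 ℕ.+ 3 ℕ.* r) (s≤s z≤n)) ℕ.≤-refl)))

  odd-theta : odd (theta -1ℤ 1 (suc (r ℕ.+ r))) ≗ -1ℤ • theta 1ℤ (4 ℕ.+ 3 ℕ.* r) r
  odd-theta = ≈⇒≗ λ d → ≈-trans (even-≈ {d} λ n n≤2d → theta≈ d (suc n) (s≤s n≤2d))
    (≈-trans (≗⇒≈ (≗-trans (odd-∑ block (suc d))
        (≗-trans (∑.big-cong (suc d) odd-block) (∑-• (thetaTerm 1ℤ (4 ℕ.+ 3 ℕ.* r) r) (suc d)))))
      λ n n≤d → cong (-1ℤ ℤ.*_) (sym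
          (∑∞-≈ (theta-summable 1ℤ {4 ℕ.+ 3 ℕ.* r} r (s≤s z≤n)) {d} {suc d} ℕ.≤-refl n n≤d)))
    where
    ∑-• : ∀ u N → ∑ (λ k → -1ℤ • u k) N ≗ -1ℤ • ∑ u N
    ∑-• u zero    n = refl
    ∑-• u (suc N) n = trans (cong (λ y → -1ℤ ℤ.* u N n ℤ.+ y) (∑-• u N n))
        (sym (ℤ.*-distribˡ-+ -1ℤ (u N n) (∑ u N n)))

module _ (x : ℤ) (a b : ℕ) (sgn-a+b≡1 : sgn (a ℕ.+ b) ≡ 1ℤ) (sgn-b≡sgn-a : sgn b ≡ sgn a) where
  private
    sgn-exponent : ∀ {z} → sgn z ≡ sgn a → ∀ k → sgn (exponent z (a ℕ.+ b) k) ℤ.* x ℤ.^ k ≡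
        (sgn a ℤ.* x) ℤ.^ k
    sgn-exponent p zero    = refl
    sgn-exponent {z} p (suc k) = begin
      sgn (E ℕ.+ (z ℕ.+ k ℕ.* (a ℕ.+ b))) ℤ.* (x ℤ.* x ℤ.^ k)
        ≡⟨ cong (ℤ._* (x ℤ.* x ℤ.^ k)) (trans (sgn-+ E _) (cong (sgn E ℤ.*_) (trans (sgn-+ z _)
             (trans (cong₂ ℤ._*_ p (sgn-* k)) (ℤ.*-identityʳ (sgn a)))))) ⟩
      sgn E ℤ.* sgn a ℤ.* (x ℤ.* x ℤ.^ k)
        ≡⟨ rearrange (sgn E) (sgn a) x (x ℤ.^ k) ⟩
      (sgn a ℤ.* x) ℤ.* (sgn E ℤ.* x ℤ.^ k)
        ≡⟨ cong ((sgn a ℤ.* x) ℤ.*_) (sgn-exponent p k) ⟩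
      (sgn a ℤ.* x) ℤ.^ suc k ∎
      where
      open ≡-Reasoning
      E = exponent z (a ℕ.+ b) k
      sgn-* : ∀ k → sgn (k ℕ.* (a ℕ.+ b)) ≡ 1ℤ
      sgn-* zero    = refl
      sgn-* (suc k) = trans (sgn-+ (a ℕ.+ b) _) (cong₂ ℤ._*_ sgn-a+b≡1 (sgn-* k))
      rearrange : ∀ s t x y → s ℤ.* t ℤ.* (x ℤ.* y) ≡ (t ℤ.* x) ℤ.* (s ℤ.* y)
      rearrange = solve 4 (λ s t x y → s :* t :* (x :* y) := (t :* x) :* (s :* y)) refl
        where open ℤ.+-*-Solver

  -- The n-th exponent is na + (a+b) n(n-1)/2, and each multiple of `a + b` has sign 1. So q ↦ -q
  -- multiplies the n-th term by the n-th power of `sgn a`, which merges with the power of `x`.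
  twist-theta : twist (theta x a b) ≗ theta (sgn a ℤ.* x) a b
  twist-theta n = trans (twist-∑ (thetaTerm x a b) (suc n) n) (∑.big-cong (suc n) twist-term n)
    where
    twist-∑ : ∀ v N → twist (∑ v N) ≗ ∑ (twist ∘ v) N
    twist-∑ v zero    n = ℤ.*-zeroʳ (sgn n)
    twist-∑ v (suc N) = ≗-trans (twist-⊕ (v N) (∑ v N)) (S.+-congˡ {twist (v N)} (twist-∑ v N))
    twist-monomial : ∀ {z} → sgn z ≡ sgn a → ∀ k →
      twist (mono (x ℤ.^ k) (exponent z (a ℕ.+ b) k)) ≗ mono ((sgn a ℤ.* x) ℤ.^ k) (exponent z (a ℕ.+ b) k)
    twist-monomial {z} p k = ≗-trans (twist-mono (x ℤ.^ k) (exponent z (a ℕ.+ b) k))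
      λ n → cong (λ s → mono s (exponent z (a ℕ.+ b) k) n) (sgn-exponent p k)
    twist-term : ∀ k → twist (thetaTerm x a b k) ≗ thetaTerm (sgn a ℤ.* x) a b k
    twist-term k = ≗-trans (twist-⊕ (mono (x ℤ.^ k) (exponent a (a ℕ.+ b) k)) _)
      (S.+-cong (twist-monomial refl k) (twist-monomial sgn-b≡sgn-a (suc k)))
-- Positivity of coefficients

0≤i*j : ∀ {i j} → 0ℤ ℤ.≤ i → 0ℤ ℤ.≤ j → 0ℤ ℤ.≤ i ℤ.* j
0≤i*j {i} {j} 0≤i 0≤j = subst (ℤ._≤ i ℤ.* j) (ℤ.*-zeroʳ i)
  (ℤ.*-monoˡ-≤-nonNeg i {{ℤ.nonNegative 0≤i}} 0≤j)

0<i*j : ∀ {i j} → 0ℤ ℤ.< i → 0ℤ ℤ.< j → 0ℤ ℤ.< i ℤ.* j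
0<i*j {i} {j} 0<i 0<j = subst (ℤ._< i ℤ.* j) (ℤ.*-zeroʳ i)
  (ℤ.*-monoˡ-<-pos i {{ℤ.positive 0<i}} 0<j)

NonNegative Positive : Series → Set
NonNegative g = ∀ n → 0ℤ ℤ.≤ g n
Positive    g = ∀ n → 0ℤ ℤ.< g n

0≤-· : ∀ n {g h} → (∀ m → m ℕ.≤ n → 0ℤ ℤ.≤ g m) → (∀ m → m ℕ.≤ n → 0ℤ ℤ.≤ h m) → 0ℤ ℤ.≤ (g · h) n
0≤-· zero    {g} {h} p r = subst (0ℤ ℤ.≤_) (sym (·-zero g h)) (0≤i*j (p 0 z≤n) (r 0 z≤n))
0≤-· (suc n) {g} {h} p r = subst (0ℤ ℤ.≤_) (sym (·-suc g h n))
  (ℤ.+-mono-≤ (0≤i*j (p 0 z≤n) (r (suc n) ℕ.≤-refl))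
    (0≤-· n (λ m m≤n → p (suc m) (s≤s m≤n)) (λ m m≤n → r m (ℕ.m≤n⇒m≤1+n m≤n))))

nonNegative-· : NonNegative g → NonNegative h → NonNegative (g · h)
nonNegative-· p r n = 0≤-· n (λ m _ → p m) (λ m _ → r m)

nonNegative-⊕ : NonNegative g → NonNegative h → NonNegative (g ⊕ h)
nonNegative-⊕ p r n = ℤ.+-mono-≤ (p n) (r n)

nonNegative-mono : ∀ a → NonNegative (mono 1ℤ a)
nonNegative-mono zero    zero    = ℤ.+≤+ z≤n
nonNegative-mono zero    (suc n) = ℤ.≤-refl
nonNegative-mono (suc a) zero    = ℤ.≤-refl
nonNegative-mono (suc a) (suc n) = nonNegative-mono a n

nonNegative-resp : g ≗ h → NonNegative g → NonNegative h
nonNegative-resp p 0≤g n = subst (0ℤ ℤ.≤_) (p n) (0≤g n)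

nonNegative-𝟙 : NonNegative 𝟙
nonNegative-𝟙 = nonNegative-resp mono-𝟙 (nonNegative-mono 0)

nonNegative-∏∞ : ∀ {u} → (∀ k → NonNegative (u k)) → NonNegative (∏∞ u)
nonNegative-∏∞ {u} p n = go n n
  where
  go : ∀ N → NonNegative (∏ u N)
  go zero    = nonNegative-𝟙
  go (suc N) = nonNegative-· (p N) (go N)

0<-· : ∀ i j → NonNegative g → NonNegative h → 0ℤ ℤ.< g i → 0ℤ ℤ.< h j → 0ℤ ℤ.< (g · h) (i ℕ.+ j)
0<-· {g} {h} zero zero    0≤g 0≤h 0<g 0<h = subst (0ℤ ℤ.<_) (sym (·-zero g h)) (0<i*j 0<g 0<h)
0<-· {g} {h} zero (suc j) 0≤g 0≤h 0<g 0<h = subst (0ℤ ℤ.<_) (sym (·-suc g h j))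
  (ℤ.+-mono-<-≤ (0<i*j 0<g 0<h) (nonNegative-· (0≤g ∘ suc) 0≤h j))
0<-· {g} {h} (suc i) j    0≤g 0≤h 0<g 0<h = subst (0ℤ ℤ.<_) (sym (·-suc g h (i ℕ.+ j)))
  (ℤ.+-mono-≤-< (0≤i*j (0≤g 0) (0≤h (suc (i ℕ.+ j)))) (0<-· i j (0≤g ∘ suc) 0≤h 0<g 0<h))

positive-resp : g ≗ h → Positive g → Positive h
positive-resp p 0<g n = subst (0ℤ ℤ.<_) (p n) (0<g n)

positive-· : Positive g → NonNegative h → 0ℤ ℤ.< h 0 → Positive (g · h)
positive-· {g} {h} 0<g 0≤h 0<h n = subst (λ m → 0ℤ ℤ.< (g · h) m) (ℕ.+-identityʳ n)
  (0<-· n 0 (λ m → ℤ.<⇒≤ (0<g m)) 0≤h (0<g n) 0<h)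

-- An odd degree is odd + 0, a positive even degree is odd + 1. Made for `g = o`, which counts
-- partitions into distinct odd parts and so has gaps among the even degrees, for example at 2.
positive-·-odd : NonNegative g → 0ℤ ℤ.< g 0 → (∀ k → 0ℤ ℤ.< g (suc (k ℕ.* 2))) →
                 NonNegative h → 0ℤ ℤ.< h 0 → 0ℤ ℤ.< h 1 → Positive (g · h)
positive-·-odd {g} {h} 0≤g 0<g₀ 0<g 0≤h 0<h₀ 0<h₁ n with parity n
  where
  parity : ∀ n → (∃ λ k → n ≡ k ℕ.* 2) ⊎ (∃ λ k → n ≡ suc (k ℕ.* 2))
  parity zero    = inj₁ (0 , refl)
  parity (suc n) with parity n
  ... | inj₁ (k , p) = inj₂ (k , cong suc p)
  ... | inj₂ (k , p) = inj₁ (suc k , cong suc p)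
... | inj₁ (zero  , refl) = 0<-· 0 0 0≤g 0≤h 0<g₀ 0<h₀
... | inj₁ (suc k , refl) = subst (λ m → 0ℤ ℤ.< (g · h) m) (ℕ.+-comm _ 1)
    (0<-· (suc (k ℕ.* 2)) 1 0≤g 0≤h (0<g k) 0<h₁)
... | inj₂ (k , refl)     = subst (λ m → 0ℤ ℤ.< (g · h) m) (ℕ.+-identityʳ _) (0<-· _ 0 0≤g 0≤h (0<g k) 0<h₀)

-- Division with remainder: `h` supplies the remainder and `g` the multiple of `c`. Made for
-- reciprocals 1/(q^c; ...)_∞.
positive-·-periodic : ∀ c .{{_ : NonZero c}} → NonNegative g → (∀ k → 0ℤ ℤ.< g (k ℕ.* c)) →
                      NonNegative h → (∀ i → i ℕ.< c → 0ℤ ℤ.< h i) → Positive (h · g)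
positive-·-periodic {g} {h} c 0≤g 0<g 0≤h 0<h n = subst (λ m → 0ℤ ℤ.< (h · g) m) (sym (m≡m%n+[m/n]*n n c))
  (0<-· (n ℕ.% c) (n ℕ./ c ℕ.* c) 0≤h 0≤g (0<h (n ℕ.% c) (m%n<n n c)) (0<g (n ℕ./ c)))

nonNegative-theta : ∀ a b → NonNegative (theta 1ℤ a b)
nonNegative-theta a b n = go (suc n) n
  where
  nonNegative-mono-^ : ∀ k m → NonNegative (mono (1ℤ ℤ.^ k) m)
  nonNegative-mono-^ k m = subst (λ x → NonNegative (mono x m)) (sym (ℤ.^-zeroˡ k)) (nonNegative-mono m)
  go : ∀ N → NonNegative (∑ (thetaTerm 1ℤ a b) N)
  go zero    n = ℤ.≤-refl
  go (suc N) = nonNegative-⊕ (nonNegative-⊕ (nonNegative-mono-^ N (exponent a (a ℕ.+ b) N))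
    (nonNegative-mono-^ (suc N) (exponent b (a ℕ.+ b) (suc N)))) (go N)

theta-zero-positive : ∀ a b → 0ℤ ℤ.< theta 1ℤ a b 0
theta-zero-positive a b = ℤ.+-mono-<-≤
    (ℤ.+-mono-<-≤ (ℤ.+<+ (s≤s z≤n)) (nonNegative-mono (b ℕ.+ 0) 0)) ℤ.≤-refl

nonNegative-poch : ∀ a c → NonNegative (poch 1ℤ a c)
nonNegative-poch a c = nonNegative-∏∞ λ k → nonNegative-⊕ nonNegative-𝟙 (nonNegative-mono (a ℕ.+ k ℕ.* c))

0<1 : 0ℤ ℤ.< 1ℤ
0<1 = ℤ.+<+ (s≤s z≤n)

poch-positive : ∀ a c k .{{_ : NonZero a}} .{{_ : NonZero c}} → 0ℤ ℤ.< poch 1ℤ a c (a ℕ.+ k ℕ.* c)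
poch-positive a c zero = subst (0ℤ ℤ.<_) (sym (poch-head 1ℤ a c (a ℕ.+ 0)))
  (0<-· a 0 (nonNegative-⊕ nonNegative-𝟙 (nonNegative-mono a)) (nonNegative-poch (a ℕ.+ c) c)
    (ℤ.+-mono-≤-< (nonNegative-𝟙 a) (subst (0ℤ ℤ.<_) (sym (mono-diag 1ℤ a)) 0<1)) 0<1)
poch-positive a c (suc k) = subst (0ℤ ℤ.<_)
  (trans (sym (poch-head 1ℤ a c (a ℕ.+ c ℕ.+ k ℕ.* c))) (cong (poch 1ℤ a c) (ℕ.+-assoc a c (k ℕ.* c))))
  (0<-· 0 (a ℕ.+ c ℕ.+ k ℕ.* c) (nonNegative-⊕ nonNegative-𝟙 (nonNegative-mono a))
      (nonNegative-poch (a ℕ.+ c) c)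
    (ℤ.+-mono-<-≤ 0<1 (nonNegative-mono a 0)) (poch-positive (a ℕ.+ c) c k {{ℕ.>-nonZero 0<a+c}}))
  where
  0<a+c : 0 ℕ.< a ℕ.+ c
  0<a+c = ℕ.<-≤-trans (ℕ.>-nonZero⁻¹ a) (ℕ.m≤m+n a c)

module Geometric (a : ℕ) .{{_ : NonZero a}} where
  geometric : Series
  geometric = (𝟙 ⊕ mono -1ℤ a) ⁻¹

  geometric-inverse : (𝟙 ⊕ mono -1ℤ a) · geometric ≗ 𝟙
  geometric-inverse = ·-inverse (𝟙 ⊕ mono -1ℤ a) (cong (λ y → 1ℤ ℤ.+ y) (mono-vanishes -1ℤ (ℕ.>-nonZero⁻¹ a)))

  geometric-recurrence : geometric ≗ 𝟙 ⊕ mono 1ℤ a · geometric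
  geometric-recurrence = begin
    geometric                                                       ≈⟨ ·-identityˡ geometric ⟨
    𝟙 · geometric                                                   ≈⟨ ·-congʳ (S.+-identityʳ 𝟙) ⟨
    (𝟙 ⊕ 𝟘) · geometric                                             ≈⟨ ·-congʳ (S.+-congˡ {𝟙}
          (≗-trans (mono-⊕-mono -1ℤ 1ℤ a) (mono-0ℤ a))) ⟨
    (𝟙 ⊕ (mono -1ℤ a ⊕ mono 1ℤ a)) · geometric
        ≈⟨ solve-series 4 (λ e m p g → (e ⊞ (m ⊞ p)) ⊗ g
          ⊜ (e ⊞ m) ⊗ g ⊞ p ⊗ g) (λ _ → refl) 𝟙 (mono -1ℤ a) (mono 1ℤ a) geometric ⟩
    (𝟙 ⊕ mono -1ℤ a) · geometric ⊕ mono 1ℤ a · geometric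
        ≈⟨ S.+-congʳ {mono 1ℤ a · geometric} geometric-inverse ⟩
    𝟙 ⊕ mono 1ℤ a · geometric                                       ∎
    where open ≗-Reasoning

  -- Strong induction on the degree along `geometric-recurrence`, with `N` as the bound on which
  -- `go` and `below` recurse.
  nonNegative-geometric : NonNegative geometric
  nonNegative-geometric n = go n n ℕ.≤-refl
    where
    shifted : ∀ a n → 0 ℕ.< a → (∀ m → m ℕ.< n → 0ℤ ℤ.≤ geometric m) → 0ℤ ℤ.≤ (mono 1ℤ a · geometric) n
    shifted (suc a) zero    _ p = ℤ.≤-reflexive (sym (mono-suc-·-zero 1ℤ a geometric))
    shifted (suc a) (suc n) _ p = subst (0ℤ ℤ.≤_) (sym (mono-suc-·-suc 1ℤ a geometric n))
      (0≤-· n (λ m _ → nonNegative-mono a m) (λ m m≤n → p m (s≤s m≤n)))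
    go : ∀ N n → n ℕ.≤ N → 0ℤ ℤ.≤ geometric n
    go N n n≤N = subst (0ℤ ℤ.≤_) (sym (geometric-recurrence n))
      (ℤ.+-mono-≤ (nonNegative-𝟙 n)
          (shifted a n (ℕ.>-nonZero⁻¹ a) (λ m m<n → below N m (ℕ.<-≤-trans m<n n≤N))))
      where
      below : ∀ N m → m ℕ.< N → 0ℤ ℤ.≤ geometric m
      below (suc N) m (s≤s m≤N) = go N m m≤N

  geometric-positive : ∀ k → 0ℤ ℤ.< geometric (k ℕ.* a)
  geometric-positive zero    = 0<1
  geometric-positive (suc k) = subst (0ℤ ℤ.<_) (sym (geometric-recurrence (a ℕ.+ k ℕ.* a)))
    (ℤ.+-mono-≤-< (nonNegative-𝟙 (a ℕ.+ k ℕ.* a)) (0<-· a (k ℕ.* a) (nonNegative-mono a) nonNegative-geometric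
      (subst (0ℤ ℤ.<_) (sym (mono-diag 1ℤ a)) 0<1) (geometric-positive k)))

open Geometric

inverse-≈𝟙 : ∀ {d} g → g 0 ≡ 1ℤ → g ≈[ d ] 𝟙 → g ⁻¹ ≈[ d ] 𝟙
inverse-≈𝟙 g g₀≡1 g≈𝟙 = ≈-trans (≗⇒≈ (≗-sym (·-identityˡ (g ⁻¹))))
  (≈-trans (≈-· {h = g ⁻¹} (≈-sym g≈𝟙) (λ _ _ → refl)) (≗⇒≈ (·-inverse g g₀≡1)))

multipliable-⁻¹ : ∀ {u} → Multipliable u → Multipliable λ k → u k ⁻¹
multipliable-⁻¹ {u} p k = inverse-≈𝟙 (u k) (p k 0 z≤n) (p k)

∏∞-⁻¹ : ∀ {u} → Multipliable u → (∏∞ u) ⁻¹ ≗ ∏∞ λ k → u k ⁻¹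
∏∞-⁻¹ {u} p = inverse-unique (·-inverse (∏∞ u) refl) (begin
  ∏∞ u · ∏∞ (λ k → u k ⁻¹)       ≈⟨ ∏∞-· p (multipliable-⁻¹ p) ⟨
  ∏∞ (λ k → u k · u k ⁻¹)        ≈⟨ ∏∞-cong (λ k → ·-inverse (u k) (p k 0 z≤n)) ⟩
  ∏∞ (λ _ → 𝟙)                   ≈⟨ (λ n → ∏.big-ε n n) ⟩
  𝟙                              ∎)
  where open ≗-Reasoning

⁻¹-· : ∀ g h → g 0 ≡ 1ℤ → h 0 ≡ 1ℤ → (g · h) ⁻¹ ≗ g ⁻¹ · h ⁻¹
⁻¹-· g h p r = inverse-unique (·-inverse (g · h) (trans (·-zero g h) (cong₂ ℤ._*_ p r))) (begin
  g · h · (g ⁻¹ · h ⁻¹)        ≈⟨ solve-series 4 (λ g h a b → g ⊗ h ⊗ (a ⊗ b)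
        ⊜ (g ⊗ a) ⊗ (h ⊗ b)) (λ _ → refl) g h (g ⁻¹) (h ⁻¹) ⟩
  (g · g ⁻¹) · (h · h ⁻¹)      ≈⟨ ·-cong (·-inverse g p) (·-inverse h r) ⟩
  𝟙 · 𝟙                        ≈⟨ ·-identityˡ 𝟙 ⟩
  𝟙                            ∎)
  where open ≗-Reasoning

⁻¹-cong : g 0 ≡ 1ℤ → g ≗ h → g ⁻¹ ≗ h ⁻¹
⁻¹-cong {g} {h} p g≗h = inverse-unique (·-inverse g p)
  (≗-trans (·-congʳ g≗h) (·-inverse h (trans (sym (g≗h 0)) p)))

nonNegative-poch⁻¹ : ∀ a c .{{_ : NonZero a}} .{{_ : NonZero c}} → NonNegative (poch -1ℤ a c ⁻¹)
nonNegative-poch⁻¹ a c = nonNegative-resp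
  (≗-sym (∏∞-⁻¹ (progression-multipliable -1ℤ (ℕ.>-nonZero⁻¹ a) (ℕ.>-nonZero⁻¹ c))))
  (nonNegative-∏∞ λ k → nonNegative-geometric (a ℕ.+ k ℕ.* c)
    {{ℕ.>-nonZero (ℕ.<-≤-trans (ℕ.>-nonZero⁻¹ a) (ℕ.m≤m+n a (k ℕ.* c)))}})

poch⁻¹-positive : ∀ a c k .{{_ : NonZero a}} .{{_ : NonZero c}} → 0ℤ ℤ.< (poch -1ℤ a c ⁻¹) (k ℕ.* a)
poch⁻¹-positive a c k = subst (0ℤ ℤ.<_) (trans
    (sym (≗-trans (⁻¹-cong refl (poch-head -1ℤ a c))
        (⁻¹-· (𝟙 ⊕ mono -1ℤ a) (poch -1ℤ (a ℕ.+ c) c) 1+mono-zero refl) (k ℕ.* a ℕ.+ 0)))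
    (cong (poch -1ℤ a c ⁻¹) (ℕ.+-identityʳ (k ℕ.* a))))
  (0<-· (k ℕ.* a) 0 (nonNegative-geometric a)
      (nonNegative-poch⁻¹ (a ℕ.+ c) c {{ℕ.>-nonZero (ℕ.<-≤-trans (ℕ.>-nonZero⁻¹ a) (ℕ.m≤m+n a c))}})
    (geometric-positive a k) 0<1)
  where
  1+mono-zero : (𝟙 ⊕ mono -1ℤ a) 0 ≡ 1ℤ
  1+mono-zero = cong (λ y → 1ℤ ℤ.+ y) (mono-vanishes -1ℤ (ℕ.>-nonZero⁻¹ a))

-- The series (q^j; q^j)_∞, their transforms, and the theta identities

E I : (j : ℕ) → Series
E j = poch -1ℤ j j
I j = E j ⁻¹

-- (−q; q²)_∞, (−q³; q⁶)_∞ and their quotient (−q, −q⁵; q⁶)_∞.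
o o₃ w φ : Series
o  = poch 1ℤ 1 2
o₃ = poch 1ℤ 3 6
w  = poch 1ℤ 1 6 · poch 1ℤ 5 6
φ  = o · o · E 2

E·I : ∀ j → E j · I j ≗ 𝟙
E·I j = ·-inverse (E j) refl

o≗w·o₃ : o ≗ w · o₃
o≗w·o₃ = ≗-trans (poch-split 1ℤ 1 2 3)
  (solve-series 3 (λ p q r → r ⊗ (q ⊗ (p ⊗ numeral 1))
        ⊜ (p ⊗ r) ⊗ q) (λ _ → refl) (poch 1ℤ 1 6) (poch 1ℤ 3 6) (poch 1ℤ 5 6))

twist-E₁ : twist (E 1) ≗ o · E 2
twist-E₁ = begin
  twist (E 1)                                  ≈⟨ twist-cong (poch-split -1ℤ 1 1 2) ⟩
  twist (E 2 · (poch -1ℤ 1 2 · 𝟙))             ≈⟨ twist-cong (solve-series 2 (λ p q → q ⊗ (p ⊗ numeral 1)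
        ⊜ p ⊗ q) (λ _ → refl) (poch -1ℤ 1 2) (E 2)) ⟩
  twist (poch -1ℤ 1 2 · E 2)                   ≈⟨ twist-· (poch -1ℤ 1 2) (E 2) ⟩
  twist (poch -1ℤ 1 2) · twist (E 2)           ≈⟨ ·-cong (twist-poch -1ℤ 1 1) (twist-poch -1ℤ 2 1) ⟩
  o · E 2                                      ∎
  where open ≗-Reasoning

twist-E₂ : twist (E 2) ≗ E 2
twist-E₂ = twist-poch -1ℤ 2 1

twist-E₃ : twist (E 3) ≗ o₃ · E 6
twist-E₃ = begin
  twist (E 3)                                  ≈⟨ twist-cong (poch-split -1ℤ 3 3 2) ⟩
  twist (E 6 · (poch -1ℤ 3 6 · 𝟙))             ≈⟨ twist-cong (solve-series 2 (λ p q → q ⊗ (p ⊗ numeral 1)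
        ⊜ p ⊗ q) (λ _ → refl) (poch -1ℤ 3 6) (E 6)) ⟩
  twist (poch -1ℤ 3 6 · E 6)                   ≈⟨ twist-· (poch -1ℤ 3 6) (E 6) ⟩
  twist (poch -1ℤ 3 6) · twist (E 6)           ≈⟨ ·-cong (twist-poch -1ℤ 3 3) (twist-poch -1ℤ 6 3) ⟩
  o₃ · E 6                                     ∎
  where open ≗-Reasoning

twist-I₂ : twist (I 2) ≗ I 2
twist-I₂ = inverse-unique (≗-trans (·-congʳ (≗-sym twist-E₂)) (Twist.F-inverse (E·I 2))) (E·I 2)

twist-I₃ : twist (I 3) ≗ o₃ ⁻¹ · I 6
twist-I₃ = ≗-trans
  (inverse-unique
        (≗-trans (·-congʳ (≗-sym twist-E₃)) (Twist.F-inverse (E·I 3)))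
            (·-inverse (o₃ · E 6) (·-zero o₃ (E 6))))
  (⁻¹-· o₃ (E 6) refl refl)

dilate-E : ∀ j .{{_ : NonZero j}} → dilate (E j) ≗ E (j ℕ.+ j)
dilate-E j = dilate-poch -1ℤ j j

dilate-I : ∀ j .{{_ : NonZero j}} → dilate (I j) ≗ I (j ℕ.+ j)
dilate-I j = inverse-unique
      (≗-trans (·-congʳ (≗-sym (dilate-E j))) (Dilate.F-inverse (E·I j))) (E·I (j ℕ.+ j))

triple : ∀ x → x ℤ.* x ≡ 1ℤ → ∀ a b .{{_ : NonZero a}} .{{_ : NonZero b}} →
         poch x a (a ℕ.+ b) · poch x b (a ℕ.+ b) · E (a ℕ.+ b) ≗ theta x a b
triple x x²≡1 a b = TripleProduct.tripleProduct x x²≡1 a b (ℕ.>-nonZero⁻¹ a) (ℕ.>-nonZero⁻¹ b)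

E₁-split : E 1 ≗ poch -1ℤ 1 2 · E 2
E₁-split = ≗-trans (poch-split -1ℤ 1 1 2)
  (solve-series 2 (λ p q → q ⊗ (p ⊗ numeral 1) ⊜ p ⊗ q) (λ _ → refl) (poch -1ℤ 1 2) (E 2))

E₁² : E 1 · E 1 ≗ E 2 · theta -1ℤ 1 1
E₁² = begin
  E 1 · E 1                                            ≈⟨ ·-cong E₁-split E₁-split ⟩
  (poch -1ℤ 1 2 · E 2) · (poch -1ℤ 1 2 · E 2)          ≈⟨ solve-series 2 (λ p e → (p ⊗ e) ⊗ (p ⊗ e)
        ⊜ e ⊗ (p ⊗ p ⊗ e)) (λ _ → refl) (poch -1ℤ 1 2) (E 2) ⟩
  E 2 · (poch -1ℤ 1 2 · poch -1ℤ 1 2 · E 2)            ≈⟨ ·-congˡ (triple -1ℤ refl 1 1) ⟩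
  E 2 · theta -1ℤ 1 1                                  ∎
  where open ≗-Reasoning

E₁·E₄ : E 1 · E 4 ≗ E 2 · theta -1ℤ 1 3
E₁·E₄ = begin
  E 1 · E 4                                            ≈⟨ ·-congʳ
        (≗-trans E₁-split (·-congʳ (poch-split -1ℤ 1 2 2))) ⟩
  (poch -1ℤ 3 4 · (poch -1ℤ 1 4 · 𝟙) · E 2) · E 4
      ≈⟨ solve-series 4 (λ p q e z → (q ⊗ (p ⊗ numeral 1) ⊗ e) ⊗ z
        ⊜ e ⊗ (p ⊗ q ⊗ z)) (λ _ → refl) (poch -1ℤ 1 4) (poch -1ℤ 3 4) (E 2) (E 4) ⟩
  E 2 · (poch -1ℤ 1 4 · poch -1ℤ 3 4 · E 4)            ≈⟨ ·-congˡ (triple -1ℤ refl 1 3) ⟩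
  E 2 · theta -1ℤ 1 3                                  ∎
  where open ≗-Reasoning

E₁·E₆² : E 1 · (E 6 · E 6) ≗ E 2 · E 3 · theta -1ℤ 1 5
E₁·E₆² = begin
  E 1 · (E 6 · E 6)
    ≈⟨ ·-congʳ (≗-trans E₁-split (·-congʳ (poch-split -1ℤ 1 2 3))) ⟩
  (poch -1ℤ 5 6 · (poch -1ℤ 3 6 · (poch -1ℤ 1 6 · 𝟙)) · E 2) · (E 6 · E 6)
    ≈⟨ solve-series 5 (λ p q r e z → (r ⊗ (q ⊗ (p ⊗ numeral 1)) ⊗ e) ⊗ (z ⊗ z)
          ⊜ e ⊗ (z ⊗ (q ⊗ numeral 1)) ⊗ (p ⊗ r ⊗ z)) (λ _ → refl)
         (poch -1ℤ 1 6) (poch -1ℤ 3 6) (poch -1ℤ 5 6) (E 2) (E 6) ⟩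
  E 2 · (E 6 · (poch -1ℤ 3 6 · 𝟙)) · (poch -1ℤ 1 6 · poch -1ℤ 5 6 · E 6)
    ≈⟨ ·-cong (·-congˡ (≗-sym (poch-split -1ℤ 3 3 2))) (triple -1ℤ refl 1 5) ⟩
  E 2 · E 3 · theta -1ℤ 1 5 ∎
  where open ≗-Reasoning

φ≗theta : φ ≗ theta 1ℤ 1 1
φ≗theta = triple 1ℤ refl 1 1

o-split : o ≗ poch 1ℤ 7 8 · (poch 1ℤ 5 8 · (poch 1ℤ 3 8 · (poch 1ℤ 1 8 · 𝟙)))
o-split = poch-split 1ℤ 1 2 4

E₂-split : E 2 ≗ poch -1ℤ 16 16 · (poch -1ℤ 14 16 · (poch -1ℤ 12 16 · (poch -1ℤ 10 16 ·
                (poch -1ℤ 8 16 · (poch -1ℤ 6 16 · (poch -1ℤ 4 16 · (poch -1ℤ 2 16 · 𝟙)))))))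
E₂-split = poch-split -1ℤ 2 2 8

N₁₆ : ℕ → Series
N₁₆ a = poch -1ℤ a 16

J : ℕ → Series
J a = N₁₆ a ⁻¹

J-inverse : ∀ a → N₁₆ a · J a ≗ 𝟙
J-inverse a = ·-inverse (N₁₆ a) refl

-- What remains of `theta -1ℤ 3 5 · o` and `theta -1ℤ 7 1 · o` once `E 2` is taken out. Only factors
-- 1 + q^a and 1/(1 - q^a) occur, although neither theta series is nonnegative.
R R′ : Series
R  = J 2 · (J 4 · (J 12 · (J 14 · (poch 1ℤ 1 8 · poch 1ℤ 7 8))))
R′ = J 4 · (J 6 · (J 10 · (J 12 · (poch 1ℤ 3 8 · poch 1ℤ 5 8))))

insert : ∀ g h k → g · h ≗ 𝟙 → k ≗ k · (g · h)
insert g h k p = ≗-sym (≗-trans (·-congˡ p) (S.*-identityʳ k))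

-- The classes 3 and 5 mod 8 of the theta product and of `o` pair up to the classes 6 and 10 mod 16,
-- and `E 8` splits into 8 and 16. `E 2` consists of the eight even classes mod 16; the missing 2,
-- 4, 12, 14 appear inverted in `R`, beside the classes 1 and 7 left over from `o`. For `theta₇₁·o`
-- the two pairs exchange roles.
theta₃₅·o : theta -1ℤ 3 5 · o ≗ E 2 · R
theta₃₅·o = begin
  theta -1ℤ 3 5 · o
    ≈⟨ ·-cong (≗-sym (triple -1ℤ refl 3 5)) o-split ⟩
  poch -1ℤ 3 8 · poch -1ℤ 5 8 · E 8 · (poch 1ℤ 7 8 · (poch 1ℤ 5 8 · (poch 1ℤ 3 8 · (poch 1ℤ 1 8 · 𝟙))))
    ≈⟨ solve-series 7 (λ na nb e p₇ p₅ p₃ p₁ → na ⊗ nb ⊗ e ⊗ (p₇ ⊗ (p₅ ⊗ (p₃ ⊗ (p₁ ⊗ numeral 1))))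
          ⊜ (p₃ ⊗ na) ⊗ (p₅ ⊗ nb) ⊗ e ⊗ (p₁ ⊗ p₇)) (λ _ → refl)
          (poch -1ℤ 3 8) (poch -1ℤ 5 8) (E 8) (poch 1ℤ 7 8) (poch 1ℤ 5 8) (poch 1ℤ 3 8) (poch 1ℤ 1 8) ⟩
  (poch 1ℤ 3 8 · poch -1ℤ 3 8) · (poch 1ℤ 5 8 · poch -1ℤ 5 8) · E 8 · (poch 1ℤ 1 8 · poch 1ℤ 7 8)
    ≈⟨ ·-congʳ {h = poch 1ℤ 1 8 · poch 1ℤ 7 8} (·-cong
          (·-cong (poch-conjugate 3 8) (poch-conjugate 5 8)) (poch-split -1ℤ 8 8 2)) ⟩
  N₁₆ 6 · N₁₆ 10 · (N₁₆ 16 · (N₁₆ 8 · 𝟙)) · (poch 1ℤ 1 8 · poch 1ℤ 7 8)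
    ≈⟨ ≗-trans (insert (N₁₆ 2) (J 2) _ (J-inverse 2)) (≗-trans (insert (N₁₆ 4) (J 4) _ (J-inverse 4))
         (≗-trans (insert (N₁₆ 12) (J 12) _ (J-inverse 12)) (insert (N₁₆ 14) (J 14) _ (J-inverse 14)))) ⟩
  N₁₆ 6 · N₁₆ 10 · (N₁₆ 16 · (N₁₆ 8 · 𝟙)) · (poch 1ℤ 1 8 · poch 1ℤ 7 8) · (N₁₆ 2 · J 2) · (N₁₆ 4 · J 4) ·
      (N₁₆ 12 · J 12) · (N₁₆ 14 · J 14)
    ≈⟨ solve-series 13 (λ n₂ n₄ n₆ n₈ n₁₀ n₁₂ n₁₄ n₁₆ ja jb jc jd p →
         n₆ ⊗ n₁₀ ⊗ (n₁₆ ⊗ (n₈ ⊗ numeral 1)) ⊗ p ⊗ (n₂ ⊗ ja) ⊗ (n₄ ⊗ jb) ⊗ (n₁₂ ⊗ jc) ⊗ (n₁₄ ⊗ jd)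
         ⊜ (n₁₆ ⊗ (n₁₄ ⊗ (n₁₂ ⊗ (n₁₀ ⊗ (n₈ ⊗ (n₆ ⊗ (n₄ ⊗ (n₂ ⊗ numeral 1)))))))) ⊗
             (ja ⊗ (jb ⊗ (jc ⊗ (jd ⊗ p))))) (λ _ → refl)
         (N₁₆ 2) (N₁₆ 4) (N₁₆ 6) (N₁₆ 8) (N₁₆ 10) (N₁₆ 12) (N₁₆ 14) (N₁₆ 16) (J 2) (J 4) (J 12) (J 14)
             (poch 1ℤ 1 8 · poch 1ℤ 7 8) ⟩
  (N₁₆ 16 · (N₁₆ 14 · (N₁₆ 12 · (N₁₆ 10 · (N₁₆ 8 · (N₁₆ 6 · (N₁₆ 4 · (N₁₆ 2 · 𝟙)))))))) · R
    ≈⟨ ·-congʳ E₂-split ⟨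
  E 2 · R ∎
  where open ≗-Reasoning

theta₇₁·o : theta -1ℤ 7 1 · o ≗ E 2 · R′
theta₇₁·o = begin
  theta -1ℤ 7 1 · o
    ≈⟨ ·-cong (≗-sym (triple -1ℤ refl 7 1)) o-split ⟩
  poch -1ℤ 7 8 · poch -1ℤ 1 8 · E 8 · (poch 1ℤ 7 8 · (poch 1ℤ 5 8 · (poch 1ℤ 3 8 · (poch 1ℤ 1 8 · 𝟙))))
    ≈⟨ solve-series 7 (λ na nb e p₇ p₅ p₃ p₁ → na ⊗ nb ⊗ e ⊗ (p₇ ⊗ (p₅ ⊗ (p₃ ⊗ (p₁ ⊗ numeral 1))))
          ⊜ (p₇ ⊗ na) ⊗ (p₁ ⊗ nb) ⊗ e ⊗ (p₃ ⊗ p₅)) (λ _ → refl)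
          (poch -1ℤ 7 8) (poch -1ℤ 1 8) (E 8) (poch 1ℤ 7 8) (poch 1ℤ 5 8) (poch 1ℤ 3 8) (poch 1ℤ 1 8) ⟩
  (poch 1ℤ 7 8 · poch -1ℤ 7 8) · (poch 1ℤ 1 8 · poch -1ℤ 1 8) · E 8 · (poch 1ℤ 3 8 · poch 1ℤ 5 8)
    ≈⟨ ·-congʳ {h = poch 1ℤ 3 8 · poch 1ℤ 5 8} (·-cong
          (·-cong (poch-conjugate 7 8) (poch-conjugate 1 8)) (poch-split -1ℤ 8 8 2)) ⟩
  N₁₆ 14 · N₁₆ 2 · (N₁₆ 16 · (N₁₆ 8 · 𝟙)) · (poch 1ℤ 3 8 · poch 1ℤ 5 8)
    ≈⟨ ≗-trans (insert (N₁₆ 4) (J 4) _ (J-inverse 4)) (≗-trans (insert (N₁₆ 6) (J 6) _ (J-inverse 6))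
         (≗-trans (insert (N₁₆ 10) (J 10) _ (J-inverse 10)) (insert (N₁₆ 12) (J 12) _ (J-inverse 12)))) ⟩
  N₁₆ 14 · N₁₆ 2 · (N₁₆ 16 · (N₁₆ 8 · 𝟙)) · (poch 1ℤ 3 8 · poch 1ℤ 5 8) · (N₁₆ 4 · J 4) · (N₁₆ 6 · J 6) ·
      (N₁₆ 10 · J 10) · (N₁₆ 12 · J 12)
    ≈⟨ solve-series 13 (λ n₂ n₄ n₆ n₈ n₁₀ n₁₂ n₁₄ n₁₆ ja jb jc jd p →
         n₁₄ ⊗ n₂ ⊗ (n₁₆ ⊗ (n₈ ⊗ numeral 1)) ⊗ p ⊗ (n₄ ⊗ ja) ⊗ (n₆ ⊗ jb) ⊗ (n₁₀ ⊗ jc) ⊗ (n₁₂ ⊗ jd)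
         ⊜ (n₁₆ ⊗ (n₁₄ ⊗ (n₁₂ ⊗ (n₁₀ ⊗ (n₈ ⊗ (n₆ ⊗ (n₄ ⊗ (n₂ ⊗ numeral 1)))))))) ⊗
             (ja ⊗ (jb ⊗ (jc ⊗ (jd ⊗ p))))) (λ _ → refl)
         (N₁₆ 2) (N₁₆ 4) (N₁₆ 6) (N₁₆ 8) (N₁₆ 10) (N₁₆ 12) (N₁₆ 14) (N₁₆ 16) (J 4) (J 6) (J 10) (J 12)
             (poch 1ℤ 3 8 · poch 1ℤ 5 8) ⟩
  (N₁₆ 16 · (N₁₆ 14 · (N₁₆ 12 · (N₁₆ 10 · (N₁₆ 8 · (N₁₆ 6 · (N₁₆ 4 · (N₁₆ 2 · 𝟙)))))))) · R′
    ≈⟨ ·-congʳ E₂-split ⟨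
  E 2 · R′ ∎
  where open ≗-Reasoning

-- Multiplied by `o₃` and combined with `o₃·N₃₆`, this expresses w / o₃, whose denominator would
-- bring in signs, as `theta 1ℤ 1 2 · E 2` over a product of factors 1 - q^a.
theta₁₂·E₂ : theta 1ℤ 1 2 · E 2 ≗ w · poch -1ℤ 3 6 · (poch -1ℤ 4 12 · poch -1ℤ 8 12) · (E 6 · E 6)
theta₁₂·E₂ = begin
  theta 1ℤ 1 2 · E 2
    ≈⟨ ·-cong (≗-trans (≗-sym (triple 1ℤ refl 1 2))
         (·-cong (·-cong (poch-split 1ℤ 1 3 2) (poch-split 1ℤ 2 3 2)) (poch-split -1ℤ 3 3 2)))
             (poch-split -1ℤ 2 2 3) ⟩
  (poch 1ℤ 4 6 · (poch 1ℤ 1 6 · 𝟙)) · (poch 1ℤ 5 6 · (poch 1ℤ 2 6 · 𝟙)) · (E 6 · (poch -1ℤ 3 6 · 𝟙))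
    · (E 6 · (poch -1ℤ 4 6 · (poch -1ℤ 2 6 · 𝟙)))
    ≈⟨ solve-series 8 (λ p₁ p₂ p₄ p₅ n₂ n₃ n₄ e →
         (p₄ ⊗ (p₁ ⊗ numeral 1)) ⊗ (p₅ ⊗ (p₂ ⊗ numeral 1)) ⊗ (e ⊗ (n₃ ⊗ numeral 1)) ⊗
             (e ⊗ (n₄ ⊗ (n₂ ⊗ numeral 1)))
         ⊜ (p₁ ⊗ p₅) ⊗ n₃ ⊗ ((p₂ ⊗ n₂) ⊗ (p₄ ⊗ n₄)) ⊗ (e ⊗ e)) (λ _ → refl)
         (poch 1ℤ 1 6) (poch 1ℤ 2 6) (poch 1ℤ 4 6) (poch 1ℤ 5 6) (poch -1ℤ 2 6) (poch -1ℤ 3 6) (poch -1ℤ 4 6)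
             (E 6) ⟩
  w · poch -1ℤ 3 6 · ((poch 1ℤ 2 6 · poch -1ℤ 2 6) · (poch 1ℤ 4 6 · poch -1ℤ 4 6)) · (E 6 · E 6)
    ≈⟨ ·-congʳ (·-congˡ (·-cong (poch-conjugate 2 6) (poch-conjugate 4 6))) ⟩
  w · poch -1ℤ 3 6 · (poch -1ℤ 4 12 · poch -1ℤ 8 12) · (E 6 · E 6) ∎
  where open ≗-Reasoning

o₃·N₃₆ : o₃ · poch -1ℤ 3 6 ≗ poch -1ℤ 6 12
o₃·N₃₆ = poch-conjugate 3 6

-- The fourteen products

integerPower : Series → ℤ → Series
integerPower g (+ n)       = g ^ˢ n
integerPower g ℤ.-[1+ n ]  = (g ⁻¹) ^ˢ suc n

f^≗integerPower : ∀ j t → f j ^ t ≗ integerPower (E j) t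
f^≗integerPower j (+ n)      = go n
  where
  go : ∀ n → f j ^ + n ≗ E j ^ˢ n
  go zero    = ≗-refl
  go (suc n) = ≗-trans (≗-sym (·≗⊛ (f j) (f j ^ + n))) (·-cong (f≗poch j) (go n))
f^≗integerPower j ℤ.-[1+ n ] = go n
  where
  f⁻¹≗I : f j ⁻¹ ≗ I j
  f⁻¹≗I = ⁻¹-cong refl (f≗poch j)
  go : ∀ n → f j ^ ℤ.-[1+ n ] ≗ I j ^ˢ suc n
  go zero    = ≗-trans (≗-sym (·≗⊛ (f j ⁻¹) 𝟙)) (·-cong f⁻¹≗I ≗-refl)
  go (suc n) = ≗-trans (≗-sym (·≗⊛ (f j ⁻¹) (f j ^ ℤ.-[1+ n ]))) (·-cong f⁻¹≗I (go n))

a≗ : ∀ t₁ t₂ t₃ t₄ → a (t₁ ∷ t₂ ∷ t₃ ∷ t₄ ∷ []) ≗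
     integerPower (E 1) t₁ · (integerPower (E 2) t₂ · (integerPower (E 3) t₃ · (integerPower (E 4) t₄ · 𝟙)))
a≗ t₁ t₂ t₃ t₄ = step (f^≗integerPower 1 t₁) (step (f^≗integerPower 2 t₂)
  (step (f^≗integerPower 3 t₃) (step (f^≗integerPower 4 t₄) ≗-refl)))
  where
  step : ∀ {g g′ h h′} → g ≗ g′ → h ≗ h′ → g ⊛ h ≗ g′ · h′
  step p r = ≗-trans (≗-sym (·≗⊛ _ _)) (·-cong p r)

Signs : Series → Set
Signs g = ∀ n → g (4 ℕ.* n) > 0ℤ × g (4 ℕ.* n ℕ.+ 1) < 0ℤ × g (4 ℕ.* n ℕ.+ 2) < 0ℤ × g (4 ℕ.* n ℕ.+ 3) > 0ℤ

-- `K · θε` has the coefficients g(2m) and `K · θω` the coefficients -g(2m+1). Positivity after q ↦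
-- -q gives both the sign (-1)^m, and m = 2n, 2n + 1 yield the four classes mod 4.
signs-of-dissection : ∀ {g} K r {L ε ω} → g ≗ dilate K · theta -1ℤ 1 (suc (r ℕ.+ r)) → twist K ≗ L →
  twist (theta 1ℤ (2 ℕ.+ r) (2 ℕ.+ 3 ℕ.* r)) ≗ ε → twist (theta 1ℤ (4 ℕ.+ 3 ℕ.* r) r) ≗ ω →
  Positive (L · ε) → Positive (L · ω) → Signs g
signs-of-dissection {g} K r {L} {ε} {ω} g≗ K≗ ε≗ ω≗ 0<ε 0<ω n =
  subst (0ℤ <_)
    (trans (untwist-even (K · θε))
      (sym (even-at (n ℕ.+ n) (solve 1 (λ n → n :+ n :+ (n :+ n) := con 4 :* n) refl n))))
    (0<ε′ (n ℕ.+ n)) ,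
  subst (_< 0ℤ)
    (trans (cong -_ (untwist-even (K · θω)))
      (sym (odd-at (n ℕ.+ n) (solve 1 (λ n → con 1 :+ (n :+ n :+ (n :+ n)) := con 4 :* n :+ con 1) refl n))))
    (ℤ.neg-mono-< (0<ω′ (n ℕ.+ n))) ,
  subst (_< 0ℤ)
    (trans (cong -_ (untwist-odd (K · θε))) (trans (ℤ.neg-involutive _)
      (sym (even-at (suc (n ℕ.+ n)) (solve 1 (λ n → con 1 :+ (n :+ n) :+ (con 1 :+ (n :+ n))
            := con 4 :* n :+ con 2) refl n)))))
    (ℤ.neg-mono-< (0<ε′ (suc (n ℕ.+ n)))) ,
  subst (0ℤ <_)
    (trans (untwist-odd (K · θω))
      (sym (odd-at (suc (n ℕ.+ n)) (solve 1 (λ n → con 1 :+ (con 1 :+ (n :+ n) :+ (con 1 :+ (n :+ n)))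
            := con 4 :* n :+ con 3) refl n))))
    (0<ω′ (suc (n ℕ.+ n)))
  where
  open ℕ.+-*-Solver
  θ θε θω : Series
  θ  = theta -1ℤ 1 (suc (r ℕ.+ r))
  θε = theta 1ℤ (2 ℕ.+ r) (2 ℕ.+ 3 ℕ.* r)
  θω = theta 1ℤ (4 ℕ.+ 3 ℕ.* r) r

  even-g : even g ≗ K · θε
  even-g = ≗-trans (even-cong g≗) (≗-trans (even-dilate-· K _) (·-congˡ (Dissection.even-theta r)))

  odd-g : ∀ m → odd g m ≡ - (K · θω) m
  odd-g m = begin
    odd g m                               ≡⟨ even-cong (g≗ ∘ suc) m ⟩
    odd (dilate K · θ) m                  ≡⟨ odd-dilate-· K θ m ⟩
    (K · odd θ) m                         ≡⟨ ·-congˡ (Dissection.odd-theta r) m ⟩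
    (K · (-1ℤ • θω)) m                    ≡⟨ ·-comm K (-1ℤ • θω) m ⟩
    ((-1ℤ • θω) · K) m                    ≡⟨ •-· -1ℤ θω K m ⟩
    -1ℤ ℤ.* (θω · K) m                    ≡⟨ ℤ.-1*i≡-i _ ⟩
    - (θω · K) m                          ≡⟨ cong -_ (·-comm θω K m) ⟩
    - (K · θω) m                          ∎
    where open ≡-Reasoning

  even-at : ∀ m {i} → m ℕ.+ m ≡ i → g i ≡ (K · θε) m
  even-at m refl = trans (sym (even-double g m)) (even-g m)

  odd-at : ∀ m {i} → suc (m ℕ.+ m) ≡ i → g i ≡ - (K · θω) m
  odd-at m refl = trans (sym (even-double (tail g) m)) (odd-g m)

  0<ε′ : Positive (twist (K · θε))
  0<ε′ = positive-resp (≗-sym (≗-trans (twist-· K θε) (·-cong K≗ ε≗))) 0<ε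

  0<ω′ : Positive (twist (K · θω))
  0<ω′ = positive-resp (≗-sym (≗-trans (twist-· K θω) (·-cong K≗ ω≗))) 0<ω

  untwist-even : ∀ h → twist h (n ℕ.+ n) ≡ h (n ℕ.+ n)
  untwist-even h = trans (cong (ℤ._* h (n ℕ.+ n)) (sgn-double n)) (ℤ.*-identityˡ _)

  untwist-odd : ∀ h → twist h (suc (n ℕ.+ n)) ≡ - h (suc (n ℕ.+ n))
  untwist-odd h = trans (cong (λ s → - s ℤ.* h (suc (n ℕ.+ n))) (sgn-double n)) (ℤ.-1*i≡-i _)

insert-EI : ∀ g j → g ≗ g · (E j · I j)
insert-EI g j = insert (E j) (I j) g (E·I j)

-- `m` and `s` stand for t₂ and -t₄. At the numerals used below it unfolds to the right-hand side of
-- `a≗`, so that the cases fit `signs-of-a` definitionally.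
product : ℤ → ℕ → ℤ → ℕ → Series
product t₁ m t₃ s = integerPower (E 1) t₁ · (E 2 ^ˢ m · (integerPower (E 3) t₃ · (I 4 ^ˢ s · 𝟙)))

dissect⟨2,m,0,-s⟩ : ∀ m s → product (+ 2) m 0ℤ s ≗ dilate (E 1 ^ˢ suc m · I 2 ^ˢ s) · theta -1ℤ 1 1
dissect⟨2,m,0,-s⟩ m s = begin
  E 1 · (E 1 · 𝟙) · (X · (𝟙 · (Y · 𝟙)))
    ≈⟨ solve-series 3 (λ e x y → e ⊗ (e ⊗ numeral 1) ⊗ (x ⊗ (numeral 1 ⊗ (y ⊗ numeral 1)))
          ⊜ (e ⊗ e) ⊗ (x ⊗ y)) (λ _ → refl) (E 1) X Y ⟩
  (E 1 · E 1) · (X · Y)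
    ≈⟨ ·-congʳ E₁² ⟩
  (E 2 · theta -1ℤ 1 1) · (X · Y)
    ≈⟨ solve-series 4 (λ e t x y → (e ⊗ t) ⊗ (x ⊗ y)
          ⊜ ((e ⊗ x) ⊗ y) ⊗ t) (λ _ → refl) (E 2) (theta -1ℤ 1 1) X Y ⟩
  (E 2 ^ˢ suc m · Y) · theta -1ℤ 1 1
    ≈⟨ ·-congʳ (≗-trans (dilate-· (E 1 ^ˢ suc m) (I 2 ^ˢ s))
          (·-cong (Dilate.F-^ (dilate-E 1) (suc m)) (Dilate.F-^ (dilate-I 2) s))) ⟨
  dilate (E 1 ^ˢ suc m · I 2 ^ˢ s) · theta -1ℤ 1 1 ∎
  where
  open ≗-Reasoning
  X = E 2 ^ˢ m
  Y = I 4 ^ˢ s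

dissect⟨1,m,0,-s⟩ : ∀ m s → product (+ 1) m 0ℤ s ≗ dilate (E 1 ^ˢ suc m · I 2 ^ˢ suc s) · theta -1ℤ 1 3
dissect⟨1,m,0,-s⟩ m s = begin
  E 1 · 𝟙 · (X · (𝟙 · (Y · 𝟙)))
    ≈⟨ ·-congʳ (·-congʳ (insert-EI (E 1) 4)) ⟩
  E 1 · (E 4 · I 4) · 𝟙 · (X · (𝟙 · (Y · 𝟙)))
    ≈⟨ solve-series 5 (λ e f i x y → e ⊗ (f ⊗ i) ⊗ numeral 1 ⊗ (x ⊗ (numeral 1 ⊗ (y ⊗ numeral 1)))
          ⊜ (e ⊗ f) ⊗ (x ⊗ (i ⊗ y))) (λ _ → refl) (E 1) (E 4) (I 4) X Y ⟩
  (E 1 · E 4) · (X · (I 4 · Y))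
    ≈⟨ ·-congʳ E₁·E₄ ⟩
  (E 2 · theta -1ℤ 1 3) · (X · (I 4 · Y))
    ≈⟨ solve-series 4 (λ e t x y → (e ⊗ t) ⊗ (x ⊗ y)
          ⊜ ((e ⊗ x) ⊗ y) ⊗ t) (λ _ → refl) (E 2) (theta -1ℤ 1 3) X (I 4 · Y) ⟩
  (E 2 ^ˢ suc m · (I 4 · Y)) · theta -1ℤ 1 3
    ≈⟨ ·-congʳ (≗-trans (dilate-· (E 1 ^ˢ suc m) (I 2 ^ˢ suc s))
          (·-cong (Dilate.F-^ (dilate-E 1) (suc m)) (Dilate.F-^ (dilate-I 2) (suc s)))) ⟨
  dilate (E 1 ^ˢ suc m · I 2 ^ˢ suc s) · theta -1ℤ 1 3 ∎
  where
  open ≗-Reasoning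
  X = E 2 ^ˢ m
  Y = I 4 ^ˢ s

dissect⟨1,m,-1,-s⟩ : ∀ m s → product (+ 1) m -1ℤ s ≗ dilate
    (E 1 ^ˢ suc m · I 2 ^ˢ s · (I 3 · I 3)) · theta -1ℤ 1 5
dissect⟨1,m,-1,-s⟩ m s = begin
  E 1 · 𝟙 · (X · (I 3 · 𝟙 · (Y · 𝟙)))
    ≈⟨ ·-congʳ (·-congʳ (≗-trans (insert-EI (E 1) 6) (insert-EI (E 1 · (E 6 · I 6)) 6))) ⟩
  E 1 · (E 6 · I 6) · (E 6 · I 6) · 𝟙 · (X · (I 3 · 𝟙 · (Y · 𝟙)))
    ≈⟨ solve-series 6 (λ e f i k x y → e ⊗ (f ⊗ i) ⊗ (f ⊗ i) ⊗ numeral 1 ⊗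
        (x ⊗ (k ⊗ numeral 1 ⊗ (y ⊗ numeral 1)))
          ⊜ (e ⊗ (f ⊗ f)) ⊗ (x ⊗ y ⊗ k ⊗ (i ⊗ i))) (λ _ → refl) (E 1) (E 6) (I 6) (I 3) X Y ⟩
  (E 1 · (E 6 · E 6)) · (X · Y · I 3 · (I 6 · I 6))
    ≈⟨ ·-congʳ E₁·E₆² ⟩
  (E 2 · E 3 · theta -1ℤ 1 5) · (X · Y · I 3 · (I 6 · I 6))
    ≈⟨ solve-series 7 (λ e h t x y k i → (e ⊗ h ⊗ t) ⊗ (x ⊗ y ⊗ k ⊗ (i ⊗ i))
          ⊜ ((e ⊗ x) ⊗ y ⊗ (i ⊗ i)) ⊗ t ⊗ (h ⊗ k)) (λ _ → refl) (E 2) (E 3) (theta -1ℤ 1 5) X Y (I 3) (I 6) ⟩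
  (E 2 ^ˢ suc m · Y · (I 6 · I 6)) · theta -1ℤ 1 5 · (E 3 · I 3)
    ≈⟨ insert-EI _ 3 ⟨
  (E 2 ^ˢ suc m · Y · (I 6 · I 6)) · theta -1ℤ 1 5
    ≈⟨ ·-congʳ (≗-trans (dilate-· (E 1 ^ˢ suc m · I 2 ^ˢ s) (I 3 · I 3)) (·-cong
         (≗-trans (dilate-· (E 1 ^ˢ suc m) (I 2 ^ˢ s))
               (·-cong (Dilate.F-^ (dilate-E 1) (suc m)) (Dilate.F-^ (dilate-I 2) s)))
         (≗-trans (dilate-· (I 3) (I 3)) (·-cong (dilate-I 3) (dilate-I 3))))) ⟨
  dilate (E 1 ^ˢ suc m · I 2 ^ˢ s · (I 3 · I 3)) · theta -1ℤ 1 5 ∎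
  where
  open ≗-Reasoning
  X = E 2 ^ˢ m
  Y = I 4 ^ˢ s

twist-K : ∀ m s → twist (E 1 ^ˢ m · I 2 ^ˢ s) ≗ (o · E 2) ^ˢ m · I 2 ^ˢ s
twist-K m s = ≗-trans (twist-· (E 1 ^ˢ m) (I 2 ^ˢ s)) (·-cong (Twist.F-^ twist-E₁ m) (Twist.F-^ twist-I₂ s))

signs⟨2,m,0,-s⟩ : ∀ m s → Positive ((o · E 2) ^ˢ suc m · I 2 ^ˢ s) → Signs (product (+ 2) m 0ℤ s)
signs⟨2,m,0,-s⟩ m s p = signs-of-dissection _ 0 (dissect⟨2,m,0,-s⟩ m s) (twist-K (suc m) s)
    (twist-theta 1ℤ 2 2 refl refl) (twist-theta 1ℤ 4 0 refl refl)
  (positive-· p (nonNegative-theta 2 2) (theta-zero-positive 2 2))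
      (positive-· p (nonNegative-theta 4 0) (theta-zero-positive 4 0))

-- For r = 1 the parameters (3, 5) and (7, 1) are odd, so both theta series become signed and cannot
-- be dropped as nonnegative factors. For r = 0 and r = 2 all parameters are even, which is why the
-- other two lemmas mention no theta series.
signs⟨1,m,0,-s⟩ : ∀ m s → Positive ((o · E 2) ^ˢ suc m · I 2 ^ˢ suc s · theta -1ℤ 3 5) →
         Positive ((o · E 2) ^ˢ suc m · I 2 ^ˢ suc s · theta -1ℤ 7 1) → Signs (product (+ 1) m 0ℤ s)
signs⟨1,m,0,-s⟩ m s = signs-of-dissection _ 1 (dissect⟨1,m,0,-s⟩ m s) (twist-K (suc m) (suc s))
  (twist-theta 1ℤ 3 5 refl refl) (twist-theta 1ℤ 7 1 refl refl)

signs⟨1,m,-1,-s⟩ : ∀ m s → Positive ((o · E 2) ^ˢ suc m · I 2 ^ˢ s · ((o₃ ⁻¹ · I 6) · (o₃ ⁻¹ · I 6)))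
      → Signs (product (+ 1) m -1ℤ s)
signs⟨1,m,-1,-s⟩ m s p = signs-of-dissection _ 2 (dissect⟨1,m,-1,-s⟩ m s)
  (≗-trans (twist-· (E 1 ^ˢ suc m · I 2 ^ˢ s) (I 3 · I 3)) (·-cong (twist-K (suc m) s)
        (≗-trans (twist-· (I 3) (I 3)) (·-cong twist-I₃ twist-I₃))))
  (twist-theta 1ℤ 4 8 refl refl) (twist-theta 1ℤ 10 2 refl refl)
  (positive-· p (nonNegative-theta 4 8) (theta-zero-positive 4 8))
      (positive-· p (nonNegative-theta 10 2) (theta-zero-positive 10 2))

cancel-EI^ : ∀ k j g → g · (E j · I j) ^ˢ k ≗ g
cancel-EI^ zero    j g = S.*-identityʳ g
cancel-EI^ (suc k) j g = ≗-trans (≗-sym (·-assoc g (E j · I j) _))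
      (≗-trans (cancel-EI^ k j _) (≗-sym (insert-EI g j)))

-- Positivity of the building blocks

q v : Series
q = o₃ ⁻¹
v = o · q

-- Here `q` is the series 1/(-q³; q⁶)_∞, not the variable. It has coefficients of both signs, but
-- together with one `o` it leaves only factors 1 + q^a.
v≗w : v ≗ w
v≗w = ≗-trans (·-congʳ o≗w·o₃) (≗-trans (·-assoc w o₃ q)
      (≗-trans (·-congˡ (·-inverse o₃ refl)) (S.*-identityʳ w)))

0≤o : NonNegative o
0≤o = nonNegative-poch 1 2

0<o-odd : ∀ k → 0ℤ < o (suc (k ℕ.* 2))
0<o-odd k = poch-positive 1 2 k

0≤w : NonNegative w
0≤w = nonNegative-· (nonNegative-poch 1 6) (nonNegative-poch 5 6)

0≤v : NonNegative v
0≤v = nonNegative-resp (≗-sym v≗w) 0≤w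

0<v₀ : 0ℤ < v 0
0<v₀ = subst (0ℤ <_) (sym (v≗w 0)) (0<-· 0 0 (nonNegative-poch 1 6) (nonNegative-poch 5 6) 0<1 0<1)

0<v₁ : 0ℤ < v 1
0<v₁ = subst (0ℤ <_) (sym (v≗w 1))
    (0<-· 1 0 (nonNegative-poch 1 6) (nonNegative-poch 5 6) (poch-positive 1 6 0) 0<1)

0≤φ : NonNegative φ
0≤φ = nonNegative-resp (≗-sym φ≗theta) (nonNegative-theta 1 1)

0<φ₀ : 0ℤ < φ 0
0<φ₀ = subst (0ℤ <_) (sym (φ≗theta 0)) 0<1

0<φ₁ : 0ℤ < φ 1
0<φ₁ = subst (0ℤ <_) (sym (φ≗theta 1)) (ℤ.+<+ (s≤s z≤n))

-- `φ` is ∑ q^{n²}; the squares 0, 1 and 4 are the degrees from which the gaps below are filled.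
0<φ₄ : 0ℤ < φ 4
0<φ₄ = subst (0ℤ <_) (sym (φ≗theta 4)) (ℤ.+<+ (s≤s z≤n))

-- The factors that preserve positivity of a series when multiplied to it, by `positive-·ᵤ`.
Unital : Series → Set
Unital g = NonNegative g × 0ℤ < g 0

unital-· : ∀ {g h} → Unital g → Unital h → Unital (g · h)
unital-· (p , p₀) (r , r₀) = nonNegative-· p r , 0<-· 0 0 p r p₀ r₀

unital-o : Unital o
unital-o = 0≤o , 0<1

unital-v : Unital v
unital-v = 0≤v , 0<v₀

unital-φ : Unital φ
unital-φ = 0≤φ , 0<φ₀

unital-poch : ∀ a c → Unital (poch 1ℤ a c)
unital-poch a c = nonNegative-poch a c , 0<1

unital-poch⁻¹ : ∀ a c .{{_ : NonZero a}} .{{_ : NonZero c}} → Unital (poch -1ℤ a c ⁻¹)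
unital-poch⁻¹ a c = nonNegative-poch⁻¹ a c , 0<1

positive-·ᵤ : ∀ {g h} → Positive g → Unital h → Positive (g · h)
positive-·ᵤ p (r , r₀) = positive-· p r r₀

positive-o· : ∀ {h} → Unital h → 0ℤ < h 1 → Positive (o · h)
positive-o· (p , p₀) p₁ = positive-·-odd 0≤o 0<1 0<o-odd p p₀ p₁

positive-·poch⁻¹ : ∀ a c .{{_ : NonZero a}} .{{_ : NonZero c}} {h} → NonNegative h →
    (∀ i → i ℕ.< a → 0ℤ < h i) → Positive (h · poch -1ℤ a c ⁻¹)
positive-·poch⁻¹ a c = positive-·-periodic a (nonNegative-poch⁻¹ a c) (λ k → poch⁻¹-positive a c k)

positive-·poch⁻¹₂ : ∀ c .{{_ : NonZero c}} {h} → NonNegative h → 0ℤ < h 0 → 0ℤ < h 1 → Positive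
    (h · poch -1ℤ 2 c ⁻¹)
positive-·poch⁻¹₂ c p p₀ p₁ = positive-·poch⁻¹ 2 c p λ where
  0 _ → p₀
  1 _ → p₁
  (suc (suc _)) (s≤s (s≤s ()))

positive-oI₂ : Positive (o · I 2)
positive-oI₂ = positive-·poch⁻¹₂ 2 0≤o 0<1 (0<o-odd 0)

positive-oo : Positive (o · o)
positive-oo = positive-o· unital-o (0<o-odd 0)

positive-oφ : Positive (o · φ)
positive-oφ = positive-o· unital-φ 0<φ₁

positive-ov : Positive (o · v)
positive-ov = positive-o· unital-v 0<v₁

positive-vI₂ : Positive (v · I 2)
positive-vI₂ = positive-·poch⁻¹₂ 2 0≤v 0<v₀ 0<v₁

-- No `o` and no `I 2` is available here, only `I 6`, which reaches the multiples of 6. The degrees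
-- 0 to 5 are sums of one of 0, 1, 2 from `v · v` and one of 0, 1, 4 from `φ`.
positive-v²φI₆ : Positive (v · v · φ · I 6)
positive-v²φI₆ = positive-·poch⁻¹ 6 6 (nonNegative-· 0≤v² 0≤φ) (λ where
  0 _ → 0<-· 0 0 0≤v² 0≤φ v²₀ 0<φ₀
  1 _ → 0<-· 0 1 0≤v² 0≤φ v²₀ 0<φ₁
  2 _ → 0<-· 1 1 0≤v² 0≤φ v²₁ 0<φ₁
  3 _ → 0<-· 2 1 0≤v² 0≤φ v²₂ 0<φ₁
  4 _ → 0<-· 0 4 0≤v² 0≤φ v²₀ 0<φ₄
  5 _ → 0<-· 1 4 0≤v² 0≤φ v²₁ 0<φ₄
  (suc (suc (suc (suc (suc (suc _)))))) (s≤s (s≤s (s≤s (s≤s (s≤s (s≤s ())))))))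
  where
  0≤v² = nonNegative-· 0≤v 0≤v
  v²₀ = 0<-· 0 0 0≤v 0≤v 0<v₀ 0<v₀
  v²₁ = 0<-· 0 1 0≤v 0≤v 0<v₀ 0<v₁
  v²₂ = 0<-· 1 1 0≤v 0≤v 0<v₁ 0<v₁

unital-R : Unital R
unital-R = unital-· (unital-poch⁻¹ 2 16) (unital-· (unital-poch⁻¹ 4 16) (unital-· (unital-poch⁻¹ 12 16)
  (unital-· (unital-poch⁻¹ 14 16) (unital-· (unital-poch 1 8) (unital-poch 7 8)))))

unital-R′ : Unital R′
unital-R′ = unital-· (unital-poch⁻¹ 4 16) (unital-· (unital-poch⁻¹ 6 16) (unital-· (unital-poch⁻¹ 10 16)
  (unital-· (unital-poch⁻¹ 12 16) (unital-· (unital-poch 3 8) (unital-poch 5 8)))))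

-- The factor `J 2` inside `R` reaches all even degrees, and one `φ` shifts them by 0 or 1.
positive-φ²R : Positive (φ · φ · R)
positive-φ²R = positive-resp
  (solve-series 3 (λ p j r → (p ⊗ j) ⊗ (p ⊗ r) ⊜ p ⊗ p ⊗ (j ⊗ r)) (λ _ → refl) φ (J 2) _)
  (positive-·ᵤ (positive-·poch⁻¹₂ 16 0≤φ 0<φ₀ 0<φ₁)
    (unital-· unital-φ (unital-· (unital-poch⁻¹ 4 16) (unital-· (unital-poch⁻¹ 12 16)
      (unital-· (unital-poch⁻¹ 14 16) (unital-· (unital-poch 1 8) (unital-poch 7 8)))))))

-- `R′` lacks `J 2`, so `J 4` takes over and the degrees 0 to 3 need a source. Three of them are
-- sums of two squares; 3 is not, and comes from the factor (-q³; q⁸)_∞ of `R′`.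
positive-φ²R′ : Positive (φ · φ · R′)
positive-φ²R′ = positive-resp
  (solve-series 7 (λ p j a b c x y → p ⊗ p ⊗ x ⊗ j ⊗ (a ⊗ (b ⊗ (c ⊗ y)))
        ⊜ p ⊗ p ⊗ (j ⊗ (a ⊗ (b ⊗ (c ⊗ (x ⊗ y))))))
    (λ _ → refl) φ (J 4) (J 6) (J 10) (J 12) (poch 1ℤ 3 8) (poch 1ℤ 5 8))
  (positive-·ᵤ (positive-·poch⁻¹ 4 16 (nonNegative-· 0≤φ² (nonNegative-poch 3 8)) (λ where
      0 _ → 0<-· 0 0 0≤φ² (nonNegative-poch 3 8) (0<-· 0 0 0≤φ 0≤φ 0<φ₀ 0<φ₀) 0<1
      1 _ → 0<-· 1 0 0≤φ² (nonNegative-poch 3 8) (0<-· 0 1 0≤φ 0≤φ 0<φ₀ 0<φ₁) 0<1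
      2 _ → 0<-· 2 0 0≤φ² (nonNegative-poch 3 8) (0<-· 1 1 0≤φ 0≤φ 0<φ₁ 0<φ₁) 0<1
      3 _ → 0<-· 0 3 0≤φ² (nonNegative-poch 3 8) (0<-· 0 0 0≤φ 0≤φ 0<φ₀ 0<φ₀) (poch-positive 3 8 0)
      (suc (suc (suc (suc _)))) (s≤s (s≤s (s≤s (s≤s ()))))))
    (unital-· (unital-poch⁻¹ 6 16)
        (unital-· (unital-poch⁻¹ 10 16) (unital-· (unital-poch⁻¹ 12 16) (unital-poch 5 8)))))
  where
  0≤φ² = nonNegative-· 0≤φ 0≤φ

-- q is not nonnegative, but v q / E₂ is a multiple of the theta series ∑ q^{n(3n+1)/2}.
positive-vqI₂²I₆² : Positive (v · q · (I 2 · I 2) · (I 6 · I 6))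
positive-vqI₂²I₆² = positive-resp eq
  (positive-·ᵤ (positive-·poch⁻¹₂ 2 (nonNegative-theta 1 2) 0<1 0<1)
    (unital-· (unital-· (unital-· u₆ u₆) (unital-· u₆ u₆))
        (unital-· (unital-poch⁻¹ 4 12) (unital-· (unital-poch⁻¹ 8 12) (unital-poch⁻¹ 6 12)))))
  where
  u₆ = unital-poch⁻¹ 6 6
  N K : ℕ → Series
  N a = poch -1ℤ a 12
  K a = N a ⁻¹
  -- Two of the four `I 6` belong to the claim, the other two cancel `E 6 · E 6` from `theta₁₂·E₂`.
  -- `κ` cancels `N 4`, `N 8` and the `N 6` produced by `o₃·N₃₆`.
  i² j⁴ κ : Series
  i² = I 2 · I 2
  j⁴ = (I 6 · I 6) · (I 6 · I 6)
  κ  = K 4 · (K 8 · K 6)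
  NK : ∀ a → N a · K a ≗ 𝟙
  NK a = ·-inverse (N a) refl
  open ≗-Reasoning
  eq : theta 1ℤ 1 2 · I 2 · (j⁴ · κ) ≗ v · q · i² · (I 6 · I 6)
  eq = begin
    theta 1ℤ 1 2 · I 2 · (j⁴ · κ)
      ≈⟨ insert-EI _ 2 ⟩
    theta 1ℤ 1 2 · I 2 · (j⁴ · κ) · (E 2 · I 2)
      ≈⟨ insert o₃ q _ (·-inverse o₃ refl) ⟩
    theta 1ℤ 1 2 · I 2 · (j⁴ · κ) · (E 2 · I 2) · (o₃ · q)
      ≈⟨ solve-series 7 (λ t e i j k o q → t ⊗ i ⊗ (j ⊗ k) ⊗ (e ⊗ i) ⊗ (o ⊗ q)
            ⊜ (t ⊗ e) ⊗ o ⊗ (q ⊗ (i ⊗ i) ⊗ j ⊗ k)) (λ _ → refl)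
           (theta 1ℤ 1 2) (E 2) (I 2) j⁴ κ o₃ q ⟩
    (theta 1ℤ 1 2 · E 2) · o₃ · (q · i² · j⁴ · κ)
      ≈⟨ ·-congʳ (·-congʳ theta₁₂·E₂) ⟩
    w · poch -1ℤ 3 6 · (N 4 · N 8) · (E 6 · E 6) · o₃ · (q · i² · j⁴ · κ)
      ≈⟨ solve-series 6 (λ w n m e o r → w ⊗ n ⊗ m ⊗ e ⊗ o ⊗ r ⊜ w ⊗ (o ⊗ n) ⊗ m ⊗ e ⊗ r) (λ _ → refl)
           w (poch -1ℤ 3 6) (N 4 · N 8) (E 6 · E 6) o₃ (q · i² · j⁴ · κ) ⟩
    w · (o₃ · poch -1ℤ 3 6) · (N 4 · N 8) · (E 6 · E 6) · (q · i² · j⁴ · κ)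
      ≈⟨ ·-congʳ (·-congʳ (·-congʳ (·-cong (≗-sym v≗w) o₃·N₃₆))) ⟩
    v · N 6 · (N 4 · N 8) · (E 6 · E 6) · (q · i² · j⁴ · κ)
      ≈⟨ solve-series 12 (λ v n₆ n₄ n₈ e q i j k₄ k₈ k₆ z →
           v ⊗ n₆ ⊗ (n₄ ⊗ n₈) ⊗ (e ⊗ e) ⊗ (q ⊗ i ⊗ ((j ⊗ j) ⊗ (j ⊗ j)) ⊗ (k₄ ⊗ (k₈ ⊗ k₆)))
           ⊜ v ⊗ q ⊗ i ⊗ (j ⊗ j) ⊗ (e ⊗ j) ⊗ (e ⊗ j) ⊗ (n₄ ⊗ k₄) ⊗ (n₈ ⊗ k₈) ⊗ (n₆ ⊗ k₆)) (λ _ → refl)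
           v (N 6) (N 4) (N 8) (E 6) q i² (I 6) (K 4) (K 8) (K 6) 𝟙 ⟩
    v · q · i² · (I 6 · I 6) · (E 6 · I 6) · (E 6 · I 6) · (N 4 · K 4) · (N 8 · K 8) · (N 6 · K 6)
      ≈⟨ ≗-trans (≗-sym (insert (N 6) (K 6) _ (NK 6))) (≗-trans (≗-sym (insert (N 8) (K 8) _ (NK 8)))
            (≗-trans (≗-sym (insert (N 4) (K 4) _ (NK 4)))
           (≗-trans (≗-sym (insert-EI _ 6)) (≗-sym (insert-EI _ 6))))) ⟩
    v · q · i² · (I 6 · I 6) ∎

reduce : ∀ {X} g k → X ≗ g · (E 2 · I 2) ^ˢ k → Positive g → Positive X
reduce g k p 0<g = positive-resp (≗-sym (≗-trans p (cancel-EI^ k 2 g))) 0<g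

-- Case by case: regrouping into factors known to be positive

signs⟨2,0,0,-2⟩ : Signs (product (+ 2) 0 0ℤ 2)
signs⟨2,0,0,-2⟩ = signs⟨2,m,0,-s⟩ 0 2 (reduce (o · I 2) 1
  (solve-series 3 (λ o e i → ((o ⊗ e) ⊗ numeral 1) ⊗ (i ⊗ (i ⊗ numeral 1))
        ⊜ o ⊗ i ⊗ ((e ⊗ i) ⊗ numeral 1)) (λ _ → refl) o (E 2) (I 2))
  positive-oI₂)

signs⟨2,1,0,-2⟩ : Signs (product (+ 2) 1 0ℤ 2)
signs⟨2,1,0,-2⟩ = signs⟨2,m,0,-s⟩ 1 2 (reduce (o · o) 2
  (solve-series 3 (λ o e i → ((o ⊗ e) ⊗ ((o ⊗ e) ⊗ numeral 1)) ⊗ (i ⊗ (i ⊗ numeral 1))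
        ⊜ o ⊗ o ⊗ ((e ⊗ i) ⊗ ((e ⊗ i) ⊗ numeral 1))) (λ _ → refl) o (E 2) (I 2))
  positive-oo)

-- One `E 2` finds no `I 2` to cancel. It has coefficients of both signs and is absorbed with two
-- `o` into `φ`, as in every later case with such a surplus.
signs⟨2,2,0,-2⟩ : Signs (product (+ 2) 2 0ℤ 2)
signs⟨2,2,0,-2⟩ = signs⟨2,m,0,-s⟩ 2 2 (reduce (o · φ) 2
  (solve-series 3 (λ o e i → ((o ⊗ e) ⊗ ((o ⊗ e) ⊗ ((o ⊗ e) ⊗ numeral 1))) ⊗ (i ⊗ (i ⊗ numeral 1))
        ⊜ o ⊗ (o ⊗ o ⊗ e) ⊗ ((e ⊗ i) ⊗ ((e ⊗ i) ⊗ numeral 1))) (λ _ → refl) o (E 2) (I 2))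
  positive-oφ)

signs⟨2,3,0,-3⟩ : Signs (product (+ 2) 3 0ℤ 3)
signs⟨2,3,0,-3⟩ = signs⟨2,m,0,-s⟩ 3 3 (reduce (o · o · φ) 3
  (solve-series 3 (λ o e i → ((o ⊗ e) ⊗ ((o ⊗ e) ⊗ ((o ⊗ e) ⊗ ((o ⊗ e) ⊗ numeral 1)))) ⊗
      (i ⊗ (i ⊗ (i ⊗ numeral 1)))
        ⊜ o ⊗ o ⊗ (o ⊗ o ⊗ e) ⊗ ((e ⊗ i) ⊗ ((e ⊗ i) ⊗ ((e ⊗ i) ⊗ numeral 1)))) (λ _ → refl) o (E 2) (I 2))
  (positive-·ᵤ positive-oo unital-φ))

signs⟨2,4,0,-3⟩ : Signs (product (+ 2) 4 0ℤ 3)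
signs⟨2,4,0,-3⟩ = signs⟨2,m,0,-s⟩ 4 3 (reduce (o · φ · φ) 3
  (solve-series 3 (λ o e i → ((o ⊗ e) ⊗ ((o ⊗ e) ⊗ ((o ⊗ e) ⊗ ((o ⊗ e) ⊗ ((o ⊗ e) ⊗ numeral 1))))) ⊗
      (i ⊗ (i ⊗ (i ⊗ numeral 1)))
        ⊜ o ⊗ (o ⊗ o ⊗ e) ⊗ (o ⊗ o ⊗ e) ⊗ ((e ⊗ i) ⊗ ((e ⊗ i) ⊗ ((e ⊗ i) ⊗ numeral 1))))
        (λ _ → refl) o (E 2) (I 2))
  (positive-·ᵤ positive-oφ unital-φ))

-- One of the two `o` is spent on the signed theta series. The `E 2` gained in exchange cancels an
-- `I 2`, which leaves `o · I 2`.
signs⟨1,1,0,-3⟩ : Signs (product (+ 1) 1 0ℤ 3)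
signs⟨1,1,0,-3⟩ = signs⟨1,m,0,-s⟩ 1 3 (reduce _ 3 (reduction theta₃₅·o) (positive-·ᵤ positive-oI₂ unital-R))
    (reduce _ 3 (reduction theta₇₁·o) (positive-·ᵤ positive-oI₂ unital-R′))
  where
  reduction : ∀ {T U} → T · o ≗ E 2 · U → (o · E 2) ^ˢ 2 · I 2 ^ˢ 4 · T ≗ o · I 2 · U · (E 2 · I 2) ^ˢ 3
  reduction {T} {U} p = begin
    (o · E 2) ^ˢ 2 · I 2 ^ˢ 4 · T
      ≈⟨ solve-series 4 (λ o e i t → ((o ⊗ e) ⊗ ((o ⊗ e) ⊗ numeral 1)) ⊗ (i ⊗ (i ⊗ (i ⊗ (i ⊗ numeral 1)))) ⊗ t
            ⊜ ((e ⊗ (e ⊗ numeral 1)) ⊗ (o ⊗ numeral 1) ⊗ (i ⊗ (i ⊗ (i ⊗ (i ⊗ numeral 1))))) ⊗ (t ⊗ o))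
            (λ _ → refl) o (E 2) (I 2) T ⟩
    (E 2 ^ˢ 2 · o ^ˢ 1 · I 2 ^ˢ 4) · (T · o)
      ≈⟨ ·-congˡ p ⟩
    (E 2 ^ˢ 2 · o ^ˢ 1 · I 2 ^ˢ 4) · (E 2 · U)
      ≈⟨ solve-series 4 (λ o e i u →
          ((e ⊗ (e ⊗ numeral 1)) ⊗ (o ⊗ numeral 1) ⊗ (i ⊗ (i ⊗ (i ⊗ (i ⊗ numeral 1))))) ⊗ (e ⊗ u)
            ⊜ o ⊗ i ⊗ u ⊗ ((e ⊗ i) ⊗ ((e ⊗ i) ⊗ ((e ⊗ i) ⊗ numeral 1)))) (λ _ → refl) o (E 2) (I 2) U ⟩
    o · I 2 · U · (E 2 · I 2) ^ˢ 3 ∎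
    where open ≗-Reasoning

signs⟨1,2,0,-3⟩ : Signs (product (+ 1) 2 0ℤ 3)
signs⟨1,2,0,-3⟩ = signs⟨1,m,0,-s⟩ 2 3 (reduce _ 4 (reduction theta₃₅·o) (positive-·ᵤ positive-oo unital-R))
    (reduce _ 4 (reduction theta₇₁·o) (positive-·ᵤ positive-oo unital-R′))
  where
  reduction : ∀ {T U} → T · o ≗ E 2 · U → (o · E 2) ^ˢ 3 · I 2 ^ˢ 4 · T ≗ o · o · U · (E 2 · I 2) ^ˢ 4
  reduction {T} {U} p = begin
    (o · E 2) ^ˢ 3 · I 2 ^ˢ 4 · T
      ≈⟨ solve-series 4 (λ o e i t → ((o ⊗ e) ⊗ ((o ⊗ e) ⊗ ((o ⊗ e) ⊗ numeral 1))) ⊗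
          (i ⊗ (i ⊗ (i ⊗ (i ⊗ numeral 1)))) ⊗ t
            ⊜ ((e ⊗ (e ⊗ (e ⊗ numeral 1))) ⊗ (o ⊗ (o ⊗ numeral 1)) ⊗ (i ⊗ (i ⊗ (i ⊗ (i ⊗ numeral 1))))) ⊗
                (t ⊗ o))
            (λ _ → refl) o (E 2) (I 2) T ⟩
    (E 2 ^ˢ 3 · o ^ˢ 2 · I 2 ^ˢ 4) · (T · o)
      ≈⟨ ·-congˡ p ⟩
    (E 2 ^ˢ 3 · o ^ˢ 2 · I 2 ^ˢ 4) · (E 2 · U)
      ≈⟨ solve-series 4 (λ o e i u →
          ((e ⊗ (e ⊗ (e ⊗ numeral 1))) ⊗ (o ⊗ (o ⊗ numeral 1)) ⊗ (i ⊗ (i ⊗ (i ⊗ (i ⊗ numeral 1))))) ⊗ (e ⊗ u)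
            ⊜ o ⊗ o ⊗ u ⊗ ((e ⊗ i) ⊗ ((e ⊗ i) ⊗ ((e ⊗ i) ⊗ ((e ⊗ i) ⊗ numeral 1)))))
            (λ _ → refl) o (E 2) (I 2) U ⟩
    o · o · U · (E 2 · I 2) ^ˢ 4 ∎
    where open ≗-Reasoning

signs⟨1,3,0,-3⟩ : Signs (product (+ 1) 3 0ℤ 3)
signs⟨1,3,0,-3⟩ = signs⟨1,m,0,-s⟩ 3 3 (reduce _ 4 (reduction theta₃₅·o) (positive-·ᵤ positive-oφ unital-R))
    (reduce _ 4 (reduction theta₇₁·o) (positive-·ᵤ positive-oφ unital-R′))
  where
  reduction : ∀ {T U} → T · o ≗ E 2 · U → (o · E 2) ^ˢ 4 · I 2 ^ˢ 4 · T ≗ o · φ · U · (E 2 · I 2) ^ˢ 4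
  reduction {T} {U} p = begin
    (o · E 2) ^ˢ 4 · I 2 ^ˢ 4 · T
      ≈⟨ solve-series 4 (λ o e i t → ((o ⊗ e) ⊗ ((o ⊗ e) ⊗ ((o ⊗ e) ⊗ ((o ⊗ e) ⊗ numeral 1)))) ⊗
          (i ⊗ (i ⊗ (i ⊗ (i ⊗ numeral 1)))) ⊗ t
            ⊜ ((e ⊗ (e ⊗ (e ⊗ (e ⊗ numeral 1)))) ⊗ (o ⊗ (o ⊗ (o ⊗ numeral 1))) ⊗
                (i ⊗ (i ⊗ (i ⊗ (i ⊗ numeral 1))))) ⊗ (t ⊗ o))
            (λ _ → refl) o (E 2) (I 2) T ⟩
    (E 2 ^ˢ 4 · o ^ˢ 3 · I 2 ^ˢ 4) · (T · o)
      ≈⟨ ·-congˡ p ⟩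
    (E 2 ^ˢ 4 · o ^ˢ 3 · I 2 ^ˢ 4) · (E 2 · U)
      ≈⟨ solve-series 4 (λ o e i u →
          ((e ⊗ (e ⊗ (e ⊗ (e ⊗ numeral 1)))) ⊗ (o ⊗ (o ⊗ (o ⊗ numeral 1))) ⊗
          (i ⊗ (i ⊗ (i ⊗ (i ⊗ numeral 1))))) ⊗ (e ⊗ u)
            ⊜ o ⊗ (o ⊗ o ⊗ e) ⊗ u ⊗ ((e ⊗ i) ⊗ ((e ⊗ i) ⊗ ((e ⊗ i) ⊗ ((e ⊗ i) ⊗ numeral 1)))))
            (λ _ → refl) o (E 2) (I 2) U ⟩
    o · φ · U · (E 2 · I 2) ^ˢ 4 ∎
    where open ≗-Reasoning

-- All five `o` are spent, one on the theta series and four on the two surplus `E 2`, so `R` and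
-- `R′` themselves have to help fill the gaps of `φ · φ`.
signs⟨1,4,0,-3⟩ : Signs (product (+ 1) 4 0ℤ 3)
signs⟨1,4,0,-3⟩ = signs⟨1,m,0,-s⟩ 4 3 (reduce _ 4 (reduction theta₃₅·o) positive-φ²R)
    (reduce _ 4 (reduction theta₇₁·o) positive-φ²R′)
  where
  reduction : ∀ {T U} → T · o ≗ E 2 · U → (o · E 2) ^ˢ 5 · I 2 ^ˢ 4 · T ≗ φ · φ · U · (E 2 · I 2) ^ˢ 4
  reduction {T} {U} p = begin
    (o · E 2) ^ˢ 5 · I 2 ^ˢ 4 · T
      ≈⟨ solve-series 4 (λ o e i t → ((o ⊗ e) ⊗ ((o ⊗ e) ⊗ ((o ⊗ e) ⊗ ((o ⊗ e) ⊗ ((o ⊗ e) ⊗ numeral 1))))) ⊗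
          (i ⊗ (i ⊗ (i ⊗ (i ⊗ numeral 1)))) ⊗ t
            ⊜ ((e ⊗ (e ⊗ (e ⊗ (e ⊗ (e ⊗ numeral 1))))) ⊗ (o ⊗ (o ⊗ (o ⊗ (o ⊗ numeral 1)))) ⊗
                (i ⊗ (i ⊗ (i ⊗ (i ⊗ numeral 1))))) ⊗ (t ⊗ o))
            (λ _ → refl) o (E 2) (I 2) T ⟩
    (E 2 ^ˢ 5 · o ^ˢ 4 · I 2 ^ˢ 4) · (T · o)
      ≈⟨ ·-congˡ p ⟩
    (E 2 ^ˢ 5 · o ^ˢ 4 · I 2 ^ˢ 4) · (E 2 · U)
      ≈⟨ solve-series 4 (λ o e i u →
          ((e ⊗ (e ⊗ (e ⊗ (e ⊗ (e ⊗ numeral 1))))) ⊗ (o ⊗ (o ⊗ (o ⊗ (o ⊗ numeral 1)))) ⊗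
          (i ⊗ (i ⊗ (i ⊗ (i ⊗ numeral 1))))) ⊗ (e ⊗ u)
            ⊜ (o ⊗ o ⊗ e) ⊗ (o ⊗ o ⊗ e) ⊗ u ⊗ ((e ⊗ i) ⊗ ((e ⊗ i) ⊗ ((e ⊗ i) ⊗ ((e ⊗ i) ⊗ numeral 1)))))
            (λ _ → refl) o (E 2) (I 2) U ⟩
    φ · φ · U · (E 2 · I 2) ^ˢ 4 ∎
    where open ≗-Reasoning

unital-I₆² : Unital (I 6 · I 6)
unital-I₆² = unital-· (unital-poch⁻¹ 6 6) (unital-poch⁻¹ 6 6)

-- A single `o` faces two factors `q`, so only one of them is absorbed into `v`; the other needs the
-- additional theta series.
signs⟨1,0,-1,-3⟩ : Signs (product (+ 1) 0 -1ℤ 3)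
signs⟨1,0,-1,-3⟩ = signs⟨1,m,-1,-s⟩ 0 3 (reduce (v · q · (I 2 · I 2) · (I 6 · I 6)) 1
  (solve-series 5 (λ o e i q j → ((o ⊗ e) ⊗ numeral 1) ⊗ (i ⊗ (i ⊗ (i ⊗ numeral 1))) ⊗ ((q ⊗ j) ⊗ (q ⊗ j))
        ⊜ (o ⊗ q) ⊗ q ⊗ (i ⊗ i) ⊗ (j ⊗ j) ⊗ ((e ⊗ i) ⊗ numeral 1)) (λ _ → refl) o (E 2) (I 2) q (I 6))
  positive-vqI₂²I₆²)

signs⟨1,1,-1,-3⟩ : Signs (product (+ 1) 1 -1ℤ 3)
signs⟨1,1,-1,-3⟩ = signs⟨1,m,-1,-s⟩ 1 3 (reduce (v · I 2 · (v · (I 6 · I 6))) 2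
  (solve-series 5 (λ o e i q j → ((o ⊗ e) ⊗ ((o ⊗ e) ⊗ numeral 1)) ⊗ (i ⊗ (i ⊗ (i ⊗ numeral 1))) ⊗
      ((q ⊗ j) ⊗ (q ⊗ j))
        ⊜ (o ⊗ q) ⊗ i ⊗ ((o ⊗ q) ⊗ (j ⊗ j)) ⊗ ((e ⊗ i) ⊗ ((e ⊗ i) ⊗ numeral 1)))
        (λ _ → refl) o (E 2) (I 2) q (I 6))
  (positive-·ᵤ positive-vI₂ (unital-· unital-v unital-I₆²)))

signs⟨1,2,-1,-3⟩ : Signs (product (+ 1) 2 -1ℤ 3)
signs⟨1,2,-1,-3⟩ = signs⟨1,m,-1,-s⟩ 2 3 (reduce (o · v · (v · (I 6 · I 6))) 3
  (solve-series 5 (λ o e i q j → ((o ⊗ e) ⊗ ((o ⊗ e) ⊗ ((o ⊗ e) ⊗ numeral 1))) ⊗ (i ⊗ (i ⊗ (i ⊗ numeral 1))) ⊗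
      ((q ⊗ j) ⊗ (q ⊗ j))
        ⊜ o ⊗ (o ⊗ q) ⊗ ((o ⊗ q) ⊗ (j ⊗ j)) ⊗ ((e ⊗ i) ⊗ ((e ⊗ i) ⊗ ((e ⊗ i) ⊗ numeral 1))))
        (λ _ → refl) o (E 2) (I 2) q (I 6))
  (positive-·ᵤ positive-ov (unital-· unital-v unital-I₆²)))

signs⟨1,3,-1,-3⟩ : Signs (product (+ 1) 3 -1ℤ 3)
signs⟨1,3,-1,-3⟩ = signs⟨1,m,-1,-s⟩ 3 3 (reduce (v · v · φ · I 6 · I 6) 3
  (solve-series 5 (λ o e i q j → ((o ⊗ e) ⊗ ((o ⊗ e) ⊗ ((o ⊗ e) ⊗ ((o ⊗ e) ⊗ numeral 1)))) ⊗
      (i ⊗ (i ⊗ (i ⊗ numeral 1))) ⊗ ((q ⊗ j) ⊗ (q ⊗ j))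
        ⊜ (o ⊗ q) ⊗ (o ⊗ q) ⊗ (o ⊗ o ⊗ e) ⊗ j ⊗ j ⊗ ((e ⊗ i) ⊗ ((e ⊗ i) ⊗ ((e ⊗ i) ⊗ numeral 1))))
        (λ _ → refl) o (E 2) (I 2) q (I 6))
  (positive-·ᵤ positive-v²φI₆ (unital-poch⁻¹ 6 6)))

-- The exponent -4 leaves just one surplus `E 2`: of the five `o`, two go to it, two to the factors
-- `q`, and one remains to reach the odd degrees.
signs⟨1,4,-1,-4⟩ : Signs (product (+ 1) 4 -1ℤ 4)
signs⟨1,4,-1,-4⟩ = signs⟨1,m,-1,-s⟩ 4 4 (reduce (o · v · (v · φ · (I 6 · I 6))) 4
  (solve-series 5 (λ o e i q j → ((o ⊗ e) ⊗ ((o ⊗ e) ⊗ ((o ⊗ e) ⊗ ((o ⊗ e) ⊗ ((o ⊗ e) ⊗ numeral 1))))) ⊗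
      (i ⊗ (i ⊗ (i ⊗ (i ⊗ numeral 1)))) ⊗ ((q ⊗ j) ⊗ (q ⊗ j))
        ⊜ o ⊗ (o ⊗ q) ⊗ ((o ⊗ q) ⊗ (o ⊗ o ⊗ e) ⊗ (j ⊗ j)) ⊗ ((e ⊗ i) ⊗ ((e ⊗ i) ⊗ ((e ⊗ i)
        ⊗ ((e ⊗ i) ⊗ numeral 1)))))
        (λ _ → refl) o (E 2) (I 2) q (I 6))
  (positive-·ᵤ positive-ov (unital-· (unital-· unital-v unital-φ) unital-I₆²)))

signs-of-a : ∀ t₁ t₂ t₃ t₄ →
  Signs (integerPower (E 1) t₁ ·
      (integerPower (E 2) t₂ · (integerPower (E 3) t₃ · (integerPower (E 4) t₄ · 𝟙)))) →
  Signs (a (t₁ ∷ t₂ ∷ t₃ ∷ t₄ ∷ []))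
signs-of-a t₁ t₂ t₃ t₄ s n =
  let a≗g = a≗ t₁ t₂ t₃ t₄; (p₀ , p₁ , p₂ , p₃) = s n in
  subst (0ℤ <_) (sym (a≗g (4 ℕ.* n))) p₀ ,
  subst (_< 0ℤ) (sym (a≗g (4 ℕ.* n ℕ.+ 1))) p₁ ,
  subst (_< 0ℤ) (sym (a≗g (4 ℕ.* n ℕ.+ 2))) p₂ ,
  subst (0ℤ <_) (sym (a≗g (4 ℕ.* n ℕ.+ 3))) p₃

open import Data.Nat.Base using (_+_; _*_)

theorem4p4 : ∀ t₁ t₂ t₃ t₄ → (t₁ , t₂ , t₃ , t₄) ∈ S₆ → ∀ n →
    let t = t₁ ∷ t₂ ∷ t₃ ∷ t₄ ∷ [] in
    a t (4 * n) > 0ℤ ×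
    a t (4 * n + 1) < 0ℤ ×
    a t (4 * n + 2) < 0ℤ ×
    a t (4 * n + 3) > 0ℤ
theorem4p4 t₁ t₂ t₃ t₄ (here refl) =
  signs-of-a t₁ t₂ t₃ t₄ signs⟨1,0,-1,-3⟩
theorem4p4 t₁ t₂ t₃ t₄ (there (here refl)) =
  signs-of-a t₁ t₂ t₃ t₄ signs⟨1,1,-1,-3⟩
theorem4p4 t₁ t₂ t₃ t₄ (there (there (here refl))) =
  signs-of-a t₁ t₂ t₃ t₄ signs⟨1,2,-1,-3⟩
theorem4p4 t₁ t₂ t₃ t₄ (there (there (there (here refl)))) =
  signs-of-a t₁ t₂ t₃ t₄ signs⟨1,3,-1,-3⟩
theorem4p4 t₁ t₂ t₃ t₄ (there (there (there (there (here refl))))) =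
  signs-of-a t₁ t₂ t₃ t₄ signs⟨1,4,-1,-4⟩
theorem4p4 t₁ t₂ t₃ t₄ (there (there (there (there (there (here refl)))))) =
  signs-of-a t₁ t₂ t₃ t₄ signs⟨2,0,0,-2⟩
theorem4p4 t₁ t₂ t₃ t₄ (there (there (there (there (there (there (here refl))))))) =
  signs-of-a t₁ t₂ t₃ t₄ signs⟨2,1,0,-2⟩
theorem4p4 t₁ t₂ t₃ t₄ (there (there (there (there (there (there (there (here refl)))))))) =
  signs-of-a t₁ t₂ t₃ t₄ signs⟨2,2,0,-2⟩
theorem4p4 t₁ t₂ t₃ t₄ (there (there (there (there (there (there (there (there (here refl))))))))) =
  signs-of-a t₁ t₂ t₃ t₄ signs⟨2,3,0,-3⟩
theorem4p4 t₁ t₂ t₃ t₄ (there (there (there (there (there (there (there (there (there (here refl)))))))))) =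
  signs-of-a t₁ t₂ t₃ t₄ signs⟨2,4,0,-3⟩
theorem4p4 t₁ t₂ t₃ t₄ (there (there (there (there (there (there (there (there (there (there (here refl))))))))))) =
  signs-of-a t₁ t₂ t₃ t₄ signs⟨1,1,0,-3⟩
theorem4p4 t₁ t₂ t₃ t₄ (there (there (there (there (there (there (there (there (there (there (there (here refl)))))))))))) =
  signs-of-a t₁ t₂ t₃ t₄ signs⟨1,2,0,-3⟩
theorem4p4 t₁ t₂ t₃ t₄ (there (there (there (there (there (there (there (there (there (there (there (there (here refl))))))))))))) =
  signs-of-a t₁ t₂ t₃ t₄ signs⟨1,3,0,-3⟩
theorem4p4 t₁ t₂ t₃ t₄ (there (there (there (there (there (there (there (there (there (there (there (there (there (here refl)))))))))))))) =
  signs-of-a t₁ t₂ t₃ t₄ signs⟨1,4,0,-3⟩
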